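{- Let $d\ge 2$, $n\ge 3$, and let $H$ be a two-dimensional subspace of $\mathbb R^d$ with orthonormal basis $\{u,v\}$. Define $p:[n]\to\mathbb R^d$ by \[ p(k)=\cos\frac{2(k-1)\pi}{n}\,u+\sin\frac{2(k-1)\pi}{n}\,v,\qquad 1\le k\le n. \] Then the spectrum of the stiffness matrix $L(K_n,p)$ is \[ \operatorname{Spec}(L(K_n,p))=\left\{n^{(1)},\ \left(\frac n2\right)^{(2n-4)},\ 0^{(n(d-2)+3)}\right\}, \] where superscripts denote algebraic multiplicities.
   Context: Here $[n]=\{1,\dots,n\}$ is the vertex set of the complete graph $K_n$, and $\|\cdot\|$ is the Euclidean norm. For $p:[n]\to\mathbb R^d$ and $1\le i<j\le n$ let \[ d_{ij}=\frac{p(i)-p(j)}{\|p(i)-p(j)\|}\ \text{ if } p(i)\ne p(j),\qquad d_{ij}=0\ \text{ if } p(i)=p(j). \] Let $1_1,\dots,1_n$ be the standard basis of $\mathbb R^n$ and let $\mathbf v_{ij}=(1_i-1_j)\otimes d_{ij}\in\mathbb R^{dn}$ (Kronecker product). The normalized rigidity matrix $R(K_n,p)$ is the $dn\times\binom n2$ matrix whose columns are the vectors $\mathbf v_{ij}$, $1\le i<j\le n$. The stiffness matrix is $L(K_n,p)=R(K_n,p)R(K_n,p)^T$, a real symmetric positive semidefinite $dn\times dn$ matrix. -}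

module Defs where

open import Algebra.Bundles using (CommutativeRing; Semiring)
import Algebra.Definitions.RawSemiring as RawSemiringDefs
open import Data.Bool.Base using (if_then_else_)
open import Data.Fin.Base using (Fin; zero; suc; toℕ; punchIn; remQuot)
open import Data.Fin.Properties as Fin using (all?)
open import Data.List.Base as List using (List; []; _∷_; length; allFin; cartesianProduct; filter)
open import Data.List.Relation.Unary.All using (All)
open import Data.List.Relation.Unary.AllPairs using (AllPairs)
open import Data.List.Relation.Unary.Any using (Any)
open import Data.Nat.Base as ℕ using (ℕ; zero; suc; _!)
open import Data.Nat.ListAction using () renaming (sum to listSum)
open import Data.Product.Base using (Σ; ∃; _×_; _,_; proj₁; proj₂)
open import Data.Vec.Functional using (Vector)
open import Function.Base using (_∘_)
open import Function.Bundles using (_⇔_)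
open import Level using (Level; _⊔_) renaming (suc to lsuc)
open import Relation.Binary.Core using (Rel)
open import Relation.Binary.Definitions using (Decidable)
open import Relation.Binary.PropositionalEquality.Core using (_≡_)
open import Relation.Binary.Structures using (IsStrictTotalOrder)
import Relation.Binary.Construct.StrictToNonStrict as NonStrict
open import Relation.Nullary.Decidable.Core using (Dec; does)
open import Relation.Unary using (Pred)

-- An axiomatic presentation of ℝ.  Classically it is unique up to a unique
-- isomorphism; the trichotomy and the suprema make it a classical ℝ.
record CompleteOrderedField (c ℓ : Level) : Set (lsuc (c ⊔ ℓ)) where
  infix 4 _<_ _≤_
  infix 9 _⁻¹
  field
    commutativeRing : CommutativeRing c ℓ

  open CommutativeRing commutativeRing public renaming (zero to *-zero)

  -- n · x is the n-fold sum of x.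
  open RawSemiringDefs (Semiring.rawSemiring semiring) public
    using (_^_; sum) renaming (_×_ to infixr 8 _·_)

  field
    _<_                : Rel Carrier ℓ
    isStrictTotalOrder : IsStrictTotalOrder _≈_ _<_
    0≉1                : 0# ≉ 1#
    -- The value of 0# ⁻¹ is unspecified.
    _⁻¹                : Carrier → Carrier
    ⁻¹-cong            : ∀ {x y} → x ≈ y → x ⁻¹ ≈ y ⁻¹
    ⁻¹-inverseʳ        : ∀ x → x ≉ 0# → x * x ⁻¹ ≈ 1#
    +-monoˡ-<          : ∀ x y z → x < y → x + z < y + z
    *-pos              : ∀ x y → 0# < x → 0# < y → 0# < x * y

  _≤_ : Rel Carrier ℓ
  _≤_ = NonStrict._≤_ _≈_ _<_

  _≟_ : Decidable _≈_
  _≟_ = IsStrictTotalOrder._≟_ isStrictTotalOrder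

  -- "Every t < s is exceeded by a member of P" is the classical form of
  -- "no t < s is an upper bound of P" that yields a witness.
  IsSupremum : Pred Carrier (c ⊔ ℓ) → Carrier → Set (c ⊔ ℓ)
  IsSupremum P s = (∀ y → P y → y ≤ s) × (∀ t → t < s → ∃ λ y → P y × t < y)

  field
    supremum : (P : Pred Carrier (c ⊔ ℓ)) → ∃ P →
               (∃ λ b → ∀ y → P y → y ≤ b) → ∃ (IsSupremum P)

  fromℕ : ℕ → Carrier
  fromℕ n = n · 1#

  infix 4 _⟶_ _HasSum_
  _⟶_ : (ℕ → Carrier) → Carrier → Set (c ⊔ ℓ)
  s ⟶ l = ∀ ε → 0# < ε → ∃ λ N → ∀ m → N ℕ.≤ m →
            (- ε < s m - l) × (s m - l < ε)

  _HasSum_ : (ℕ → Carrier) → Carrier → Set (c ⊔ ℓ)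
  a HasSum l = (λ N → sum {N} (a ∘ toℕ)) ⟶ l

-- Each of these functions and constants is determined uniquely by its
-- specification (√ only on non-negative arguments).
record ElementaryFunctions {c ℓ : Level} (R : CompleteOrderedField c ℓ) : Set (c ⊔ ℓ) where
  open CompleteOrderedField R
  field
    √     : Carrier → Carrier
    √-def : ∀ x → 0# ≤ x → (0# ≤ √ x) × (√ x * √ x ≈ x)

    cos sin : Carrier → Carrier
    cos-def : ∀ x →
      (λ k → (- 1#) ^ k * x ^ (2 ℕ.* k) * (fromℕ ((2 ℕ.* k) !)) ⁻¹) HasSum cos x
    sin-def : ∀ x →
      (λ k → (- 1#) ^ k * x ^ suc (2 ℕ.* k) * (fromℕ (suc (2 ℕ.* k) !)) ⁻¹) HasSum sin x

    -- π is the least positive zero of sin.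
    π       : Carrier
    π-pos   : 0# < π
    sin-π   : sin π ≈ 0#
    π-least : ∀ x → 0# < x → sin x ≈ 0# → π ≤ x

module LinearAlgebra {c ℓ : Level} (R : CompleteOrderedField c ℓ) where
  open CompleteOrderedField R

  Matrix : ℕ → ℕ → Set c
  Matrix m n = Fin m → Fin n → Carrier

  infixl 7 _⊡_ _*ᴹ_ _⊗_
  infixl 6 _-ⱽ_
  infix 4 _≈ⱽ?_
  infix 9 _ᵀ

  _⊡_ : ∀ {n} → Vector Carrier n → Vector Carrier n → Carrier
  v ⊡ w = sum λ i → v i * w i

  _-ⱽ_ : ∀ {n} → Vector Carrier n → Vector Carrier n → Vector Carrier n
  (v -ⱽ w) i = v i - w i

  _≈ⱽ?_ : ∀ {n} (v w : Vector Carrier n) → Dec (∀ i → v i ≈ w i)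
  v ≈ⱽ? w = all? λ i → v i ≟ w i

  _*ᴹ_ : ∀ {m n o} → Matrix m n → Matrix n o → Matrix m o
  (A *ᴹ B) i k = sum λ j → A i j * B j k

  _ᵀ : ∀ {m n} → Matrix m n → Matrix n m
  (A ᵀ) i j = A j i

  basis : ∀ {n} → Fin n → Vector Carrier n
  basis i k = if does (i Fin.≟ k) then 1# else 0#

  _⊗_ : ∀ {m n} → Vector Carrier m → Vector Carrier n → Vector Carrier (m ℕ.* n)
  _⊗_ {m} {n} v w r = v (proj₁ (remQuot {m} n r)) * w (proj₂ (remQuot {m} n r))

  -- Laplace expansion along the first row.
  det : ∀ {n} → Matrix n n → Carrier
  det {zero}  A = 1#
  det {suc n} A = sum λ j →
    (- 1#) ^ toℕ j * A zero j * det (λ i k → A (suc i) (punchIn j k))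

  -- A polynomial is given by its coefficients, constant term first.
  eval : List Carrier → Carrier → Carrier
  eval []      x = 0#
  eval (a ∷ q) x = a + x * eval q x

  -- The characteristic polynomial as a function on the (infinite) field.
  charPoly : ∀ {n} → Matrix n n → Carrier → Carrier
  charPoly A x = det λ i j → x * basis i j - A i j

  IsEigenvalue : ∀ {n} → Matrix n n → Carrier → Set (c ⊔ ℓ)
  IsEigenvalue {n} A μ = Σ (Vector Carrier n) λ v →
    (∃ λ i → v i ≉ 0#) × (∀ i → sum (λ j → A i j * v j) ≈ μ * v i)

  HasAlgebraicMultiplicity : ∀ {n} → Matrix n n → Carrier → ℕ → Set (c ⊔ ℓ)
  HasAlgebraicMultiplicity A μ m = Σ (List Carrier) λ q →
    (∀ x → charPoly A x ≈ (x - μ) ^ m * eval q x) × (eval q μ ≉ 0#)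

  record HasSpectrum {n : ℕ} (A : Matrix n n) (spec : List (Carrier × ℕ)) : Set (c ⊔ ℓ) where
    field
      distinct       : AllPairs (λ (μ , _) (ν , _) → μ ≉ ν) spec
      eigenvalues    : ∀ μ → IsEigenvalue A μ ⇔ Any (λ (ν , _) → μ ≈ ν) spec
      multiplicities : All (λ (μ , m) → HasAlgebraicMultiplicity A μ m) spec
      -- The characteristic polynomial splits over the field.
      exhaustive     : listSum (List.map proj₂ spec) ≡ n

  record Subspace (d : ℕ) : Set (lsuc (c ⊔ ℓ)) where
    field
      Member    : Pred (Vector Carrier d) (c ⊔ ℓ)
      resp      : ∀ {v w} → (∀ i → v i ≈ w i) → Member v → Member w
      0-closed  : Member (λ _ → 0#)
      +-closed  : ∀ {v w} → Member v → Member w → Member (λ i → v i + w i)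
      *-closed  : ∀ a {v} → Member v → Member (λ i → a * v i)

  -- {u, v} is an orthonormal basis of H; in particular dim H = 2.
  record IsOrthonormalBasis {d : ℕ} (H : Subspace d) (u v : Vector Carrier d) : Set (c ⊔ ℓ) where
    open Subspace H
    field
      u∈H   : Member u
      v∈H   : Member v
      u⊡u≈1 : u ⊡ u ≈ 1#
      v⊡v≈1 : v ⊡ v ≈ 1#
      u⊡v≈0 : u ⊡ v ≈ 0#
      spans : ∀ {w} → Member w → ∃ λ a → ∃ λ b → ∀ i → w i ≈ a * u i + b * v i

-- The pairs i < j, that is, the edges of the complete graph on Fin n.
edges : ∀ n → List (Fin n × Fin n)
edges n = filter (λ (i , j) → i Fin.<? j) (cartesianProduct (allFin n) (allFin n))

module Rigidity {c ℓ : Level} {R : CompleteOrderedField c ℓ} (F : ElementaryFunctions R) where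
  open CompleteOrderedField R
  open ElementaryFunctions F
  open LinearAlgebra R

  ‖_‖ : ∀ {d} → Vector Carrier d → Carrier
  ‖ v ‖ = √ (v ⊡ v)

  direction : ∀ {d} → Vector Carrier d → Vector Carrier d → Vector Carrier d
  direction x y a =
    if does (x ≈ⱽ? y) then 0# else (x a - y a) * ‖ x -ⱽ y ‖ ⁻¹

  rigidityMatrix : ∀ {n d} → (Fin n → Vector Carrier d) →
                   Matrix (n ℕ.* d) (length (edges n))
  rigidityMatrix {n} {d} p r e = column (List.lookup (edges n) e) r
    where
    column : Fin n × Fin n → Vector Carrier (n ℕ.* d)
    column (i , j) = (basis i -ⱽ basis j) ⊗ direction (p i) (p j)

  stiffnessMatrix : ∀ {n d} → (Fin n → Vector Carrier d) → Matrix (n ℕ.* d) (n ℕ.* d)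
  stiffnessMatrix p = rigidityMatrix p *ᴹ rigidityMatrix p ᵀ

  -- Fin n starts at 0, so toℕ k stands for k - 1.
  regularPolygon : ∀ {d} n → Vector Carrier d → Vector Carrier d →
                   Fin n → Vector Carrier d
  regularPolygon n u v k a = cos θ * u a + sin θ * v a
    where
    θ : Carrier
    θ = fromℕ (2 ℕ.* toℕ k) * π * fromℕ n ⁻¹

{-# OPTIONS --safe #-}

-- Write z_k for the k-th vertex as a complex number in the plane H. On the unit circle (z − w)² = −|z − w|² z w, so the
-- projection onto the direction of the edge jk is half of the identity of H minus the reflection x ↦ z_j z_k x̄, which
-- is linear in z_j z_k. As Σ z_k = 0, the sum of these projections over k is n/2 times the identity of H, and
--   L = n/2 · (identity of Hⁿ) + ½ P Pᵀ − ½ T Tᵀ − ½ U Uᵀ − ½ V Vᵀ,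
-- where P = (z_k), T = (i z_k), U = (1), V = (i) are pairwise orthogonal vectors of Hⁿ of norm √n. The characteristic
-- polynomial follows by updating det (x I) with one eigenvector at a time: if qᵀM = μ qᵀ then
-- μ det (M + c q qᵀ) = (μ + c q·q) det M.
-- That z_k is the k-th power of a primitive n-th root of unity rests on the addition theorem, obtained from the Cauchy
-- product of the partial sums of Σ (i x)ᵏ / k!, and on the minimality of π.
module Submission where

open import Algebra.Bundles using (AbelianGroup; CommutativeRing; Semiring)
import Algebra.Construct.DirectProduct as DirectProduct
open import Algebra.Solver.Ring.AlmostCommutativeRing using (_-Raw-AlmostCommutative⟶_; fromCommutativeRing)
open import Data.Bool.Base using (true; false; if_then_else_)
open import Data.Fin.Base as Fin using (Fin; zero; suc; toℕ; punchIn; remQuot; _↑ˡ_; _↑ʳ_)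
open import Data.Fin.Properties as Fin using (punchInᵢ≢i; splitAt-↑ˡ; splitAt-↑ʳ)
open import Data.Integer.Base as ℤ using (ℤ; +_; -[1+_]; _⊖_; _◃_; ∣_∣; sign)
import Data.Integer.Properties as ℤ
open import Data.List.Base as List using (List; []; _∷_; _++_; allFin; cartesianProduct; filter; tabulate)
open import Data.List.Relation.Unary.All using ([]; _∷_)
open import Data.List.Relation.Unary.AllPairs using ([]; _∷_)
open import Data.List.Relation.Unary.Any using (Any; here; there)
open import Data.Maybe.Base using (just; nothing)
open import Data.Nat.Base as ℕ using (ℕ; zero; suc; _!)
import Data.Nat.Properties as ℕ
open import Data.Nat.Solver using (module +-*-Solver)
open import Data.Product.Base using (Σ; ∃; _×_; _,_; proj₁; proj₂)
open import Data.Sign.Base as Sign using (Sign)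
open import Data.Sum.Base using (_⊎_; inj₁; inj₂)
open import Data.Vec.Functional using (Vector; updateAt)
open import Data.Vec.Functional.Properties using (updateAt-updates; updateAt-minimal)
open import Defs
open import Function.Base using (_∘_; const; id)
open import Function.Bundles using (_⇔_; mk⇔)
open import Level using (Level; Lift; lift; _⊔_)
open import Relation.Binary.Bundles using (StrictPartialOrder)
import Relation.Binary.Construct.StrictToNonStrict as NonStrict
open import Relation.Binary.Definitions using (WeaklyDecidable; Tri; tri<; tri≈; tri>)
open import Relation.Binary.PropositionalEquality.Core as ≡ using (_≡_; _≢_)
open import Relation.Binary.Structures using (IsStrictTotalOrder)
open import Relation.Nullary.Decidable.Core using (Dec; yes; no; does)
open import Relation.Nullary.Negation.Core using (¬_; contradiction)
open import Relation.Unary using (Decidable; Pred)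

-- The update formula carries a factor μ that can be cancelled only where it is nonzero, so the
-- resulting identity says nothing about the characteristic polynomial at x = 0 and x = n/2. There
-- both sides are shown to vanish by exhibiting eigenvectors: the rotation T for 0, and the family
-- (z_k²) for n/2. The latter is orthogonal to P, T, U and V because Σ z_k = Σ z_k² = 0, and Σ z_k²
-- = 0 is where n ≥ 3 enters. The identity of Hⁿ is itself a sum of 2n orthonormal rank-one
-- matrices, so the same update leads from x I to x I - n/2 times that identity. Cosine and sine are
-- given only by their series, and even their compatibility with the equality of the field has to be
-- derived. All their properties therefore come from one source: the uniqueness of limits of the
-- partial sums of exp (i x).

-- Integer coefficients for the ring solver

module IntegerCoefficients {c ℓ} (A : CommutativeRing c ℓ) where
  open CommutativeRing A
  open import Algebra.Properties.Ring ring
  open import Algebra.Properties.AbelianGroup +-abelianGroup using (⁻¹-∙-comm)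
  open import Algebra.Properties.CommutativeSemigroup +-commutativeSemigroup using (interchange)
  -- With the optimised multiple, `1 · 1#` is definitionally `1#`, so `1-homo` is `refl` and
  -- `con (+ 1)` denotes `1#` itself.
  open import Algebra.Properties.Semiring.Mult.TCOptimised semiring renaming (_×_ to infixr 8 _·_)
  open import Relation.Binary.Reasoning.Setoid setoid

  ⟦_⟧ : ℤ → Carrier
  ⟦ + n      ⟧ = n · 1#
  ⟦ -[1+ n ] ⟧ = - (suc n · 1#)

  ⟦_⟧± : Sign → Carrier
  ⟦ Sign.+ ⟧± = 1#
  ⟦ Sign.- ⟧± = - 1#

  -‿homo : ∀ i → ⟦ ℤ.- i ⟧ ≈ - ⟦ i ⟧
  -‿homo (+ zero)  = sym -0#≈0#
  -‿homo (+ suc n) = refl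
  -‿homo -[1+ n ]  = sym (-‿involutive _)

  ⊖-homo : ∀ m n → ⟦ m ⊖ n ⟧ ≈ m · 1# - n · 1#
  ⊖-homo zero    zero    = sym (-‿inverseʳ _)
  ⊖-homo zero    (suc n) = sym (+-identityˡ _)
  ⊖-homo (suc m) zero    = sym (trans (+-congˡ -0#≈0#) (+-identityʳ _))
  ⊖-homo (suc m) (suc n) = begin
    ⟦ suc m ⊖ suc n ⟧                    ≡⟨ ≡.cong ⟦_⟧ (ℤ.[1+m]⊖[1+n]≡m⊖n m n) ⟩
    ⟦ m ⊖ n ⟧                            ≈⟨ ⊖-homo m n ⟩
    m · 1# - n · 1#                      ≈⟨ +-identityˡ _ ⟨
    0# + (m · 1# - n · 1#)               ≈⟨ +-congʳ (-‿inverseʳ 1#) ⟨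
    (1# - 1#) + (m · 1# - n · 1#)        ≈⟨ interchange _ _ _ _ ⟩
    (1# + m · 1#) + (- 1# - n · 1#)      ≈⟨ +-congˡ (⁻¹-∙-comm _ _) ⟩
    (1# + m · 1#) - (1# + n · 1#)        ≈⟨ +-cong (×-homo-+ 1# 1 m) (-‿cong (×-homo-+ 1# 1 n)) ⟨
    suc m · 1# - suc n · 1#              ∎

  +-homo : ∀ i j → ⟦ i ℤ.+ j ⟧ ≈ ⟦ i ⟧ + ⟦ j ⟧
  +-homo (+ m)      (+ n)      = ×-homo-+ 1# m n
  +-homo (+ m)      (-[1+ n ]) = ⊖-homo m (suc n)
  +-homo (-[1+ m ]) (+ n)      = trans (⊖-homo n (suc m)) (+-comm _ _)
  +-homo (-[1+ m ]) (-[1+ n ]) = begin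
    - ⟦ + suc (suc (m ℕ.+ n)) ⟧   ≡⟨ ≡.cong (λ k → - ⟦ + suc k ⟧) (ℕ.+-suc m n) ⟨
    - ⟦ + (suc m ℕ.+ suc n) ⟧     ≈⟨ -‿cong (×-homo-+ 1# (suc m) (suc n)) ⟩
    - (suc m · 1# + suc n · 1#)   ≈⟨ ⁻¹-∙-comm _ _ ⟨
    - (suc m · 1#) - suc n · 1#   ∎

  ◃-homo : ∀ s n → ⟦ s ◃ n ⟧ ≈ ⟦ s ⟧± * n · 1#
  ◃-homo s      zero    = sym (zeroʳ _)
  ◃-homo Sign.+ (suc n) = sym (*-identityˡ _)
  ◃-homo Sign.- (suc n) = sym (-1*x≈-x _)

  ±-homo : ∀ s t → ⟦ s Sign.* t ⟧± ≈ ⟦ s ⟧± * ⟦ t ⟧±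
  ±-homo Sign.+ t      = sym (*-identityˡ _)
  ±-homo Sign.- Sign.+ = sym (*-identityʳ _)
  ±-homo Sign.- Sign.- = sym (trans (-1*x≈-x _) (-‿involutive 1#))

  ⟦⟧-sign-abs : ∀ i → ⟦ i ⟧ ≈ ⟦ sign i ⟧± * ∣ i ∣ · 1#
  ⟦⟧-sign-abs (+ n)      = sym (*-identityˡ _)
  ⟦⟧-sign-abs (-[1+ n ]) = sym (-1*x≈-x _)

  *-homo : ∀ i j → ⟦ i ℤ.* j ⟧ ≈ ⟦ i ⟧ * ⟦ j ⟧
  *-homo i j = begin
    ⟦ i ℤ.* j ⟧                                            ≈⟨ ◃-homo (sign i Sign.* sign j) (∣ i ∣ ℕ.* ∣ j ∣) ⟩
    ⟦ sign i Sign.* sign j ⟧± * (∣ i ∣ ℕ.* ∣ j ∣) · 1#     ≈⟨ *-cong (±-homo (sign i) (sign j)) (×1-homo-* ∣ i ∣ ∣ j ∣) ⟩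
    (⟦ sign i ⟧± * ⟦ sign j ⟧±) * (∣ i ∣ · 1# * ∣ j ∣ · 1#) ≈⟨ *-interchange _ _ _ _ ⟩
    (⟦ sign i ⟧± * ∣ i ∣ · 1#) * (⟦ sign j ⟧± * ∣ j ∣ · 1#) ≈⟨ *-cong (⟦⟧-sign-abs i) (⟦⟧-sign-abs j) ⟨
    ⟦ i ⟧ * ⟦ j ⟧                                          ∎
    where open import Algebra.Properties.CommutativeSemigroup *-commutativeSemigroup
                 using () renaming (interchange to *-interchange)

  homomorphism : ℤ.+-*-rawRing -Raw-AlmostCommutative⟶ fromCommutativeRing A
  homomorphism = record
    { ⟦_⟧    = ⟦_⟧
    ; +-homo = +-homo
    ; *-homo = *-homo
    ; -‿homo = -‿homo
    ; 0-homo = refl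
    ; 1-homo = refl
    }

  _coeff≟_ : WeaklyDecidable (λ i j → ⟦ i ⟧ ≈ ⟦ j ⟧)
  i coeff≟ j with i ℤ.≟ j
  ... | yes i≡j = just (reflexive (≡.cong ⟦_⟧ i≡j))
  ... | no  _   = nothing

-- The solver's coefficients are integers because equality of coefficients must be decided by computation, which an
-- abstract ring does not allow.
module RingSolver {c ℓ} (A : CommutativeRing c ℓ) where
  open import Algebra.Solver.Ring ℤ.+-*-rawRing (fromCommutativeRing A)
    (IntegerCoefficients.homomorphism A) (IntegerCoefficients._coeff≟_ A) public
    using (solve; _:=_; _:+_; _:*_; _:-_; :-_; con)

-- Order, the Archimedean property and geometric decay

module OrderedField {c ℓ} (R : CompleteOrderedField c ℓ) where
  open CompleteOrderedField R
  open RingSolver commutativeRing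
  open import Algebra.Properties.Semiring.Mult semiring using (×-homo-+; ×1-homo-*)
  open import Algebra.Properties.Ring ring using (-0#≈0#)

  private module < = IsStrictTotalOrder isStrictTotalOrder

  open <  public using (compare) renaming (trans to <-trans; irrefl to <-irrefl)

  strictPartialOrder : StrictPartialOrder c ℓ ℓ
  strictPartialOrder = record { isStrictPartialOrder = <.isStrictPartialOrder }

  open import Relation.Binary.Reasoning.StrictPartialOrder strictPartialOrder

  ≤-trans : ∀ {x y z} → x ≤ y → y ≤ z → x ≤ z
  ≤-trans = NonStrict.trans _≈_ _<_ isEquivalence <.<-resp-≈ <-trans

  ≤-refl : ∀ {x} → x ≤ x
  ≤-refl = inj₂ refl

  ≤-reflexive : ∀ {x y} → x ≈ y → x ≤ y
  ≤-reflexive = inj₂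

  ≤-antisym : ∀ {x y} → x ≤ y → y ≤ x → x ≈ y
  ≤-antisym = NonStrict.antisym _≈_ _<_ isEquivalence <-trans <-irrefl

  ≤-total : ∀ x y → (x ≤ y) ⊎ (y ≤ x)
  ≤-total = NonStrict.total _≈_ _<_ compare

  <⇒≱ : ∀ {x y} → x < y → y ≤ x → ∀ {a} {A : Set a} → A
  <⇒≱ x<y (inj₁ y<x) = contradiction (<-trans x<y y<x) (<-irrefl refl)
  <⇒≱ x<y (inj₂ y≈x) = contradiction x<y (<-irrefl (sym y≈x))

  <⇒≉ : ∀ {x} → 0# < x → x ≉ 0#
  <⇒≉ 0<x x≈0 = <-irrefl (sym x≈0) 0<x

  <-resp : ∀ {x x′ y y′} → x ≈ x′ → y ≈ y′ → x < y → x′ < y′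
  <-resp x≈x′ y≈y′ x<y = proj₁ <.<-resp-≈ y≈y′ (proj₂ <.<-resp-≈ x≈x′ x<y)

  ≤-resp : ∀ {x x′ y y′} → x ≈ x′ → y ≈ y′ → x ≤ y → x′ ≤ y′
  ≤-resp x≈x′ y≈y′ (inj₁ x<y) = inj₁ (<-resp x≈x′ y≈y′ x<y)
  ≤-resp x≈x′ y≈y′ (inj₂ x≈y) = inj₂ (trans (sym x≈x′) (trans x≈y y≈y′))

  +-monoˡ-≤ : ∀ z {x y} → x ≤ y → x + z ≤ y + z
  +-monoˡ-≤ z (inj₁ x<y) = inj₁ (+-monoˡ-< _ _ z x<y)
  +-monoˡ-≤ z (inj₂ x≈y) = inj₂ (+-congʳ x≈y)

  +-mono-≤ : ∀ {w x y z} → w ≤ x → y ≤ z → w + y ≤ x + z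
  +-mono-≤ {w} {x} {y} {z} w≤x y≤z =
    ≤-trans (+-monoˡ-≤ y w≤x) (≤-resp (+-comm _ _) (+-comm _ _) (+-monoˡ-≤ x y≤z))

  0≤-+ : ∀ {x y} → 0# ≤ x → 0# ≤ y → 0# ≤ x + y
  0≤-+ 0≤x 0≤y = ≤-resp (+-identityˡ 0#) refl (+-mono-≤ 0≤x 0≤y)

  0≤-* : ∀ {x y} → 0# ≤ x → 0# ≤ y → 0# ≤ x * y
  0≤-* (inj₁ 0<x) (inj₁ 0<y) = inj₁ (*-pos _ _ 0<x 0<y)
  0≤-* (inj₁ 0<x) (inj₂ 0≈y) = inj₂ (sym (trans (*-congˡ (sym 0≈y)) (zeroʳ _)))
  0≤-* (inj₂ 0≈x) _          = inj₂ (sym (trans (*-congʳ (sym 0≈x)) (zeroˡ _)))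

  ≤⇒0≤- : ∀ {x y} → x ≤ y → 0# ≤ y - x
  ≤⇒0≤- {x} x≤y = ≤-resp (-‿inverseʳ x) refl (+-monoˡ-≤ (- x) x≤y)

  0≤-⇒≤ : ∀ {x y} → 0# ≤ y - x → x ≤ y
  0≤-⇒≤ {x} {y} 0≤y-x =
    ≤-resp (+-identityˡ x) (solve 2 (λ x y → (y :- x) :+ x := y) refl x y) (+-monoˡ-≤ x 0≤y-x)

  neg-mono-≤ : ∀ {x y} → x ≤ y → - y ≤ - x
  neg-mono-≤ {x} {y} x≤y =
    0≤-⇒≤ (≤-resp refl (solve 2 (λ x y → y :- x := (:- x) :- (:- y)) refl x y) (≤⇒0≤- x≤y))

  *-monoˡ-≤ : ∀ {x y z} → 0# ≤ z → x ≤ y → x * z ≤ y * z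
  *-monoˡ-≤ {x} {y} {z} 0≤z x≤y =
    0≤-⇒≤ (≤-resp refl (solve 3 (λ x y z → (y :- x) :* z := y :* z :- x :* z) refl x y z)
                  (0≤-* (≤⇒0≤- x≤y) 0≤z))

  *-monoʳ-≤ : ∀ {x y z} → 0# ≤ z → x ≤ y → z * x ≤ z * y
  *-monoʳ-≤ 0≤z x≤y = ≤-resp (*-comm _ _) (*-comm _ _) (*-monoˡ-≤ 0≤z x≤y)

  0≤x*x : ∀ x → 0# ≤ x * x
  0≤x*x x with ≤-total 0# x
  ... | inj₁ 0≤x = 0≤-* 0≤x 0≤x
  ... | inj₂ x≤0 = ≤-resp refl (solve 1 (λ x → (:- x) :* (:- x) := x :* x) refl x) (0≤-* 0≤-x 0≤-x)
    where
    0≤-x : 0# ≤ - x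
    0≤-x = ≤-resp -0#≈0# refl (neg-mono-≤ x≤0)

  0<1 : 0# < 1#
  0<1 with compare 0# 1#
  ... | tri< 0<1 _ _ = 0<1
  ... | tri≈ _ 0≈1 _ = contradiction 0≈1 0≉1
  ... | tri> _ _ 1<0 = <⇒≱ 1<0 (≤-resp refl (*-identityˡ 1#) (0≤x*x 1#))

  x*y≈0⇒y≈0 : ∀ {x y} → x ≉ 0# → x * y ≈ 0# → y ≈ 0#
  x*y≈0⇒y≈0 {x} {y} x≉0 xy≈0 = begin-equality
    y               ≈⟨ *-identityˡ y ⟨
    1# * y          ≈⟨ *-congʳ (⁻¹-inverseʳ x x≉0) ⟨
    x * x ⁻¹ * y    ≈⟨ solve 3 (λ x z y → x :* z :* y := z :* (x :* y)) refl x (x ⁻¹) y ⟩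
    x ⁻¹ * (x * y)  ≈⟨ *-congˡ xy≈0 ⟩
    x ⁻¹ * 0#       ≈⟨ zeroʳ _ ⟩
    0#              ∎

  *-cancelˡ : ∀ {x y z} → x ≉ 0# → x * y ≈ x * z → y ≈ z
  *-cancelˡ {x} {y} {z} x≉0 xy≈xz = begin-equality
    y            ≈⟨ solve 2 (λ y z → y := y :- z :+ z) refl y z ⟩
    y - z + z    ≈⟨ +-congʳ (x*y≈0⇒y≈0 x≉0 (begin-equality
      x * (y - z)    ≈⟨ solve 3 (λ x y z → x :* (y :- z) := x :* y :- x :* z) refl x y z ⟩
      x * y - x * z  ≈⟨ +-congʳ xy≈xz ⟩
      x * z - x * z  ≈⟨ -‿inverseʳ _ ⟩
      0#             ∎)) ⟩
    0# + z       ≈⟨ +-identityˡ z ⟩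
    z            ∎

  *-≉0 : ∀ {x y} → x ≉ 0# → y ≉ 0# → x * y ≉ 0#
  *-≉0 x≉0 y≉0 xy≈0 = y≉0 (x*y≈0⇒y≈0 x≉0 xy≈0)

  ^-≉0 : ∀ {x} n → x ≉ 0# → x ^ n ≉ 0#
  ^-≉0 zero    x≉0 1≈0 = 0≉1 (sym 1≈0)
  ^-≉0 (suc n) x≉0     = *-≉0 x≉0 (^-≉0 n x≉0)

  x*x≈0⇒x≈0 : ∀ {x} → x * x ≈ 0# → x ≈ 0#
  x*x≈0⇒x≈0 {x} xx≈0 with x ≟ 0#
  ... | yes x≈0 = x≈0
  ... | no  x≉0 = x*y≈0⇒y≈0 x≉0 xx≈0

  x*x+y≈0⇒x≈0 : ∀ {x y} → 0# ≤ y → x * x + y ≈ 0# → x ≈ 0#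
  x*x+y≈0⇒x≈0 {x} {y} 0≤y eq = x*x≈0⇒x≈0 (≤-antisym xx≤0 (0≤x*x x))
    where
    xx≤0 : x * x ≤ 0#
    xx≤0 = ≤-resp (+-identityʳ _) eq (+-mono-≤ ≤-refl 0≤y)

  ⁻¹-pos : ∀ {x} → 0# < x → 0# < x ⁻¹
  ⁻¹-pos {x} 0<x with compare 0# (x ⁻¹)
  ... | tri< 0<x⁻¹ _ _ = 0<x⁻¹
  ... | tri≈ _ 0≈x⁻¹ _ =
    contradiction (trans (sym (zeroʳ x)) (trans (*-congˡ 0≈x⁻¹) (⁻¹-inverseʳ x (<⇒≉ 0<x)))) 0≉1
  ... | tri> _ _ x⁻¹<0 =
    <⇒≱ 0<1 (≤-resp (⁻¹-inverseʳ x (<⇒≉ 0<x)) (zeroʳ x) (*-monoʳ-≤ (inj₁ 0<x) (inj₁ x⁻¹<0)))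

  0≤fromℕ : ∀ n → 0# ≤ fromℕ n
  0≤fromℕ zero    = ≤-refl
  0≤fromℕ (suc n) = 0≤-+ (inj₁ 0<1) (0≤fromℕ n)

  0<fromℕ : ∀ n → 0# < fromℕ (suc n)
  0<fromℕ n = begin-strict
    0#            <⟨ 0<1 ⟩
    1#            ≈⟨ +-identityʳ 1# ⟨
    1# + 0#       ≤⟨ +-mono-≤ ≤-refl (0≤fromℕ n) ⟩
    1# + fromℕ n  ∎

  fromℕ-mono-≤ : ∀ {m n} → m ℕ.≤ n → fromℕ m ≤ fromℕ n
  fromℕ-mono-≤ {n = n} ℕ.z≤n       = 0≤fromℕ n
  fromℕ-mono-≤         (ℕ.s≤s m≤n) = +-mono-≤ ≤-refl (fromℕ-mono-≤ m≤n)

  fromℕ-+ : ∀ m n → fromℕ (m ℕ.+ n) ≈ fromℕ m + fromℕ n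
  fromℕ-+ = ×-homo-+ 1#

  fromℕ-* : ∀ m n → fromℕ (m ℕ.* n) ≈ fromℕ m * fromℕ n
  fromℕ-* = ×1-homo-*

  fromℕ-^ : ∀ m n → fromℕ (m ℕ.^ n) ≈ fromℕ m ^ n
  fromℕ-^ m zero    = +-identityʳ 1#
  fromℕ-^ m (suc n) = trans (fromℕ-* m (m ℕ.^ n)) (*-congˡ (fromℕ-^ m n))

  -- For positive x the naturals not exceeding x include 0 and so have a supremum. Some n among them
  -- lies within 1 of it; then n + 1 exceeds the supremum and cannot be at most x.
  archimedean : ∀ x → ∃ λ n → x < fromℕ n
  archimedean x with compare x 0#
  ... | tri< x<0 _ _ = 0 , x<0
  ... | tri≈ _ x≈0 _ = 1 , <-resp (sym x≈0) refl (0<fromℕ 0)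
  ... | tri> _ _ 0<x = exceed (supremum P (0# , lift ((0 , refl) , inj₁ 0<x)) (x , λ { _ (lift (_ , y≤x)) → y≤x }))
    where
    P : Pred Carrier (c ⊔ ℓ)
    P y = Lift (c ⊔ ℓ) ((∃ λ n → y ≈ fromℕ n) × (y ≤ x))

    exceed : ∃ (IsSupremum P) → ∃ λ n → x < fromℕ n
    exceed (s , upper , approx) = beyond (approx (s - 1#) s-1<s)
      where
      s-1<s : s - 1# < s
      s-1<s = <-resp (+-identityˡ _) (solve 1 (λ s → con (+ 1) :+ (s :- con (+ 1)) := s) refl s)
                     (+-monoˡ-< 0# 1# (s - 1#) 0<1)

      beyond : (∃ λ y → P y × s - 1# < y) → ∃ λ n → x < fromℕ n
      beyond (y , lift ((n , y≈n) , _) , s-1<y) = suc n , x<n+1 (compare x (fromℕ (suc n)))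
        where
        s<n+1 : s < fromℕ (suc n)
        s<n+1 = <-resp (solve 1 (λ s → (s :- con (+ 1)) :+ con (+ 1) := s) refl s)
                       (trans (+-comm _ _) (+-congˡ y≈n)) (+-monoˡ-< _ _ 1# s-1<y)

        n+1≤x⇒x<n+1 : fromℕ (suc n) ≤ x → x < fromℕ (suc n)
        n+1≤x⇒x<n+1 n+1≤x = <⇒≱ s<n+1 (upper _ (lift ((suc n , refl) , n+1≤x)))

        x<n+1 : Tri (x < fromℕ (suc n)) (x ≈ fromℕ (suc n)) (fromℕ (suc n) < x) → x < fromℕ (suc n)
        x<n+1 (tri< x<n _ _) = x<n
        x<n+1 (tri≈ _ x≈n _) = n+1≤x⇒x<n+1 (inj₂ (sym x≈n))
        x<n+1 (tri> _ _ n<x) = n+1≤x⇒x<n+1 (inj₁ n<x)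

  ½ : Carrier
  ½ = fromℕ 2 ⁻¹

  ½+½≈1 : ½ + ½ ≈ 1#
  -- `fromℕ 2` unfolds to `1# + (1# + 0#)`, which the solver expression has to match literally.
  ½+½≈1 = trans (solve 1 (λ h → h :+ h := (con (+ 1) :+ (con (+ 1) :+ con (+ 0))) :* h) refl ½)
                (⁻¹-inverseʳ (fromℕ 2) (<⇒≉ (0<fromℕ 1)))

  0<½ : 0# < ½
  0<½ = ⁻¹-pos (0<fromℕ 1)

  0<½^ : ∀ n → 0# < ½ ^ n
  0<½^ zero    = 0<1
  0<½^ (suc n) = *-pos _ _ 0<½ (0<½^ n)

  -- The linear factor is what turns the Archimedean property into decay of ½ ^ n. The induction
  -- step adds one more ½ ^ n ≤ 1 and then halves the total.
  n*½^n≤1 : ∀ n → fromℕ n * ½ ^ n ≤ 1#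
  ½^n≤1   : ∀ n → ½ ^ n ≤ 1#
  ½≤1     : ½ ≤ 1#

  ½≤1 = begin
    ½         ≈⟨ +-identityʳ ½ ⟨
    ½ + 0#    ≤⟨ +-mono-≤ ≤-refl (inj₁ 0<½) ⟩
    ½ + ½     ≈⟨ ½+½≈1 ⟩
    1#        ∎

  ½^n≤1 zero    = ≤-refl
  ½^n≤1 (suc n) = begin
    ½ * ½ ^ n  ≤⟨ *-monoʳ-≤ (inj₁ 0<½) (½^n≤1 n) ⟩
    ½ * 1#     ≈⟨ *-identityʳ ½ ⟩
    ½          ≤⟨ ½≤1 ⟩
    1#         ∎

  n*½^n≤1 zero    = ≤-resp (sym (zeroˡ _)) refl (inj₁ 0<1)
  n*½^n≤1 (suc n) = begin
    (1# + fromℕ n) * (½ * ½ ^ n)    ≈⟨ solve 3 (λ m h p → (con (+ 1) :+ m) :* (h :* p) := h :* (p :+ m :* p)) refl (fromℕ n) ½ (½ ^ n) ⟩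
    ½ * (½ ^ n + fromℕ n * ½ ^ n)   ≤⟨ *-monoʳ-≤ (inj₁ 0<½) (+-mono-≤ (½^n≤1 n) (n*½^n≤1 n)) ⟩
    ½ * (1# + 1#)                   ≈⟨ solve 1 (λ h → h :* (con (+ 1) :+ con (+ 1)) := h :+ h) refl ½ ⟩
    ½ + ½                           ≈⟨ ½+½≈1 ⟩
    1#                              ∎

  -- With N above b / ε, the product b · ½ ^ m is at most ε · (m · ½ ^ m) for m ≥ N.
  geometric-null : ∀ b ε → 0# < ε → ∃ λ N → ∀ m → N ℕ.≤ m → b * ½ ^ m ≤ ε
  geometric-null b ε 0<ε with N , b/ε<N ← archimedean (b * ε ⁻¹) = N , λ m N≤m → begin
    b * ½ ^ m                ≈⟨ *-congʳ (*-identityʳ b) ⟨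
    b * 1# * ½ ^ m           ≈⟨ *-congʳ (*-congˡ (⁻¹-inverseʳ ε (<⇒≉ 0<ε))) ⟨
    b * (ε * ε ⁻¹) * ½ ^ m   ≈⟨ solve 4 (λ b e i p → b :* (e :* i) :* p := (b :* i) :* (e :* p)) refl b ε (ε ⁻¹) (½ ^ m) ⟩
    b * ε ⁻¹ * (ε * ½ ^ m)   ≤⟨ *-monoˡ-≤ (0≤-* (inj₁ 0<ε) (inj₁ (0<½^ m))) (≤-trans (inj₁ b/ε<N) (fromℕ-mono-≤ N≤m)) ⟩
    fromℕ m * (ε * ½ ^ m)    ≈⟨ solve 3 (λ n e p → n :* (e :* p) := e :* (n :* p)) refl (fromℕ m) ε (½ ^ m) ⟩
    ε * (fromℕ m * ½ ^ m)    ≤⟨ *-monoʳ-≤ (inj₁ 0<ε) (n*½^n≤1 m) ⟩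
    ε * 1#                   ≈⟨ *-identityʳ ε ⟩
    ε                        ∎

-- Complex numbers as pairs

module GaussianNumbers {c ℓ} (A : CommutativeRing c ℓ) where
  open CommutativeRing A
  open RingSolver A

  gaussianRing : CommutativeRing c ℓ
  gaussianRing = record
    { Carrier = Carrier × Carrier
    ; _≈_ = G._≈_
    ; _+_ = G._∙_
    ; _*_ = λ z w → proj₁ z * proj₁ w - proj₂ z * proj₂ w , proj₁ z * proj₂ w + proj₂ z * proj₁ w
    ; -_ = G._⁻¹
    ; 0# = G.ε
    ; 1# = 1# , 0#
    ; isCommutativeRing = record
      { isRing = record
        { +-isAbelianGroup = G.isAbelianGroup
        ; *-cong = λ (a≈ , b≈) (x≈ , y≈) →
            +-cong (*-cong a≈ x≈) (-‿cong (*-cong b≈ y≈)) , +-cong (*-cong a≈ y≈) (*-cong b≈ x≈)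
        ; *-assoc = λ (a , b) (x , y) (u , v) →
            solve 6 (λ a b x y u v → (a :* x :- b :* y) :* u :- (a :* y :+ b :* x) :* v
                                   := a :* (x :* u :- y :* v) :- b :* (x :* v :+ y :* u)) refl a b x y u v ,
            solve 6 (λ a b x y u v → (a :* x :- b :* y) :* v :+ (a :* y :+ b :* x) :* u
                                   := a :* (x :* v :+ y :* u) :+ b :* (x :* u :- y :* v)) refl a b x y u v
        ; *-identity =
            (λ (a , b) → solve 2 (λ a b → con (+ 1) :* a :- con (+ 0) :* b := a) refl a b ,
                         solve 2 (λ a b → con (+ 1) :* b :+ con (+ 0) :* a := b) refl a b) ,
            (λ (a , b) → solve 2 (λ a b → a :* con (+ 1) :- b :* con (+ 0) := a) refl a b ,
                         solve 2 (λ a b → a :* con (+ 0) :+ b :* con (+ 1) := b) refl a b)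
        ; distrib =
            (λ (a , b) (x , y) (u , v) →
              solve 6 (λ a b x y u v → a :* (x :+ u) :- b :* (y :+ v)
                                     := (a :* x :- b :* y) :+ (a :* u :- b :* v)) refl a b x y u v ,
              solve 6 (λ a b x y u v → a :* (y :+ v) :+ b :* (x :+ u)
                                     := (a :* y :+ b :* x) :+ (a :* v :+ b :* u)) refl a b x y u v) ,
            (λ (a , b) (x , y) (u , v) →
              solve 6 (λ a b x y u v → (x :+ u) :* a :- (y :+ v) :* b
                                     := (x :* a :- y :* b) :+ (u :* a :- v :* b)) refl a b x y u v ,
              solve 6 (λ a b x y u v → (x :+ u) :* b :+ (y :+ v) :* a
                                     := (x :* b :+ y :* a) :+ (u :* b :+ v :* a)) refl a b x y u v)
        }
      ; *-comm = λ (a , b) (x , y) →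
          solve 4 (λ a b x y → a :* x :- b :* y := x :* a :- y :* b) refl a b x y ,
          solve 4 (λ a b x y → a :* y :+ b :* x := x :* b :+ y :* a) refl a b x y
      }
    }
    where module G = AbelianGroup (DirectProduct.abelianGroup +-abelianGroup +-abelianGroup)

module CommutativeRingKit {c ℓ} (A : CommutativeRing c ℓ) where
  open CommutativeRing A public
  open RingSolver A public
  open import Algebra.Properties.CommutativeSemigroup *-commutativeSemigroup public using (x∙yz≈y∙xz; xy∙z≈y∙xz)
  open import Algebra.Properties.Semiring.Sum semiring public
  open import Algebra.Properties.Semiring.Exp semiring public
  open import Algebra.Properties.Semiring.Mult semiring public renaming (_×_ to infixr 8 _·_)

-- Complex bounds and sequences tending to zero

module ComplexNumbers {c ℓ} (R : CompleteOrderedField c ℓ) where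
  open CompleteOrderedField R
  open OrderedField R
  open RingSolver commutativeRing
  open import Algebra.Properties.Ring ring using (-‿involutive; -0#≈0#)
  open import Relation.Binary.Reasoning.StrictPartialOrder strictPartialOrder

  module ℂ = CommutativeRingKit (GaussianNumbers.gaussianRing commutativeRing)

  ℂ : Set c
  ℂ = ℂ.Carrier

  conj : ℂ → ℂ
  conj (a , b) = a , - b

  ∣_∣² : ℂ → Carrier
  ∣ a , b ∣² = a * a + b * b

  *-conj : ∀ z → z ℂ.* conj z ℂ.≈ (∣ z ∣² , 0#)
  *-conj (a , b) = solve 2 (λ a b → a :* a :- b :* (:- b) := a :* a :+ b :* b) refl a b ,
                   solve 2 (λ a b → a :* (:- b) :+ b :* a := con (+ 0)) refl a b

  ∣∣²≈0⇒≈0 : ∀ z → ∣ z ∣² ≈ 0# → z ℂ.≈ ℂ.0#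
  ∣∣²≈0⇒≈0 (a , b) eq = x*x+y≈0⇒x≈0 (0≤x*x b) eq , x*x+y≈0⇒x≈0 (0≤x*x a) (trans (+-comm _ _) eq)

  scale : ∀ r z → (r , 0#) ℂ.* z ℂ.≈ (r * proj₁ z , r * proj₂ z)
  scale r (x , y) = solve 3 (λ r x y → r :* x :- con (+ 0) :* y := r :* x) refl r x y ,
                    solve 3 (λ r x y → r :* y :+ con (+ 0) :* x := r :* y) refl r x y

  -- Multiplying by `conj z` replaces z by the nonzero real `∣ z ∣²`, which can be cancelled in each
  -- coordinate separately.
  z*w≈0⇒w≈0 : ∀ {z w} → ¬ z ℂ.≈ ℂ.0# → z ℂ.* w ℂ.≈ ℂ.0# → w ℂ.≈ ℂ.0#
  z*w≈0⇒w≈0 {z} {w} z≉0 zw≈0 =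
    x*y≈0⇒y≈0 N≉0 (proj₁ Nw≈0) , x*y≈0⇒y≈0 N≉0 (proj₂ Nw≈0)
    where
    N≉0 : ∣ z ∣² ≉ 0#
    N≉0 N≈0 = z≉0 (∣∣²≈0⇒≈0 z N≈0)
    Nw≈0 : (∣ z ∣² * proj₁ w , ∣ z ∣² * proj₂ w) ℂ.≈ ℂ.0#
    Nw≈0 = ℂ.trans (ℂ.sym (ℂ.trans (ℂ.*-congʳ {w} (*-conj z)) (scale ∣ z ∣² w)))
      (ℂ.trans (ℂ.xy∙z≈y∙xz z (conj z) w)
      (ℂ.trans (ℂ.*-congˡ {conj z} zw≈0) (ℂ.zeroʳ (conj z))))

  infix 4 _∈±_ _⊏_

  -- This is |x| ≤ b, written as two inequalities in place of an absolute value.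
  _∈±_ : Carrier → Carrier → Set ℓ
  x ∈± b = (- b ≤ x) × (x ≤ b)

  ∈±-resp : ∀ {x y b} → x ≈ y → x ∈± b → y ∈± b
  ∈±-resp x≈y (l , u) = ≤-resp refl x≈y l , ≤-resp x≈y refl u

  ∈±-mono : ∀ {x b d} → b ≤ d → x ∈± b → x ∈± d
  ∈±-mono b≤d (l , u) = ≤-trans (neg-mono-≤ b≤d) l , ≤-trans u b≤d

  ∈±-+ : ∀ {x y b d} → x ∈± b → y ∈± d → x + y ∈± b + d
  ∈±-+ {b = b} {d} (l , u) (l′ , u′) =
    ≤-resp (solve 2 (λ b d → (:- b) :+ (:- d) := :- (b :+ d)) refl b d) refl (+-mono-≤ l l′) , +-mono-≤ u u′

  ∈±-neg : ∀ {x b} → x ∈± b → - x ∈± b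
  ∈±-neg (l , u) = neg-mono-≤ u , ≤-resp refl (-‿involutive _) (neg-mono-≤ l)

  -- Twice bd + xy and twice bd - xy are sums of two products of nonnegative differences, which
  -- saves a case distinction on the signs of x and y.
  ∈±-* : ∀ {x y b d} → x ∈± b → y ∈± d → x * y ∈± b * d
  ∈±-* {x} {y} {b} {d} (l , u) (l′ , u′) =
    0≤-⇒≤ (0≤2x⇒0≤x (≤-resp refl
      (solve 4 (λ x y b d → (b :- x) :* (d :- y) :+ (x :- (:- b)) :* (y :- (:- d))
                          := (x :* y :- (:- (b :* d))) :+ (x :* y :- (:- (b :* d)))) refl x y b d)
      (0≤-+ (0≤-* (≤⇒0≤- u) (≤⇒0≤- u′)) (0≤-* (≤⇒0≤- l) (≤⇒0≤- l′))))) ,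
    0≤-⇒≤ (0≤2x⇒0≤x (≤-resp refl
      (solve 4 (λ x y b d → (b :- x) :* (y :- (:- d)) :+ (x :- (:- b)) :* (d :- y)
                          := (b :* d :- x :* y) :+ (b :* d :- x :* y)) refl x y b d)
      (0≤-+ (0≤-* (≤⇒0≤- u) (≤⇒0≤- l′)) (0≤-* (≤⇒0≤- l) (≤⇒0≤- u′)))))
    where
    0≤2x⇒0≤x : ∀ {x} → 0# ≤ x + x → 0# ≤ x
    0≤2x⇒0≤x {x} 0≤2x = begin
      0#               ≤⟨ 0≤-* (inj₁ 0<½) 0≤2x ⟩
      ½ * (x + x)      ≈⟨ solve 2 (λ h x → h :* (x :+ x) := (h :+ h) :* x) refl ½ x ⟩
      (½ + ½) * x      ≈⟨ *-congʳ ½+½≈1 ⟩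
      1# * x           ≈⟨ *-identityˡ x ⟩
      x                ∎

  0∈± : ∀ {b} → 0# ≤ b → 0# ∈± b
  0∈± 0≤b = ≤-resp refl -0#≈0# (neg-mono-≤ 0≤b) , 0≤b

  ∈±-bound : ∀ x → ∃ λ n → x ∈± fromℕ n
  ∈±-bound x with m , x<m ← archimedean x | n , -x<n ← archimedean (- x) =
    m ℕ.+ n , ≤-resp refl (-‿involutive x) (neg-mono-≤ (≤-trans (inj₁ -x<n) (fromℕ-mono-≤ (ℕ.m≤n+m n m)))) ,
    ≤-trans (inj₁ x<m) (fromℕ-mono-≤ (ℕ.m≤m+n m n))

  -- Both coordinates are bounded instead of the modulus. This avoids square roots at the price of a
  -- factor 2 in `⊏-*`; multiplication by a real number, as in `⊏-scale`, does not incur it.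
  _⊏_ : ℂ → Carrier → Set ℓ
  z ⊏ r = (proj₁ z ∈± r) × (proj₂ z ∈± r)

  ⊏-resp : ∀ {z w r} → z ℂ.≈ w → z ⊏ r → w ⊏ r
  ⊏-resp (a≈ , b≈) (a∈ , b∈) = ∈±-resp a≈ a∈ , ∈±-resp b≈ b∈

  ⊏-mono : ∀ {z r s} → r ≤ s → z ⊏ r → z ⊏ s
  ⊏-mono r≤s (a∈ , b∈) = ∈±-mono r≤s a∈ , ∈±-mono r≤s b∈

  ⊏-+ : ∀ {z w r s} → z ⊏ r → w ⊏ s → z ℂ.+ w ⊏ r + s
  ⊏-+ (a∈ , b∈) (x∈ , y∈) = ∈±-+ a∈ x∈ , ∈±-+ b∈ y∈

  ⊏-neg : ∀ {z r} → z ⊏ r → ℂ.- z ⊏ r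
  ⊏-neg (a∈ , b∈) = ∈±-neg a∈ , ∈±-neg b∈

  ⊏-* : ∀ {z w r s} → z ⊏ r → w ⊏ s → z ℂ.* w ⊏ r * s + r * s
  ⊏-* (a∈ , b∈) (x∈ , y∈) = ∈±-+ (∈±-* a∈ x∈) (∈±-neg (∈±-* b∈ y∈)) , ∈±-+ (∈±-* a∈ y∈) (∈±-* b∈ x∈)

  ⊏-scale : ∀ {x z r s} → x ∈± r → z ⊏ s → (x , 0#) ℂ.* z ⊏ r * s
  ⊏-scale {x} {z} x∈ (a∈ , b∈) = ⊏-resp (ℂ.sym (scale x z)) (∈±-* x∈ a∈ , ∈±-* x∈ b∈)

  ⊏-bound : ∀ z → ∃ λ n → z ⊏ fromℕ n
  ⊏-bound (a , b) with m , a∈ ← ∈±-bound a | n , b∈ ← ∈±-bound b =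
    m ℕ.+ n , ∈±-mono (fromℕ-mono-≤ (ℕ.m≤m+n m n)) a∈ , ∈±-mono (fromℕ-mono-≤ (ℕ.m≤n+m n m)) b∈

  Null : (ℕ → ℂ) → Set (c ⊔ ℓ)
  Null s = ∀ ε → 0# < ε → ∃ λ N → ∀ m → N ℕ.≤ m → s m ⊏ ε

  Null-resp : ∀ {s t} → (∀ n → s n ℂ.≈ t n) → Null s → Null t
  Null-resp s≈t s-null ε 0<ε with N , s⊏ε ← s-null ε 0<ε = N , λ m N≤m → ⊏-resp (s≈t m) (s⊏ε m N≤m)

  Null-+ : ∀ {s t} → Null s → Null t → Null (λ n → s n ℂ.+ t n)
  Null-+ {s} {t} s-null t-null ε 0<ε
    with M , s⊏ ← s-null (½ * ε) (*-pos _ _ 0<½ 0<ε) | N , t⊏ ← t-null (½ * ε) (*-pos _ _ 0<½ 0<ε) =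
    M ℕ.⊔ N , λ m M⊔N≤m → ⊏-mono (≤-reflexive 2*ε/2≈ε)
      (⊏-+ (s⊏ m (ℕ.m⊔n≤o⇒m≤o M N M⊔N≤m)) (t⊏ m (ℕ.m⊔n≤o⇒n≤o M N M⊔N≤m)))
    where
    2*ε/2≈ε : ½ * ε + ½ * ε ≈ ε
    2*ε/2≈ε = trans (sym (distribʳ ε ½ ½)) (trans (*-congʳ ½+½≈1) (*-identityˡ ε))

  Null-neg : ∀ {s} → Null s → Null (λ n → ℂ.- s n)
  Null-neg s-null ε 0<ε with N , s⊏ε ← s-null ε 0<ε = N , λ m N≤m → ⊏-neg (s⊏ε m N≤m)

  Null-* : ∀ {s t : ℕ → ℂ} n → (∀ m → s m ⊏ fromℕ n) → Null t → Null (λ m → s m ℂ.* t m)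
  Null-* {s} {t} n s⊏n t-null ε 0<ε =
    let N , t⊏ = t-null δ 0<δ in N , λ m N≤m → ⊏-mono bound (⊏-* (s⊏n m) (t⊏ m N≤m))
    where
    b δ : Carrier
    -- The product is bounded by 2nδ; dividing ε by 2n + 1 instead of 2n keeps the denominator
    -- positive for n = 0.
    b = fromℕ (suc (n ℕ.+ n))
    δ = ε * b ⁻¹
    0<δ : 0# < δ
    0<δ = *-pos _ _ 0<ε (⁻¹-pos (0<fromℕ (n ℕ.+ n)))
    bound : fromℕ n * δ + fromℕ n * δ ≤ ε
    bound = begin
      fromℕ n * δ + fromℕ n * δ     ≈⟨ distribʳ δ _ _ ⟨
      (fromℕ n + fromℕ n) * δ       ≈⟨ *-congʳ (fromℕ-+ n n) ⟨
      fromℕ (n ℕ.+ n) * δ           ≤⟨ *-monoˡ-≤ (inj₁ 0<δ) (fromℕ-mono-≤ (ℕ.n≤1+n (n ℕ.+ n))) ⟩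
      b * (ε * b ⁻¹)                ≈⟨ solve 3 (λ b e i → b :* (e :* i) := e :* (b :* i)) refl b ε (b ⁻¹) ⟩
      ε * (b * b ⁻¹)                ≈⟨ *-congˡ (⁻¹-inverseʳ b (<⇒≉ (0<fromℕ (n ℕ.+ n)))) ⟩
      ε * 1#                        ≈⟨ *-identityʳ ε ⟩
      ε                             ∎

  -- Uniqueness of limits: two limits of one sequence differ by a constant null sequence. A nonzero
  -- coordinate is refuted by taking half its absolute value for ε.
  Null-const⇒≈0 : ∀ {z} → Null (λ _ → z) → z ℂ.≈ ℂ.0#
  Null-const⇒≈0 {a , b} z-null = zero-if (λ ε 0<ε → proj₁ (small ε 0<ε)) , zero-if (λ ε 0<ε → proj₂ (small ε 0<ε))
    where
    small : ∀ ε → 0# < ε → (a , b) ⊏ ε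
    small ε 0<ε with N , z⊏ ← z-null ε 0<ε = z⊏ N ℕ.≤-refl

    ½x<x : ∀ {x} → 0# < x → ½ * x < x
    ½x<x {x} 0<x = begin-strict
      ½ * x            ≈⟨ +-identityˡ _ ⟨
      0# + ½ * x       <⟨ +-monoˡ-< 0# (½ * x) (½ * x) (*-pos _ _ 0<½ 0<x) ⟩
      ½ * x + ½ * x    ≈⟨ distribʳ x ½ ½ ⟨
      (½ + ½) * x      ≈⟨ *-congʳ ½+½≈1 ⟩
      1# * x           ≈⟨ *-identityˡ x ⟩
      x                ∎

    zero-if : ∀ {x} → (∀ ε → 0# < ε → x ∈± ε) → x ≈ 0#
    zero-if {x} small with compare x 0#
    ... | tri≈ _ x≈0 _ = x≈0
    ... | tri> _ _ 0<x = <⇒≱ (½x<x 0<x) (proj₂ (small _ (*-pos _ _ 0<½ 0<x)))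
    ... | tri< x<0 _ _ = <⇒≱ (½x<x 0<-x) (proj₂ (∈±-neg (small _ (*-pos _ _ 0<½ 0<-x))))
      where
      0<-x : 0# < - x
      0<-x = <-resp (-‿inverseʳ x) (+-identityˡ _) (+-monoˡ-< x 0# (- x) x<0)

-- Formal power series and Cauchy products

module Convolution {c ℓ} (A : CommutativeRing c ℓ) where
  open CommutativeRingKit A
  open import Relation.Binary.Reasoning.Setoid setoid

  partialSum : (ℕ → Carrier) → ℕ → Carrier
  partialSum a n = sum {n} (a ∘ toℕ)

  partialSum-cong : ∀ {a b} → (∀ k → a k ≈ b k) → ∀ n → partialSum a n ≈ partialSum b n
  partialSum-cong a≈b n = sum-cong-≋ {n} λ k → a≈b (toℕ k)

  partialSum-+ : ∀ a b n → partialSum (λ k → a k + b k) n ≈ partialSum a n + partialSum b n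
  partialSum-+ a b n = ∑-distrib-+ {n} (a ∘ toℕ) (b ∘ toℕ)

  partialSum-last : ∀ a n → partialSum a (suc n) ≈ partialSum a n + a n
  partialSum-last a zero    = +-comm _ _
  partialSum-last a (suc n) = trans (+-congˡ (partialSum-last (a ∘ suc) n)) (sym (+-assoc _ _ _))

  -- Taken in pairs, the terms of exp (i x) match the terms of the cosine and the sine series with
  -- the same index.
  partialSum-pairs : ∀ a n →
    partialSum a (n ℕ.* 2) ≈ partialSum (λ k → a (k ℕ.* 2) + a (suc (k ℕ.* 2))) n
  partialSum-pairs a zero    = refl
  partialSum-pairs a (suc n) = trans (sym (+-assoc _ _ _)) (+-congˡ (partialSum-pairs (λ k → a (2 ℕ.+ k)) n))

  -- The coefficient Σ a i · b (n - i) of the Cauchy product. Recursion that shifts a avoids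
  -- subtraction of indices.
  conv : (ℕ → Carrier) → (ℕ → Carrier) → ℕ → Carrier
  conv a b zero    = a 0 * b 0
  conv a b (suc n) = a 0 * b (suc n) + conv (a ∘ suc) b n

  conv-cong : ∀ {a a′ b b′} → (∀ k → a k ≈ a′ k) → (∀ k → b k ≈ b′ k) → ∀ n → conv a b n ≈ conv a′ b′ n
  conv-cong a≈ b≈ zero    = *-cong (a≈ 0) (b≈ 0)
  conv-cong a≈ b≈ (suc n) = +-cong (*-cong (a≈ 0) (b≈ (suc n))) (conv-cong (a≈ ∘ suc) b≈ n)

  conv-+ : ∀ a a′ b n → conv (λ k → a k + a′ k) b n ≈ conv a b n + conv a′ b n
  conv-+ a a′ b zero    = distribʳ _ _ _
  conv-+ a a′ b (suc n) = trans (+-congˡ (conv-+ (a ∘ suc) (a′ ∘ suc) b n))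
    (solve 5 (λ x y b p q → (x :+ y) :* b :+ (p :+ q) := (x :* b :+ p) :+ (y :* b :+ q)) refl _ _ _ _ _)

  conv-scale : ∀ x y a b n → conv (λ k → x * a k) (λ k → y * b k) n ≈ (x * y) * conv a b n
  conv-scale x y a b zero    = solve 4 (λ x y a b → (x :* a) :* (y :* b) := (x :* y) :* (a :* b)) refl x y (a 0) (b 0)
  conv-scale x y a b (suc n) = trans (+-congˡ (conv-scale x y (a ∘ suc) b n))
    (solve 5 (λ x y a b p → (x :* a) :* (y :* b) :+ (x :* y) :* p := (x :* y) :* (a :* b :+ p)) refl x y _ _ _)

  -- The coefficients of the formal derivative of the power series Σ a k tᵏ.
  derivative : (ℕ → Carrier) → ℕ → Carrier
  derivative a k = (suc k · 1#) * a (suc k)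

  -- In the step the weight is 1 + N. The N copies of the part without `a 0` go to the induction
  -- hypothesis for `a ∘ suc`; the remaining copy supplies the difference between
  -- `derivative a ∘ suc` and `derivative (a ∘ suc)`, which is `a (2 + k)`.
  leibniz : ∀ a b n → derivative (conv a b) n ≈ conv (derivative a) b n + conv a (derivative b) n
  leibniz a b zero = solve 5 (λ n a₀ a₁ b₀ b₁ → n :* (a₀ :* b₁ :+ a₁ :* b₀)
    := (n :* a₁) :* b₀ :+ a₀ :* (n :* b₁)) refl (1 · 1#) _ _ _ _
  leibniz a b (suc n) = begin
    (1# + N) * (a 0 * b (2 ℕ.+ n) + (a 1 * b (suc n) + W))
      ≈⟨ solve 4 (λ N x y W → (con (+ 1) :+ N) :* (x :+ (y :+ W)) := (con (+ 1) :+ N) :* x :+ (y :+ W) :+ N :* (y :+ W)) refl N _ _ _ ⟩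
    (1# + N) * (a 0 * b (2 ℕ.+ n)) + (a 1 * b (suc n) + W) + N * (a 1 * b (suc n) + W)
      ≈⟨ +-congˡ (leibniz (a ∘ suc) b n) ⟩
    (1# + N) * (a 0 * b (2 ℕ.+ n)) + (a 1 * b (suc n) + W) + (conv (derivative (a ∘ suc)) b n + conv (a ∘ suc) (derivative b) n)
      ≈⟨ solve 8 (λ N a₀ b₂ a₁ b₁ W P Q →
           (con (+ 1) :+ N) :* (a₀ :* b₂) :+ (a₁ :* b₁ :+ W) :+ (P :+ Q)
           := (((con (+ 1) :+ con (+ 0)) :* a₁) :* b₁ :+ (W :+ P)) :+ (a₀ :* ((con (+ 1) :+ N) :* b₂) :+ Q))
           refl N _ _ _ _ _ _ _ ⟩
    ((1# + 0#) * a 1 * b (suc n) + (W + conv (derivative (a ∘ suc)) b n)) + conv a (derivative b) (suc n)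
      ≈⟨ +-congʳ (+-congˡ (conv-+ (λ k → a (2 ℕ.+ k)) (derivative (a ∘ suc)) b n)) ⟨
    ((1# + 0#) * a 1 * b (suc n) + conv (λ k → a (2 ℕ.+ k) + derivative (a ∘ suc) k) b n) + conv a (derivative b) (suc n)
      ≈⟨ +-congʳ (+-congˡ (conv-cong {b = b} (λ k → solve 2 (λ N x → (con (+ 1) :+ N) :* x := x :+ N :* x) refl (suc k · 1#) (a (2 ℕ.+ k))) (λ _ → refl) n)) ⟨
    conv (derivative a) b (suc n) + conv a (derivative b) (suc n) ∎
    where
    N W : Carrier
    N = suc n · 1#
    W = conv (λ k → a (2 ℕ.+ k)) b n

  -- This takes the place of the binomial theorem. By the product rule the convolution solves f′ =
  -- (x + y) f with constant term 1, and this equation determines the coefficients recursively once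
  -- n + 1 can be cancelled; `cancel` provides that in a general ring.
  conv-exponential : (∀ n {x y} → (suc n · 1#) * x ≈ (suc n · 1#) * y → x ≈ y) →
    ∀ {x y} a b e → a 0 ≈ 1# → b 0 ≈ 1# → e 0 ≈ 1# →
    (∀ k → derivative a k ≈ x * a k) → (∀ k → derivative b k ≈ y * b k) → (∀ k → derivative e k ≈ (x + y) * e k) →
    ∀ n → conv a b n ≈ e n
  conv-exponential cancel a b e a₀ b₀ e₀ a′ b′ e′ zero = trans (*-cong a₀ b₀) (trans (*-identityˡ 1#) (sym e₀))
  conv-exponential cancel {x} {y} a b e a₀ b₀ e₀ a′ b′ e′ (suc n) = cancel n (begin
    derivative (conv a b) n                                     ≈⟨ leibniz a b n ⟩
    conv (derivative a) b n + conv a (derivative b) n           ≈⟨ +-cong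
      (conv-cong a′ (λ k → sym (*-identityˡ (b k))) n) (conv-cong (λ k → sym (*-identityˡ (a k))) b′ n) ⟩
    conv (λ k → x * a k) (λ k → 1# * b k) n + conv (λ k → 1# * a k) (λ k → y * b k) n
                                                                ≈⟨ +-cong (conv-scale x 1# a b n) (conv-scale 1# y a b n) ⟩
    (x * 1#) * conv a b n + (1# * y) * conv a b n               ≈⟨ solve 3 (λ x y z → (x :* con (+ 1)) :* z :+ (con (+ 1) :* y) :* z := (x :+ y) :* z) refl x y _ ⟩
    (x + y) * conv a b n                                        ≈⟨ *-congˡ (conv-exponential cancel a b e a₀ b₀ e₀ a′ b′ e′ n) ⟩
    (x + y) * e n                                               ≈⟨ e′ n ⟨
    derivative e n                                              ∎)

  -- The sum of the products a i · b j with i, j < n and i + j ≥ n.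
  cauchyDefect : (ℕ → Carrier) → (ℕ → Carrier) → ℕ → Carrier
  cauchyDefect a b n = partialSum a n * partialSum b n - partialSum (conv a b) n

  -- No pair with i = 0 satisfies i + j ≥ n + 1 and j ≤ n. After lowering i by one, the pairs with j
  -- < n form the defect of `a ∘ suc` and b, and the pairs with j = n form the last product.
  cauchyDefect-suc : ∀ a b n →
    cauchyDefect a b (suc n) ≈ cauchyDefect (a ∘ suc) b n + partialSum (a ∘ suc) n * b n
  cauchyDefect-suc a b n = begin
    (a 0 + A′) * B₊ - (a 0 * b 0 + partialSum (λ k → a 0 * b (suc k) + conv (a ∘ suc) b k) n)
      ≈⟨ +-cong (*-congˡ (partialSum-last b n)) (-‿cong (+-congˡ (partialSum-+ (λ k → a 0 * b (suc k)) (conv (a ∘ suc) b) n))) ⟩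
    (a 0 + A′) * (B + b n) - (a 0 * b 0 + (partialSum (λ k → a 0 * b (suc k)) n + C))
      ≈⟨ +-congˡ (-‿cong (+-congˡ (+-congʳ (*-distribˡ-sum {n} (a 0) (b ∘ suc ∘ toℕ))))) ⟨
    (a 0 + A′) * (B + b n) - (a 0 * b 0 + (a 0 * partialSum (b ∘ suc) n + C))
      ≈⟨ solve 7 (λ a₀ A′ B bₙ b₀ B′ C → (a₀ :+ A′) :* (B :+ bₙ) :- (a₀ :* b₀ :+ (a₀ :* B′ :+ C))
           := a₀ :* ((B :+ bₙ) :- (b₀ :+ B′)) :+ ((A′ :* B :- C) :+ A′ :* bₙ)) refl (a 0) A′ B (b n) (b 0) (partialSum (b ∘ suc) n) C ⟩
    a 0 * ((B + b n) - B₊) + (A′ * B - C + A′ * b n)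
      ≈⟨ +-congʳ (*-congˡ (+-congʳ (partialSum-last b n))) ⟨
    a 0 * (B₊ - B₊) + (A′ * B - C + A′ * b n)
      ≈⟨ solve 3 (λ a B r → a :* (B :- B) :+ r := r) refl (a 0) B₊ _ ⟩
    A′ * B - C + A′ * b n ∎
    where
    A′ B B₊ C : Carrier
    A′ = partialSum (a ∘ suc) n
    B  = partialSum b n
    B₊ = partialSum b (suc n)
    C  = partialSum (conv (a ∘ suc) b) n

-- Convergence of the exponential series

-- Up to exponent n the factor n ^ n suffices; beyond it each step multiplies the left side by n and
-- the factorial by at least n. Applied to an n ≥ 4 |x|, this bounds |x|ᵏ / k! by a multiple of ¼ ^
-- k.
n^k≤n^n*k! : ∀ n k → n ℕ.^ k ℕ.≤ n ℕ.^ n ℕ.* k !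
n^k≤n^n*k! zero    zero    = ℕ.≤-refl
n^k≤n^n*k! (suc n) zero    = ℕ.≤-trans (ℕ.m^n>0 (suc n) (suc n)) (ℕ.≤-reflexive (≡.sym (ℕ.*-identityʳ _)))
n^k≤n^n*k! n       (suc k) with suc k ℕ.≤? n
... | yes k<n@(ℕ.s≤s _) = ℕ.≤-trans (ℕ.^-monoʳ-≤ n k<n) (ℕ.m≤m*n (n ℕ.^ n) (suc k !) {{suc k ℕ.!≢0}})
... | no  k≮n = begin
  n ℕ.* n ℕ.^ k              ≤⟨ ℕ.*-mono-≤ (ℕ.≤-trans (ℕ.≤-pred (ℕ.≰⇒> k≮n)) (ℕ.n≤1+n k)) (n^k≤n^n*k! n k) ⟩
  suc k ℕ.* (n ℕ.^ n ℕ.* k !)  ≡⟨ ℕ.*-assoc (suc k) (n ℕ.^ n) (k !) ⟨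
  suc k ℕ.* n ℕ.^ n ℕ.* k !    ≡⟨ ≡.cong (ℕ._* k !) (ℕ.*-comm (suc k) (n ℕ.^ n)) ⟩
  n ℕ.^ n ℕ.* suc k ℕ.* k !    ≡⟨ ℕ.*-assoc (n ℕ.^ n) (suc k) (k !) ⟩
  n ℕ.^ n ℕ.* (suc k ℕ.* k !)  ∎
  where open ℕ.≤-Reasoning

module Exponential {c ℓ} (R : CompleteOrderedField c ℓ) where
  open CompleteOrderedField R
  open OrderedField R
  open ComplexNumbers R
  open RingSolver commutativeRing
  open Convolution (GaussianNumbers.gaussianRing commutativeRing)
  open import Algebra.Properties.CommutativeSemiring.Exp commutativeSemiring using (^-distrib-*)
  import Relation.Binary.Reasoning.StrictPartialOrder strictPartialOrder as ≤-Reasoning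
  import Relation.Binary.Reasoning.Setoid ℂ.setoid as ℂ-Reasoning

  fromℕ-!≉0 : ∀ k → fromℕ (k !) ≉ 0#
  fromℕ-!≉0 k k!≈0 with k ! in eq
  ... | zero  = contradiction eq (ℕ.m<n⇒n≢0 (ℕ.1≤n! k))
  ... | suc m = <⇒≉ (0<fromℕ m) k!≈0

  0<fromℕ-! : ∀ k → 0# < fromℕ (k !)
  0<fromℕ-! k with 0≤fromℕ (k !)
  ... | inj₁ 0<k! = 0<k!
  ... | inj₂ 0≈k! = contradiction (sym 0≈k!) (fromℕ-!≉0 k)

  term : Carrier → ℕ → ℂ
  term x k = (fromℕ (k !) ⁻¹ , 0#) ℂ.* (0# , x) ℂ.^ k

  ℂ-fromℕ : ∀ n → n ℂ.· ℂ.1# ℂ.≈ (fromℕ n , 0#)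
  ℂ-fromℕ zero    = ℂ.refl
  ℂ-fromℕ (suc n) = ℂ.trans (ℂ.+-congˡ {ℂ.1#} (ℂ-fromℕ n)) (refl , +-identityˡ 0#)

  ℂ-cancel : ∀ n {z w} → (suc n ℂ.· ℂ.1#) ℂ.* z ℂ.≈ (suc n ℂ.· ℂ.1#) ℂ.* w → z ℂ.≈ w
  ℂ-cancel n {z} {w} nz≈nw = *-cancelˡ n≉0 (proj₁ eq) , *-cancelˡ n≉0 (proj₂ eq)
    where
    n≉0 : fromℕ (suc n) ≉ 0#
    n≉0 = <⇒≉ (0<fromℕ n)
    to : ∀ z → (suc n ℂ.· ℂ.1#) ℂ.* z ℂ.≈ (fromℕ (suc n) * proj₁ z , fromℕ (suc n) * proj₂ z)
    to z = ℂ.trans (ℂ.*-congʳ {z} (ℂ-fromℕ (suc n))) (scale _ z)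
    eq : (fromℕ (suc n) * proj₁ z , fromℕ (suc n) * proj₂ z) ℂ.≈ (fromℕ (suc n) * proj₁ w , fromℕ (suc n) * proj₂ w)
    eq = ℂ.trans (ℂ.sym (to z)) (ℂ.trans nz≈nw (to w))

  x*[x*y]⁻¹≈y⁻¹ : ∀ {x y} → x ≉ 0# → y ≉ 0# → x * (x * y) ⁻¹ ≈ y ⁻¹
  x*[x*y]⁻¹≈y⁻¹ {x} {y} x≉0 y≉0 = *-cancelˡ y≉0 (begin-equality
    y * (x * (x * y) ⁻¹)  ≈⟨ solve 3 (λ x y i → y :* (x :* i) := (x :* y) :* i) refl x y _ ⟩
    x * y * (x * y) ⁻¹    ≈⟨ ⁻¹-inverseʳ _ (*-≉0 x≉0 y≉0) ⟩
    1#                    ≈⟨ ⁻¹-inverseʳ y y≉0 ⟨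
    y * y ⁻¹              ∎)
    where open ≤-Reasoning

  term-derivative : ∀ x k → derivative (term x) k ℂ.≈ (0# , x) ℂ.* term x k
  term-derivative x k = begin
    (suc k ℂ.· ℂ.1#) ℂ.* ((fromℕ (suc k !) ⁻¹ , 0#) ℂ.* ((0# , x) ℂ.* p))
      ≈⟨ ℂ.*-congʳ {(fromℕ (suc k !) ⁻¹ , 0#) ℂ.* ((0# , x) ℂ.* p)} (ℂ-fromℕ (suc k)) ⟩
    (fromℕ (suc k) , 0#) ℂ.* ((fromℕ (suc k !) ⁻¹ , 0#) ℂ.* ((0# , x) ℂ.* p))
      ≈⟨ ℂ.*-assoc (fromℕ (suc k) , 0#) (fromℕ (suc k !) ⁻¹ , 0#) ((0# , x) ℂ.* p) ⟨
    (fromℕ (suc k) , 0#) ℂ.* (fromℕ (suc k !) ⁻¹ , 0#) ℂ.* ((0# , x) ℂ.* p)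
      ≈⟨ ℂ.*-congʳ {(0# , x) ℂ.* p} (ℂ.trans (scale _ _) (1/k! , zeroʳ _)) ⟩
    (fromℕ (k !) ⁻¹ , 0#) ℂ.* ((0# , x) ℂ.* p)
      ≈⟨ ℂ.x∙yz≈y∙xz (fromℕ (k !) ⁻¹ , 0#) (0# , x) p ⟩
    (0# , x) ℂ.* term x k ∎
    where
    open ℂ-Reasoning
    p : ℂ
    p = (0# , x) ℂ.^ k
    1/k! : fromℕ (suc k) * fromℕ (suc k !) ⁻¹ ≈ fromℕ (k !) ⁻¹
    1/k! = trans (*-congˡ (⁻¹-cong (fromℕ-* (suc k) (k !)))) (x*[x*y]⁻¹≈y⁻¹ (<⇒≉ (0<fromℕ k)) (fromℕ-!≉0 k))

  term-zero : ∀ x → term x 0 ℂ.≈ ℂ.1#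
  term-zero x = ℂ.trans (scale _ ℂ.1#)
    (trans (*-comm _ _) (trans (*-congˡ (⁻¹-cong (+-identityʳ 1#))) 1*1⁻¹) , zeroʳ _)
    where
    1*1⁻¹ : 1# * 1# ⁻¹ ≈ 1#
    1*1⁻¹ = ⁻¹-inverseʳ 1# λ 1≈0 → 0≉1 (sym 1≈0)

  conv-term : ∀ x y n → conv (term x) (term y) n ℂ.≈ term (x + y) n
  conv-term x y = conv-exponential ℂ-cancel (term x) (term y) (term (x + y))
    (term-zero x) (term-zero y) (term-zero (x + y)) (term-derivative x) (term-derivative y)
    (λ k → ℂ.trans (term-derivative (x + y) k) (ℂ.*-congʳ {term (x + y) k} (sym (+-identityˡ 0#) , refl)))

  ¼ : Carrier
  ¼ = ½ * ½

  0≤¼^ : ∀ k → 0# ≤ ¼ ^ k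
  0≤¼^ zero    = inj₁ 0<1
  0≤¼^ (suc k) = 0≤-* (inj₁ (*-pos _ _ 0<½ 0<½)) (0≤¼^ k)

  0≤⇒∈± : ∀ {x b} → 0# ≤ x → x ≤ b → x ∈± b
  0≤⇒∈± 0≤x x≤b = ≤-trans (proj₁ (0∈± (≤-trans 0≤x x≤b))) 0≤x , x≤b

  -- Multiplication by the imaginary number i x exchanges the coordinates up to sign and scales them
  -- by x. Estimating with `⊏-*` instead would accumulate a factor 2 ^ k.
  ⊏-^ : ∀ {x b} → x ∈± b → ∀ k → (0# , x) ℂ.^ k ⊏ b ^ k
  ⊏-^ x∈ zero    = 0≤⇒∈± (inj₁ 0<1) ≤-refl , 0∈± (inj₁ 0<1)
  ⊏-^ {x} {b} x∈ (suc k) with u∈ , v∈ ← ⊏-^ x∈ k =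
    ∈±-resp (solve 3 (λ x u v → :- (x :* v) := con (+ 0) :* u :- x :* v) refl x _ _) (∈±-neg (∈±-* x∈ v∈)) ,
    ∈±-resp (solve 3 (λ x u v → x :* u := con (+ 0) :* v :+ x :* u) refl x _ _) (∈±-* x∈ u∈)

  -- With a natural bound n for 4 |x|, the term is at most (n ^ k / k!) · ¼ ^ k, and n ^ k / k! ≤ n
  -- ^ n.
  term-bound : ∀ x → ∃ λ n → ∀ k → term x k ⊏ fromℕ n * ¼ ^ k
  term-bound x with n , 4x∈ ← ∈±-bound (x * fromℕ 4) = n ℕ.^ n , λ k →
    ⊏-mono (bound k) (⊏-scale (0≤⇒∈± (inj₁ (⁻¹-pos (0<fromℕ-! k))) ≤-refl) (⊏-^ x∈ k))
    where
    open ≤-Reasoning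
    x∈ : x ∈± fromℕ n * ¼
    x∈ = ∈±-resp
      (trans (solve 2 (λ x h → (x :* (con (+ 1) :+ (con (+ 1) :+ (con (+ 1) :+ (con (+ 1) :+ con (+ 0)))))) :* (h :* h)
                             := x :* ((h :+ h) :* (h :+ h))) refl x ½)
             (trans (*-congˡ (trans (*-cong ½+½≈1 ½+½≈1) (*-identityˡ 1#))) (*-identityʳ x)))
      (∈±-* 4x∈ (0≤⇒∈± (0≤-* (inj₁ 0<½) (inj₁ 0<½)) ≤-refl))

    bound : ∀ k → fromℕ (k !) ⁻¹ * (fromℕ n * ¼) ^ k ≤ fromℕ (n ℕ.^ n) * ¼ ^ k
    bound k = begin
      fromℕ (k !) ⁻¹ * (fromℕ n * ¼) ^ k                  ≈⟨ *-congˡ (^-distrib-* (fromℕ n) ¼ k) ⟩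
      fromℕ (k !) ⁻¹ * (fromℕ n ^ k * ¼ ^ k)              ≈⟨ *-congˡ (*-congʳ (fromℕ-^ n k)) ⟨
      fromℕ (k !) ⁻¹ * (fromℕ (n ℕ.^ k) * ¼ ^ k)          ≤⟨ *-monoʳ-≤ (inj₁ (⁻¹-pos (0<fromℕ-! k)))
                                                               (*-monoˡ-≤ (0≤¼^ k) (fromℕ-mono-≤ (n^k≤n^n*k! n k))) ⟩
      fromℕ (k !) ⁻¹ * (fromℕ (n ℕ.^ n ℕ.* k !) * ¼ ^ k)  ≈⟨ *-congˡ (*-congʳ (fromℕ-* (n ℕ.^ n) (k !))) ⟩
      fromℕ (k !) ⁻¹ * (fromℕ (n ℕ.^ n) * fromℕ (k !) * ¼ ^ k)
        ≈⟨ solve 4 (λ i c f q → i :* (c :* f :* q) := (f :* i) :* (c :* q)) refl _ _ _ _ ⟩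
      fromℕ (k !) * fromℕ (k !) ⁻¹ * (fromℕ (n ℕ.^ n) * ¼ ^ k) ≈⟨ *-congʳ (⁻¹-inverseʳ _ (fromℕ-!≉0 k)) ⟩
      1# * (fromℕ (n ℕ.^ n) * ¼ ^ k)                      ≈⟨ *-identityˡ _ ⟩
      fromℕ (n ℕ.^ n) * ¼ ^ k                             ∎

  bound-suc : ∀ {a : ℕ → ℂ} {α} → (∀ k → a k ⊏ α * ¼ ^ k) → ∀ k → a (suc k) ⊏ α * ¼ * ¼ ^ k
  bound-suc a⊏ k = ⊏-mono (≤-reflexive (sym (*-assoc _ _ _))) (a⊏ (suc k))

  0≤α*¼ : ∀ {α} → 0# ≤ α → 0# ≤ α * ¼
  0≤α*¼ 0≤α = 0≤-* 0≤α (inj₁ (*-pos _ _ 0<½ 0<½))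

  -- The geometric series would give 4α/3. The larger bound 2α is closed under the induction: the
  -- tail starts at α/4, and α + 2(α/4) ≤ 2α.
  partialSum-bound : ∀ {a : ℕ → ℂ} {α} → 0# ≤ α → (∀ k → a k ⊏ α * ¼ ^ k) → ∀ n → partialSum a n ⊏ α + α
  partialSum-bound {a} {α} 0≤α a⊏ zero = 0∈± (0≤-+ 0≤α 0≤α) , 0∈± (0≤-+ 0≤α 0≤α)
  partialSum-bound {a} {α} 0≤α a⊏ (suc n) =
    ⊏-mono bound (⊏-+ (a⊏ 0) (partialSum-bound (0≤α*¼ 0≤α) (bound-suc {a} a⊏) n))
    where
    open ≤-Reasoning
    bound : α * 1# + (α * ¼ + α * ¼) ≤ α + α
    bound = begin
      α * 1# + (α * ¼ + α * ¼)        ≈⟨ solve 2 (λ a h → a :* con (+ 1) :+ (a :* (h :* h) :+ a :* (h :* h)) := a :+ a :* (h :* (h :+ h))) refl α ½ ⟩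
      α + α * (½ * (½ + ½))           ≤⟨ +-mono-≤ ≤-refl (*-monoʳ-≤ 0≤α (≤-resp (sym (trans (*-congˡ ½+½≈1) (*-identityʳ ½))) refl ½≤1)) ⟩
      α + α * 1#                      ≈⟨ +-congˡ (*-identityʳ α) ⟩
      α + α                           ∎

  ¼^n≤½^n : ∀ n → ¼ ^ n ≤ ½ ^ n
  ¼^n≤½^n n = begin
    ¼ ^ n             ≈⟨ ^-distrib-* ½ ½ n ⟩
    ½ ^ n * ½ ^ n     ≤⟨ *-monoʳ-≤ (inj₁ (0<½^ n)) (½^n≤1 n) ⟩
    ½ ^ n * 1#        ≈⟨ *-identityʳ _ ⟩
    ½ ^ n             ∎
    where open ≤-Reasoning

  -- The defect is a sum of n products of size about ¼ ^ n, and n ¼ ^ n is O(½ ^ n).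
  cauchyDefect-bound : ∀ {a b : ℕ → ℂ} {α β} → 0# ≤ α → 0# ≤ β →
    (∀ k → a k ⊏ α * ¼ ^ k) → (∀ k → b k ⊏ β * ¼ ^ k) →
    ∀ n → cauchyDefect a b n ⊏ (α + α) * (β * ½ ^ n) + (α + α) * (β * ½ ^ n)
  cauchyDefect-bound {a} {b} {α} {β} 0≤α 0≤β a⊏ b⊏ zero =
    ⊏-resp (solve 0 (con (+ 0) := con (+ 0) :* con (+ 0) :- con (+ 0) :* con (+ 0) :- con (+ 0)) refl ,
            solve 0 (con (+ 0) := con (+ 0) :* con (+ 0) :+ con (+ 0) :* con (+ 0) :- con (+ 0)) refl)
      (0∈± 0≤B , 0∈± 0≤B)
    where
    0≤b : 0# ≤ (α + α) * (β * 1#)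
    0≤b = 0≤-* (0≤-+ 0≤α 0≤α) (0≤-* 0≤β (inj₁ 0<1))
    0≤B : 0# ≤ (α + α) * (β * 1#) + (α + α) * (β * 1#)
    0≤B = 0≤-+ 0≤b 0≤b
  cauchyDefect-bound {a} {b} {α} {β} 0≤α 0≤β a⊏ b⊏ (suc n) =
    ⊏-resp (ℂ.sym (cauchyDefect-suc a b n)) (⊏-mono (≤-reflexive bound)
      (⊏-+ (cauchyDefect-bound {a ∘ suc} {b} (0≤α*¼ 0≤α) 0≤β (bound-suc {a} a⊏) b⊏ n)
           (⊏-* {partialSum (a ∘ suc) n} {b n} (partialSum-bound {a ∘ suc} (0≤α*¼ 0≤α) (bound-suc {a} a⊏) n)
                (⊏-mono (*-monoʳ-≤ 0≤β (¼^n≤½^n n)) (b⊏ n)))))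
    where
    open ≤-Reasoning
    G : Carrier → Carrier → Carrier
    G α p = (α + α) * (β * p) + (α + α) * (β * p)
    bound : G (α * ¼) (½ ^ n) + G (α * ¼) (½ ^ n) ≈ G α (½ * ½ ^ n)
    bound = begin-equality
      G (α * ¼) (½ ^ n) + G (α * ¼) (½ ^ n)
        ≈⟨ solve 4 (λ a b h p → let X = (a :* (h :* h) :+ a :* (h :* h)) :* (b :* p) ; Y = (a :+ a) :* (b :* (h :* p)) in
             (X :+ X) :+ (X :+ X) := (h :+ h) :* (Y :+ Y)) refl α β ½ (½ ^ n) ⟩
      (½ + ½) * G α (½ * ½ ^ n)  ≈⟨ *-congʳ ½+½≈1 ⟩
      1# * G α (½ * ½ ^ n)       ≈⟨ *-identityˡ _ ⟩
      G α (½ * ½ ^ n)            ∎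

  -- An even number of terms, so that the coordinates are exactly the n-th partial sums of the
  -- cosine and sine series.
  partialExp : Carrier → ℕ → ℂ
  partialExp x n = partialSum (term x) (n ℕ.* 2)

  partialExp-bound : ∀ x → ∃ λ m → ∀ n → partialExp x n ⊏ fromℕ m
  partialExp-bound x = bounded (term-bound x)
    where
    bounded : (∃ λ m → ∀ k → term x k ⊏ fromℕ m * ¼ ^ k) → ∃ λ m → ∀ n → partialExp x n ⊏ fromℕ m
    bounded (m , term⊏) = m ℕ.+ m , λ n →
      ⊏-mono (≤-reflexive (sym (fromℕ-+ m m))) (partialSum-bound {term x} (0≤fromℕ m) term⊏ (n ℕ.* 2))

  partialExp-+ : ∀ x y → Null (λ n → partialExp x n ℂ.* partialExp y n ℂ.- partialExp (x + y) n)
  partialExp-+ x y =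
    Null-resp (λ n → ℂ.+-congˡ {partialExp x n ℂ.* partialExp y n} (ℂ.-‿cong (partialSum-cong (conv-term x y) (n ℕ.* 2))))
              (defect-null (term-bound x) (term-bound y))
    where
    defect-null : (∃ λ m → ∀ k → term x k ⊏ fromℕ m * ¼ ^ k) → (∃ λ m → ∀ k → term y k ⊏ fromℕ m * ¼ ^ k) →
      Null (λ n → cauchyDefect (term x) (term y) (n ℕ.* 2))
    defect-null (k , x⊏) (l , y⊏) ε 0<ε = bound (geometric-null B ε 0<ε)
      where
      B : Carrier
      B = (fromℕ k + fromℕ k) * fromℕ l + (fromℕ k + fromℕ k) * fromℕ l
      distribute : ∀ p → B * p ≈ (fromℕ k + fromℕ k) * (fromℕ l * p) + (fromℕ k + fromℕ k) * (fromℕ l * p)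
      distribute p = solve 3 (λ a b p → (a :* b :+ a :* b) :* p := a :* (b :* p) :+ a :* (b :* p)) refl (fromℕ k + fromℕ k) (fromℕ l) p
      bound : (∃ λ N → ∀ m → N ℕ.≤ m → B * ½ ^ m ≤ ε) →
        ∃ λ N → ∀ m → N ℕ.≤ m → cauchyDefect (term x) (term y) (m ℕ.* 2) ⊏ ε
      bound (N , small) = N , λ m N≤m →
        ⊏-mono (≤-resp (distribute (½ ^ (m ℕ.* 2))) refl (small (m ℕ.* 2) (ℕ.≤-trans N≤m (ℕ.m≤m*n m 2))))
               (cauchyDefect-bound {term x} {term y} (0≤fromℕ k) (0≤fromℕ l) x⊏ y⊏ (m ℕ.* 2))

-- Ring identities for limits and geometric sums

module RingIdentities {c ℓ} (A : CommutativeRing c ℓ) where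
  open CommutativeRingKit A
  open import Relation.Binary.Reasoning.Setoid setoid

  x-z-[x-y]≈y-z : ∀ x y z → (x - z) - (x - y) ≈ y - z
  x-z-[x-y]≈y-z = solve 3 (λ x y z → (x :- z) :- (x :- y) := y :- z) refl

  x-y≈0⇒x≈y : ∀ {x y} → x - y ≈ 0# → x ≈ y
  x-y≈0⇒x≈y {x} {y} x-y≈0 = begin
    x          ≈⟨ solve 2 (λ x y → x := (x :- y) :+ y) refl x y ⟩
    x - y + y  ≈⟨ +-congʳ x-y≈0 ⟩
    0# + y     ≈⟨ +-identityˡ y ⟩
    y          ∎

  x≈y⇒x-y≈0 : ∀ {x y} → x ≈ y → x - y ≈ 0#
  x≈y⇒x-y≈0 {x} {y} x≈y = trans (+-congʳ x≈y) (-‿inverseʳ y)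

  -- Used with s, t, r approximating e, f, g: every bracket on the left tends to 0.
  product-error : ∀ s t r e f g →
    ((s * t - r) + (r - g)) + ((- (s * (t - f))) + (- (f * (s - e)))) ≈ e * f - g
  product-error = solve 6 (λ s t r e f g →
    ((s :* t :- r) :+ (r :- g)) :+ ((:- (s :* (t :- f))) :+ (:- (f :* (s :- e)))) := e :* f :- g) refl

  geometricSum : ∀ z n → (z - 1#) * sum {n} (λ i → z ^ toℕ i) ≈ z ^ n - 1#
  geometricSum z zero    = solve 1 (λ z → (z :- con (+ 1)) :* con (+ 0) := con (+ 1) :- con (+ 1)) refl z
  geometricSum z (suc n) = begin
    (z - 1#) * (1# + sum {n} (λ i → z * z ^ toℕ i))   ≈⟨ *-congˡ (+-congˡ (*-distribˡ-sum {n} z (λ i → z ^ toℕ i))) ⟨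
    (z - 1#) * (1# + z * S)                           ≈⟨ solve 2 (λ z s → (z :- con (+ 1)) :* (con (+ 1) :+ z :* s)
                                                          := (z :- con (+ 1)) :+ z :* ((z :- con (+ 1)) :* s)) refl z S ⟩
    (z - 1#) + z * ((z - 1#) * S)                     ≈⟨ +-congˡ (*-congˡ (geometricSum z n)) ⟩
    (z - 1#) + z * (z ^ n - 1#)                       ≈⟨ solve 2 (λ z p → (z :- con (+ 1)) :+ z :* (p :- con (+ 1)) := z :* p :- con (+ 1)) refl z (z ^ n) ⟩
    z * z ^ n - 1#                                    ∎
    where
    S : Carrier
    S = sum {n} (λ i → z ^ toℕ i)

  ^-difference : ∀ z m k → z ^ m * (z ^ k - 1#) ≈ z ^ (m ℕ.+ k) - z ^ m
  ^-difference z m k = trans (solve 2 (λ a b → a :* (b :- con (+ 1)) := a :* b :- a) refl (z ^ m) (z ^ k))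
                             (+-congʳ (sym (^-homo-* z m k)))

-- The addition theorem and the zeros of sine

module Trigonometry {c ℓ} {R : CompleteOrderedField c ℓ} (F : ElementaryFunctions R) where
  open CompleteOrderedField R
  open ElementaryFunctions F
  open OrderedField R
  open ComplexNumbers R
  open Exponential R
  open RingSolver commutativeRing
  open RingIdentities
  open Convolution (GaussianNumbers.gaussianRing commutativeRing)
  open import Algebra.Properties.Ring ring using (-0#≈0#)
  open import Algebra.Properties.Semiring.Sum semiring using (sum-cong-≋)
  import Relation.Binary.Reasoning.StrictPartialOrder strictPartialOrder as ≤-Reasoning
  import Relation.Binary.Reasoning.Setoid ℂ.setoid as ℂ-Reasoning

  private
    ℂR : CommutativeRing c ℓ
    ℂR = GaussianNumbers.gaussianRing commutativeRing

  cis : Carrier → ℂ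
  cis x = cos x , sin x

  cosTerm sinTerm : Carrier → ℕ → Carrier
  cosTerm x k = (- 1#) ^ k * x ^ (2 ℕ.* k) * (fromℕ ((2 ℕ.* k) !)) ⁻¹
  sinTerm x k = (- 1#) ^ k * x ^ suc (2 ℕ.* k) * (fromℕ (suc (2 ℕ.* k) !)) ⁻¹

  ix^2k : ∀ x k → (0# , x) ℂ.^ (k ℕ.* 2) ℂ.≈ ((- 1#) ^ k * x ^ (k ℕ.* 2) , 0#)
  ix^2k x zero    = sym (*-identityʳ 1#) , refl
  ix^2k x (suc k) = ℂ.trans
    (ℂ.*-congˡ {0# , x} (ℂ.*-congˡ {0# , x} (ix^2k x k)))
    (solve 3 (λ x s p → con (+ 0) :* (con (+ 0) :* (s :* p) :- x :* con (+ 0)) :- x :* (con (+ 0) :* con (+ 0) :+ x :* (s :* p))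
                      := ((:- con (+ 1)) :* s) :* (x :* (x :* p))) refl x s p ,
     solve 3 (λ x s p → con (+ 0) :* (con (+ 0) :* con (+ 0) :+ x :* (s :* p)) :+ x :* (con (+ 0) :* (s :* p) :- x :* con (+ 0))
                      := con (+ 0)) refl x s p)
    where
    s p : Carrier
    s = (- 1#) ^ k
    p = x ^ (k ℕ.* 2)

  -- The index j is kept variable because the cosine series is written with `2 * k`, which equals
  -- `k * 2` only propositionally.
  term-even : ∀ x k j → k ℕ.* 2 ≡ j →
    term x (k ℕ.* 2) ℂ.≈ ((- 1#) ^ k * x ^ j * fromℕ (j !) ⁻¹ , 0#)
  term-even x k j ≡.refl = ℂ.trans (scale _ _)
    (trans (*-congˡ (proj₁ (ix^2k x k))) (*-comm _ _) , trans (*-congˡ (proj₂ (ix^2k x k))) (zeroʳ _))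

  term-odd : ∀ x k j → k ℕ.* 2 ≡ j →
    term x (suc (k ℕ.* 2)) ℂ.≈ (0# , (- 1#) ^ k * x ^ suc j * fromℕ (suc j !) ⁻¹)
  term-odd x k j ≡.refl = ℂ.trans (ℂ.*-congˡ {fromℕ (suc j !) ⁻¹ , 0#} (ℂ.*-congˡ {0# , x} (ix^2k x k)))
    (solve 4 (λ i x s p → i :* (con (+ 0) :* (s :* p) :- x :* con (+ 0)) :- con (+ 0) :* (con (+ 0) :* con (+ 0) :+ x :* (s :* p)) := con (+ 0))
       refl (fromℕ (suc j !) ⁻¹) x ((- 1#) ^ k) (x ^ j) ,
     solve 4 (λ i x s p → i :* (con (+ 0) :* con (+ 0) :+ x :* (s :* p)) :+ con (+ 0) :* (con (+ 0) :* (s :* p) :- x :* con (+ 0)) := s :* (x :* p) :* i)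
       refl (fromℕ (suc j !) ⁻¹) x ((- 1#) ^ k) (x ^ j))

  ℂ-sum : ∀ {n} (f : Fin n → ℂ) → ℂ.sum f ℂ.≈ (sum (proj₁ ∘ f) , sum (proj₂ ∘ f))
  ℂ-sum {zero}  f = ℂ.refl
  ℂ-sum {suc n} f = ℂ.+-congˡ {f Fin.zero} (ℂ-sum (f ∘ Fin.suc))

  partialExp-cos-sin : ∀ x n →
    partialExp x n ℂ.≈ (sum {n} (cosTerm x ∘ toℕ) , sum {n} (sinTerm x ∘ toℕ))
  partialExp-cos-sin x n = ℂ.trans (partialSum-pairs (term x) n)
    (ℂ.trans (partialSum-cong pair n) (ℂ-sum {n} (λ i → cosTerm x (toℕ i) , sinTerm x (toℕ i))))
    where
    pair : ∀ k → term x (k ℕ.* 2) ℂ.+ term x (suc (k ℕ.* 2)) ℂ.≈ (cosTerm x k , sinTerm x k)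
    pair k = ℂ.trans (ℂ.+-cong (term-even x k (2 ℕ.* k) (ℕ.*-comm k 2)) (term-odd x k (2 ℕ.* k) (ℕ.*-comm k 2)))
                     (+-identityʳ _ , +-identityˡ _)

  partialExp-null : ∀ x → Null (λ n → partialExp x n ℂ.- cis x)
  partialExp-null x = Null-resp (λ n → ℂ.+-congʳ {ℂ.- cis x} (ℂ.sym (partialExp-cos-sin x n)))
    λ ε 0<ε → both ε (cos-def x ε 0<ε) (sin-def x ε 0<ε)
    where
    both : ∀ ε →
      (∃ λ N → ∀ m → N ℕ.≤ m → (- ε < sum {m} (cosTerm x ∘ toℕ) - cos x) × (sum {m} (cosTerm x ∘ toℕ) - cos x < ε)) →
      (∃ λ N → ∀ m → N ℕ.≤ m → (- ε < sum {m} (sinTerm x ∘ toℕ) - sin x) × (sum {m} (sinTerm x ∘ toℕ) - sin x < ε)) →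
      ∃ λ N → ∀ m → N ℕ.≤ m → ((sum {m} (cosTerm x ∘ toℕ) , sum {m} (sinTerm x ∘ toℕ)) ℂ.- cis x) ⊏ ε
    both ε (M , c∈) (N , s∈) = M ℕ.⊔ N , λ m M⊔N≤m →
      (let l , u = c∈ m (ℕ.m⊔n≤o⇒m≤o M N M⊔N≤m) in inj₁ l , inj₁ u) ,
      (let l , u = s∈ m (ℕ.m⊔n≤o⇒n≤o M N M⊔N≤m) in inj₁ l , inj₁ u)

  -- Since cosine and sine are specified as sums of series, their values are identified by producing
  -- the limit of the partial sums.
  cis-unique : ∀ x w → Null (λ n → partialExp x n ℂ.- w) → cis x ℂ.≈ w
  cis-unique x w null = x-y≈0⇒x≈y ℂR (Null-const⇒≈0
    (Null-resp (λ n → x-z-[x-y]≈y-z ℂR (partialExp x n) (cis x) w) (Null-+ null (Null-neg (partialExp-null x)))))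

  term-cong : ∀ {x y} → x ≈ y → ∀ k → term x k ℂ.≈ term y k
  term-cong x≈y k = ℂ.*-congˡ {fromℕ (k !) ⁻¹ , 0#} (ℂ.^-congˡ k (refl , x≈y))

  -- The specification does not postulate that cosine and sine respect `_≈_`; the terms of the
  -- series do, and limits are unique.
  cis-cong : ∀ {x y} → x ≈ y → cis x ℂ.≈ cis y
  cis-cong {x} {y} x≈y = cis-unique x (cis y)
    (Null-resp (λ n → ℂ.+-congʳ {ℂ.- cis y} (partialSum-cong (term-cong (sym x≈y)) (n ℕ.* 2))) (partialExp-null y))

  cis-+ : ∀ x y → cis (x + y) ℂ.≈ cis x ℂ.* cis y
  cis-+ x y = ℂ.sym (x-y≈0⇒x≈y ℂR (Null-const⇒≈0
    (Null-resp (λ n → product-error ℂR (partialExp x n) (partialExp y n) (partialExp (x + y) n) (cis x) (cis y) (cis (x + y)))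
      (Null-+ (Null-+ (partialExp-+ x y) (partialExp-null (x + y)))
        (Null-+ (Null-neg (Null-* (proj₁ (partialExp-bound x)) (proj₂ (partialExp-bound x)) (partialExp-null y)))
                (Null-neg (Null-* (proj₁ (⊏-bound (cis y))) (λ _ → proj₂ (⊏-bound (cis y))) (partialExp-null x))))))))

  cis-0 : cis 0# ℂ.≈ ℂ.1#
  -- From index 1 on, a partial sum consists of the term 1 and zeros; at index 0 it is empty.
  cis-0 = cis-unique 0# ℂ.1# λ ε 0<ε → 1 , λ
    { (suc m) _ → ⊏-resp (ℂ.sym (x≈y⇒x-y≈0 ℂR (partialExp≈1 m))) (0∈± (inj₁ 0<ε) , 0∈± (inj₁ 0<ε)) }
    where
    partialExp≈1 : ∀ m → partialExp 0# (suc m) ℂ.≈ ℂ.1#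
    partialExp≈1 m = ℂ.trans (ℂ.+-cong (term-zero 0#) (ℂ.trans
      (partialSum-cong (λ k → ℂ.trans (ℂ.*-congˡ {fromℕ (suc k !) ⁻¹ , 0#} (ℂ.zeroˡ ((0# , 0#) ℂ.^ k))) (ℂ.zeroʳ (fromℕ (suc k !) ⁻¹ , 0#))) (suc (m ℕ.* 2)))
      (ℂ.sum-replicate-zero (suc (m ℕ.* 2))))) (ℂ.+-identityʳ ℂ.1#)

  conj-* : ∀ z w → conj (z ℂ.* w) ℂ.≈ conj z ℂ.* conj w
  conj-* (a , b) (x , y) =
    solve 4 (λ a b x y → a :* x :- b :* y := a :* x :- (:- b) :* (:- y)) refl a b x y ,
    solve 4 (λ a b x y → :- (a :* y :+ b :* x) := a :* (:- y) :+ (:- b) :* x) refl a b x y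

  conj-^ : ∀ z n → conj (z ℂ.^ n) ℂ.≈ conj z ℂ.^ n
  conj-^ z zero    = refl , -0#≈0#
  conj-^ z (suc n) = ℂ.trans (conj-* z (z ℂ.^ n)) (ℂ.*-congˡ {conj z} (conj-^ z n))

  conj-sum : ∀ {n} (f : Fin n → ℂ) → conj (ℂ.sum f) ℂ.≈ ℂ.sum (conj ∘ f)
  conj-sum {zero}  f = refl , -0#≈0#
  conj-sum {suc n} f = ℂ.trans (refl , solve 2 (λ x y → :- (x :+ y) := (:- x) :+ (:- y)) refl _ _)
    (ℂ.+-congˡ {conj (f Fin.zero)} (conj-sum (f ∘ Fin.suc)))

  term-conj : ∀ x k → conj (term x k) ℂ.≈ term (- x) k
  term-conj x k = ℂ.trans (conj-* (fromℕ (k !) ⁻¹ , 0#) ((0# , x) ℂ.^ k))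
    (ℂ.*-cong (refl , -0#≈0#) (conj-^ (0# , x) k))

  -- Conjugation turns the series for x into the series for - x term by term and preserves the
  -- bounds on both coordinates.
  cis-neg : ∀ x → cis (- x) ℂ.≈ conj (cis x)
  cis-neg x = cis-unique (- x) (conj (cis x)) λ ε 0<ε → conjugate ε (partialExp-null x ε 0<ε)
    where
    conj-difference : ∀ n → conj (partialExp x n ℂ.- cis x) ℂ.≈ partialExp (- x) n ℂ.- conj (cis x)
    conj-difference n = ℂ.trans (refl , solve 2 (λ x y → :- (x :- y) := (:- x) :- (:- y)) refl _ _)
      (ℂ.+-congʳ {ℂ.- conj (cis x)} (ℂ.trans (conj-sum {n ℕ.* 2} (term x ∘ toℕ)) (partialSum-cong (term-conj x) (n ℕ.* 2))))

    conjugate : ∀ ε → (∃ λ N → ∀ m → N ℕ.≤ m → (partialExp x m ℂ.- cis x) ⊏ ε) →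
      ∃ λ N → ∀ m → N ℕ.≤ m → (partialExp (- x) m ℂ.- conj (cis x)) ⊏ ε
    conjugate ε (N , small) = N , λ m N≤m → ⊏-resp (conj-difference m)
      (proj₁ (small m N≤m) , ∈±-neg (proj₂ (small m N≤m)))

  ∣cis∣²≈1 : ∀ x → ∣ cis x ∣² ≈ 1#
  ∣cis∣²≈1 x = proj₁ (begin
    (∣ cis x ∣² , 0#)          ≈⟨ *-conj (cis x) ⟨
    cis x ℂ.* conj (cis x)     ≈⟨ ℂ.*-congˡ {cis x} (cis-neg x) ⟨
    cis x ℂ.* cis (- x)        ≈⟨ cis-+ x (- x) ⟨
    cis (x - x)                ≈⟨ cis-cong (-‿inverseʳ x) ⟩
    cis 0#                     ≈⟨ cis-0 ⟩
    ℂ.1#                       ∎)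
    where open ℂ-Reasoning

  -- The real part of (cis π)² is cos² π - sin² π; because sin π = 0 it coincides with `∣ cis π ∣²`,
  -- which is 1.
  cis-2π : cis (π + π) ℂ.≈ ℂ.1#
  cis-2π = ℂ.trans (cis-+ π π)
    (trans (+-congˡ (trans (-‿cong sin²≈0) (trans -0#≈0# (sym sin²≈0)))) (∣cis∣²≈1 π) ,
     trans (+-cong (trans (*-congˡ sin-π) (zeroʳ _)) (trans (*-congʳ sin-π) (zeroˡ _))) (+-identityˡ 0#))
    where
    sin²≈0 : sin π * sin π ≈ 0#
    sin²≈0 = trans (*-congʳ sin-π) (zeroˡ _)

  -- This translates periods of `cis` into zeros of sine, in terms of which π is defined:
  -- subtracting cos² x - sin² x = 1 from cos² x + sin² x = 1 leaves 2 sin² x = 0.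
  cis-2x≈1⇒sin-x≈0 : ∀ x → cis (x + x) ℂ.≈ ℂ.1# → sin x ≈ 0#
  cis-2x≈1⇒sin-x≈0 x eq = x*x+y≈0⇒x≈0 (0≤x*x (sin x)) (begin-equality
    s * s + s * s                              ≈⟨ solve 2 (λ c s → s :* s :+ s :* s := (c :* c :+ s :* s) :- (c :* c :- s :* s)) refl (cos x) s ⟩
    ∣ cis x ∣² - (cos x * cos x - s * s)       ≈⟨ +-cong (∣cis∣²≈1 x) (-‿cong (trans (sym (proj₁ (cis-+ x x))) (proj₁ eq))) ⟩
    1# - 1#                                    ≈⟨ -‿inverseʳ 1# ⟩
    0#                                         ∎)
    where
    open ≤-Reasoning
    s : Carrier
    s = sin x

  -- The vertices as powers of a primitive root of unity

  module RootsOfUnity (m : ℕ) where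

    n : ℕ
    n = suc m

    ρ : Carrier
    ρ = fromℕ n ⁻¹

    θ : ℕ → Carrier
    θ k = fromℕ (2 ℕ.* k) * π * ρ

    ω : ℂ
    ω = cis (θ 1)

    n*ρ≈1 : fromℕ n * ρ ≈ 1#
    n*ρ≈1 = ⁻¹-inverseʳ _ (<⇒≉ (0<fromℕ m))

    -- Minimality of π speaks about zeros of sine, hence about half of a period of `cis`. The half
    -- angles kπ/n lie strictly between 0 and π for 0 < k < n.
    half : ℕ → Carrier
    half k = fromℕ k * π * ρ

    θ≈half+half : ∀ k → θ k ≈ half k + half k
    θ≈half+half k = trans (*-congʳ (*-congʳ (fromℕ-* 2 k)))
      (solve 3 (λ k p r → ((con (+ 1) :+ (con (+ 1) :+ con (+ 0))) :* k) :* p :* r := k :* p :* r :+ k :* p :* r) refl (fromℕ k) π ρ)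

    half-n≈π : half n ≈ π
    half-n≈π = begin-equality
      fromℕ n * π * ρ    ≈⟨ solve 3 (λ n p r → n :* p :* r := (n :* r) :* p) refl (fromℕ n) π ρ ⟩
      fromℕ n * ρ * π    ≈⟨ *-congʳ n*ρ≈1 ⟩
      1# * π             ≈⟨ *-identityˡ π ⟩
      π                  ∎
      where open ≤-Reasoning

    half-+ : ∀ j k → half (j ℕ.+ k) ≈ half j + half k
    half-+ j k = trans (*-congʳ (*-congʳ (fromℕ-+ j k)))
      (solve 4 (λ j k p r → (j :+ k) :* p :* r := j :* p :* r :+ k :* p :* r) refl (fromℕ j) (fromℕ k) π ρ)

    0<half : ∀ k → 0# < half (suc k)
    0<half k = *-pos _ _ (*-pos _ _ (0<fromℕ k) π-pos) (⁻¹-pos (0<fromℕ m))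

    cis-θ : ∀ k → cis (θ k) ℂ.≈ ω ℂ.^ k
    cis-θ zero    = ℂ.trans (cis-cong (trans (*-congʳ (zeroˡ π)) (zeroˡ ρ))) cis-0
    cis-θ (suc k) = ℂ.trans (cis-cong (begin-equality
      θ (suc k)                                       ≈⟨ θ≈half+half (suc k) ⟩
      half (suc k) + half (suc k)                     ≈⟨ +-cong (half-+ 1 k) (half-+ 1 k) ⟩
      (half 1 + half k) + (half 1 + half k)           ≈⟨ solve 2 (λ a b → (a :+ b) :+ (a :+ b) := (a :+ a) :+ (b :+ b)) refl (half 1) (half k) ⟩
      (half 1 + half 1) + (half k + half k)           ≈⟨ +-cong (θ≈half+half 1) (θ≈half+half k) ⟨
      θ 1 + θ k                                       ∎))
      (ℂ.trans (cis-+ (θ 1) (θ k)) (ℂ.*-congˡ {ω} (cis-θ k)))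
      where open ≤-Reasoning

    ω^n≈1 : ω ℂ.^ n ℂ.≈ ℂ.1#
    ω^n≈1 = ℂ.trans (ℂ.sym (cis-θ n))
      (ℂ.trans (cis-cong (trans (θ≈half+half n) (+-cong half-n≈π half-n≈π))) cis-2π)

    -- Otherwise kπ/n would be a positive zero of sine smaller than π.
    ω^k≉1 : ∀ k → 0 ℕ.< k → k ℕ.< n → ¬ ω ℂ.^ k ℂ.≈ ℂ.1#
    ω^k≉1 (suc k) _ k<n ω^k≈1 = <⇒≱ half<π (π-least (half (suc k)) (0<half k) (cis-2x≈1⇒sin-x≈0 (half (suc k))
      (ℂ.trans (cis-cong (sym (θ≈half+half (suc k)))) (ℂ.trans (cis-θ (suc k)) ω^k≈1))))
      where
      half<π : half (suc k) < π
      half<π with d , ≡.refl ← ℕ.m≤n⇒∃[o]m+o≡n k<n =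
        <-resp (+-identityˡ _) (trans (sym (half-+ (suc d) (suc k)))
                                      (trans (reflexive (≡.cong (half ∘ suc) (ℕ.+-comm d (suc k)))) half-n≈π))
               (+-monoˡ-< 0# (half (suc d)) (half (suc k)) (0<half d))

    -- Multiplied by the nonzero number ω ^ j - 1, the geometric sum becomes ω ^ (j n) - 1 = 0.
    sum-ω^k≈0 : ∀ j → 0 ℕ.< j → j ℕ.< n → ℂ.sum {n} (λ i → (ω ℂ.^ j) ℂ.^ toℕ i) ℂ.≈ ℂ.0#
    sum-ω^k≈0 j 0<j j<n = z*w≈0⇒w≈0 (λ eq → ω^k≉1 j 0<j j<n (x-y≈0⇒x≈y ℂR eq))
      (ℂ.trans (geometricSum ℂR (ω ℂ.^ j) n) (x≈y⇒x-y≈0 ℂR (begin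
        (ω ℂ.^ j) ℂ.^ n       ≈⟨ ℂ.^-assocʳ ω j n ⟩
        ω ℂ.^ (j ℕ.* n)       ≡⟨ ≡.cong (ω ℂ.^_) (ℕ.*-comm j n) ⟩
        ω ℂ.^ (n ℕ.* j)       ≈⟨ ℂ.^-assocʳ ω n j ⟨
        (ω ℂ.^ n) ℂ.^ j       ≈⟨ ℂ.^-congˡ j ω^n≈1 ⟩
        ℂ.1# ℂ.^ j            ≈⟨ 1^ j ⟩
        ℂ.1#                  ∎)))
      where
      open ℂ-Reasoning
      1^ : ∀ j → ℂ.1# ℂ.^ j ℂ.≈ ℂ.1#
      1^ zero    = ℂ.refl
      1^ (suc j) = ℂ.trans (ℂ.*-identityˡ _) (1^ j)

    vertex : Fin n → ℂ
    vertex i = cis (θ (toℕ i))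

    sum-vertex : ∀ j → 0 ℕ.< j → j ℕ.< n → ℂ.sum (λ i → vertex i ℂ.^ j) ℂ.≈ ℂ.0#
    sum-vertex j 0<j j<n = ℂ.trans (ℂ.sum-cong-≋ {n} λ i → begin
      vertex i ℂ.^ j              ≈⟨ ℂ.^-congˡ j (cis-θ (toℕ i)) ⟩
      (ω ℂ.^ toℕ i) ℂ.^ j         ≈⟨ ℂ.^-assocʳ ω (toℕ i) j ⟩
      ω ℂ.^ (toℕ i ℕ.* j)         ≡⟨ ≡.cong (ω ℂ.^_) (ℕ.*-comm (toℕ i) j) ⟩
      ω ℂ.^ (j ℕ.* toℕ i)         ≈⟨ ℂ.^-assocʳ ω j (toℕ i) ⟨
      (ω ℂ.^ j) ℂ.^ toℕ i         ∎) (sum-ω^k≈0 j 0<j j<n)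
      where open ℂ-Reasoning

    -- After cancelling ω ^ i, which has modulus 1, equal vertices would give ω ^ (j - i) = 1 with 0
    -- < j - i < n.
    vertex-distinct-< : ∀ {i j} → i Fin.< j → ¬ vertex i ℂ.≈ vertex j
    vertex-distinct-< {i} {j} i<j vᵢ≈vⱼ =
      ω^k≉1 d (ℕ.m<n⇒0<n∸m i<j) (ℕ.≤-<-trans (ℕ.m∸n≤m (toℕ j) (toℕ i)) (Fin.toℕ<n j)) (x-y≈0⇒x≈y ℂR (z*w≈0⇒w≈0 ω^i≉0 (begin
        ω ℂ.^ toℕ i ℂ.* (ω ℂ.^ d ℂ.- ℂ.1#)                 ≈⟨ ^-difference ℂR ω (toℕ i) d ⟩
        ω ℂ.^ (toℕ i ℕ.+ d) ℂ.- ω ℂ.^ toℕ i                ≡⟨ ≡.cong (λ k → ω ℂ.^ k ℂ.- ω ℂ.^ toℕ i) (ℕ.m+[n∸m]≡n (ℕ.<⇒≤ i<j)) ⟩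
        ω ℂ.^ toℕ j ℂ.- ω ℂ.^ toℕ i                        ≈⟨ x≈y⇒x-y≈0 ℂR (ℂ.trans (ℂ.sym (cis-θ (toℕ j))) (ℂ.trans (ℂ.sym vᵢ≈vⱼ) (cis-θ (toℕ i)))) ⟩
        ℂ.0#                                               ∎)))
      where
      open ℂ-Reasoning
      d : ℕ
      d = toℕ j ℕ.∸ toℕ i
      ω^i≉0 : ¬ ω ℂ.^ toℕ i ℂ.≈ ℂ.0#
      ω^i≉0 ω^i≈0 = 0≉1 (trans (sym (trans (+-cong (trans (*-congˡ c≈0) (zeroʳ _)) (trans (*-congˡ s≈0) (zeroʳ _))) (+-identityˡ 0#)))
                               (∣cis∣²≈1 (θ (toℕ i))))
        where
        c≈0 : cos (θ (toℕ i)) ≈ 0#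
        c≈0 = proj₁ (ℂ.trans (cis-θ (toℕ i)) ω^i≈0)
        s≈0 : sin (θ (toℕ i)) ≈ 0#
        s≈0 = proj₂ (ℂ.trans (cis-θ (toℕ i)) ω^i≈0)

    vertex-distinct : ∀ {i j} → i ≢ j → ¬ vertex i ℂ.≈ vertex j
    vertex-distinct {i} {j} i≢j vᵢ≈vⱼ with Fin.<-cmp i j
    ... | tri< i<j _ _ = vertex-distinct-< i<j vᵢ≈vⱼ
    ... | tri≈ _ i≡j _ = i≢j i≡j
    ... | tri> _ _ j<i = vertex-distinct-< j<i (ℂ.sym vᵢ≈vⱼ)

-- Determinants: multilinearity, alternation and rank-one updates

module Determinant {c ℓ} (R : CompleteOrderedField c ℓ) where
  open CompleteOrderedField R
  open LinearAlgebra R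
  open RingSolver commutativeRing
  open import Algebra.Properties.Semiring.Sum semiring hiding (sum)
  open import Relation.Binary.Reasoning.Setoid setoid

  sum-zero : ∀ {n} (f : Fin n → Carrier) → (∀ i → f i ≈ 0#) → sum f ≈ 0#
  sum-zero {n} f f≈0 = trans (sum-cong-≋ f≈0) (sum-replicate-zero n)

  sum-only : ∀ {n} (f : Fin n → Carrier) i → (∀ j → j ≢ i → f j ≈ 0#) → sum f ≈ f i
  sum-only {suc n} f i f≈0 = begin
    sum f                              ≈⟨ sum-remove {i = i} f ⟩
    f i + sum (λ j → f (punchIn i j))  ≈⟨ +-congˡ (sum-zero (f ∘ punchIn i) λ j → f≈0 (punchIn i j) (punchInᵢ≢i i j)) ⟩
    f i + 0#                           ≈⟨ +-identityʳ _ ⟩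
    f i                                ∎

  sum-linear : ∀ {n} x (f g : Fin n → Carrier) → sum (λ i → x * f i + g i) ≈ x * sum f + sum g
  sum-linear x f g = trans (∑-distrib-+ (λ i → x * f i) g) (+-congʳ (sym (*-distribˡ-sum x f)))

  minor : ∀ {n} → Matrix (suc n) (suc n) → Fin (suc n) → Matrix n n
  minor A j i k = A (suc i) (punchIn j k)

  det-cong : ∀ {n} {A B : Matrix n n} → (∀ i j → A i j ≈ B i j) → det A ≈ det B
  det-cong {zero}  A≈B = refl
  det-cong {suc n} A≈B = sum-cong-≋ λ j →
    *-cong (*-congˡ {(- 1#) ^ toℕ j} (A≈B zero j)) (det-cong λ i k → A≈B (suc i) (punchIn j k))

  -- Linearity in row i is a relation between three matrices that agree outside that row. In this
  -- form the minors inherit the hypotheses, so induction along row 0 applies directly.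
  det-linear : ∀ {n} {A B C : Matrix n n} i x → (∀ j → A i j ≈ x * B i j + C i j) →
    (∀ k → k ≢ i → ∀ j → A k j ≈ B k j) → (∀ k → k ≢ i → ∀ j → A k j ≈ C k j) →
    det A ≈ x * det B + det C
  det-linear {suc n} {A} {B} {C} zero x Aᵢ A≈B A≈C = trans
    (sum-cong-≋ λ j → begin
      s j * A zero j * det (minor A j)
        ≈⟨ *-congʳ (*-congˡ (Aᵢ j)) ⟩
      s j * (x * B zero j + C zero j) * det (minor A j)
        ≈⟨ solve 5 (λ s x b c d → s :* (x :* b :+ c) :* d := x :* (s :* b :* d) :+ s :* c :* d) refl (s j) x _ _ _ ⟩
      x * (s j * B zero j * det (minor A j)) + s j * C zero j * det (minor A j)
        ≈⟨ +-cong (*-congˡ (*-congˡ (det-cong λ i k → A≈B (suc i) (λ ()) (punchIn j k))))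
                  (*-congˡ (det-cong λ i k → A≈C (suc i) (λ ()) (punchIn j k))) ⟩
      x * (s j * B zero j * det (minor B j)) + s j * C zero j * det (minor C j) ∎)
    (sum-linear x (λ j → s j * B zero j * det (minor B j)) (λ j → s j * C zero j * det (minor C j)))
    where
    s : Fin (suc n) → Carrier
    s j = (- 1#) ^ toℕ j
  det-linear {suc n} {A} {B} {C} (suc i) x Aᵢ A≈B A≈C = trans
    (sum-cong-≋ λ j → begin
      s j * A zero j * det (minor A j)
        ≈⟨ *-congˡ (det-linear i x (λ k → Aᵢ (punchIn j k))
             (λ k k≢i l → A≈B (suc k) (λ { ≡.refl → k≢i ≡.refl }) (punchIn j l))
             (λ k k≢i l → A≈C (suc k) (λ { ≡.refl → k≢i ≡.refl }) (punchIn j l))) ⟩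
      s j * A zero j * (x * det (minor B j) + det (minor C j))
        ≈⟨ solve 5 (λ s a x d e → s :* a :* (x :* d :+ e) := x :* (s :* a :* d) :+ s :* a :* e) refl (s j) _ x _ _ ⟩
      x * (s j * A zero j * det (minor B j)) + s j * A zero j * det (minor C j)
        ≈⟨ +-cong (*-congˡ (*-congʳ (*-congˡ (A≈B zero (λ ()) j)))) (*-congʳ (*-congˡ (A≈C zero (λ ()) j))) ⟩
      x * (s j * B zero j * det (minor B j)) + s j * C zero j * det (minor C j) ∎)
    (sum-linear x (λ j → s j * B zero j * det (minor B j)) (λ j → s j * C zero j * det (minor C j)))
    where
    s : Fin (suc n) → Carrier
    s j = (- 1#) ^ toℕ j

  -- (j , k) ↦ (punchIn j k , punchBack j k) exchanges the two elements of the ordered pair of distinct indices j, punchIn j k.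
  punchBack : ∀ {n} → Fin (suc n) → Fin n → Fin n
  punchBack zero    zero    = zero
  punchBack zero    (suc k) = zero
  punchBack (suc j) zero    = j
  punchBack (suc j) (suc k) = suc (punchBack j k)

  punchIn-punchBack : ∀ {n} (j : Fin (suc n)) k → punchIn (punchIn j k) (punchBack j k) ≡ j
  punchIn-punchBack zero    zero    = ≡.refl
  punchIn-punchBack zero    (suc k) = ≡.refl
  punchIn-punchBack (suc j) zero    = ≡.refl
  punchIn-punchBack (suc j) (suc k) = ≡.cong suc (punchIn-punchBack j k)

  punchIn-swap : ∀ {n} (j : Fin (2 ℕ.+ n)) k l →
    punchIn (punchIn j k) (punchIn (punchBack j k) l) ≡ punchIn j (punchIn k l)
  punchIn-swap zero    zero    l       = ≡.refl
  punchIn-swap zero    (suc k) l       = ≡.refl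
  punchIn-swap (suc j) zero    l       = ≡.refl
  punchIn-swap (suc j) (suc k) zero    = ≡.refl
  punchIn-swap {suc n} (suc j) (suc k) (suc l) = ≡.cong suc (punchIn-swap j k l)

  -- In an expansion along two rows, a pair of columns and its exchange delete the same columns, by
  -- `punchIn-swap`, but carry opposite signs.
  sign-swap : ∀ {n} (j : Fin (suc n)) k →
    (- 1#) ^ toℕ (punchIn j k) * (- 1#) ^ toℕ (punchBack j k) ≈ - ((- 1#) ^ toℕ j * (- 1#) ^ toℕ k)
  sign-swap zero    zero    = solve 1 (λ x → ((:- con (+ 1)) :* x) :* x := :- (x :* x)) refl 1#
  sign-swap zero    (suc k) = solve 1 (λ x → (:- con (+ 1)) :* ((:- con (+ 1)) :* x) :* con (+ 1) := :- (con (+ 1) :* ((:- con (+ 1)) :* x))) refl _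
  sign-swap (suc j) zero    = solve 1 (λ x → con (+ 1) :* x := :- (((:- con (+ 1)) :* x) :* con (+ 1))) refl _
  sign-swap (suc j) (suc k) = trans
    (solve 2 (λ x y → ((:- con (+ 1)) :* x) :* ((:- con (+ 1)) :* y) := x :* y) refl _ _)
    (trans (sign-swap j k) (solve 2 (λ x y → :- (x :* y) := :- (((:- con (+ 1)) :* x) :* ((:- con (+ 1)) :* y))) refl _ _))

  -- The terms in which one of the two indices is 0 cancel in pairs; the others form an
  -- antisymmetric family on a smaller index set.
  sum-antisymmetric : ∀ {n} (f : Fin (suc n) → Fin n → Carrier) →
    (∀ j k → f (punchIn j k) (punchBack j k) ≈ - f j k) → sum (λ j → sum (f j)) ≈ 0#
  sum-antisymmetric {zero}  f anti = +-identityˡ 0#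
  sum-antisymmetric {suc n} f anti = begin
    sum (f zero) + sum (λ j → f (suc j) zero + sum (λ k → f (suc j) (suc k)))
      ≈⟨ +-congˡ (∑-distrib-+ (λ j → f (suc j) zero) (λ j → sum (λ k → f (suc j) (suc k)))) ⟩
    sum (f zero) + (sum (λ j → f (suc j) zero) + sum (λ j → sum (λ k → f (suc j) (suc k))))
      ≈⟨ +-assoc _ _ _ ⟨
    sum (f zero) + sum (λ j → f (suc j) zero) + sum (λ j → sum (λ k → f (suc j) (suc k)))
      ≈⟨ +-cong (sym (∑-distrib-+ (f zero) (λ j → f (suc j) zero))) (sum-antisymmetric (λ j k → f (suc j) (suc k)) (λ j k → anti (suc j) (suc k))) ⟩
    sum (λ j → f zero j + f (suc j) zero) + 0#
      ≈⟨ +-identityʳ _ ⟩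
    sum (λ j → f zero j + f (suc j) zero)
      ≈⟨ sum-zero _ (λ j → trans (+-congˡ (anti′ j)) (-‿inverseʳ _)) ⟩
    0# ∎
    where
    anti′ : ∀ j → f (suc j) zero ≈ - f zero j
    anti′ zero    = anti zero zero
    anti′ (suc j) = anti zero (suc j)

  -- Expanding along both equal rows, the exchange of the two chosen columns keeps the entries and
  -- the minor but reverses the sign.
  det-rows01 : ∀ {n} (A : Matrix (2 ℕ.+ n) (2 ℕ.+ n)) → (∀ j → A zero j ≈ A (suc zero) j) → det A ≈ 0#
  det-rows01 {n} A A₀≈A₁ = trans
    (sum-cong-≋ λ j → *-distribˡ-sum (s j * A zero j) (λ k → s k * A (suc zero) (punchIn j k) * det (minor (minor A j) k)))
    (sum-antisymmetric f anti)
    where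
    s : ∀ {m} → Fin m → Carrier
    s j = (- 1#) ^ toℕ j
    f : Fin (2 ℕ.+ n) → Fin (suc n) → Carrier
    f j k = s j * A zero j * (s k * A (suc zero) (punchIn j k) * det (minor (minor A j) k))
    anti : ∀ j k → f (punchIn j k) (punchBack j k) ≈ - f j k
    anti j k = begin
      s j′ * A zero j′ * (s k′ * A (suc zero) (punchIn j′ k′) * det (minor (minor A j′) k′))
        ≈⟨ *-cong (*-congˡ (A₀≈A₁ j′)) (*-cong (*-congˡ (trans (reflexive (≡.cong (A (suc zero)) (punchIn-punchBack j k))) (sym (A₀≈A₁ j))))
             (det-cong λ i l → reflexive (≡.cong (A (suc (suc i))) (punchIn-swap j k l)))) ⟩
      s j′ * A (suc zero) j′ * (s k′ * A zero j * det (minor (minor A j) k))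
        ≈⟨ solve 5 (λ s t a b d → s :* a :* (t :* b :* d) := (s :* t) :* (b :* a :* d)) refl (s j′) (s k′) _ _ _ ⟩
      s j′ * s k′ * (A zero j * A (suc zero) j′ * det (minor (minor A j) k))
        ≈⟨ *-congʳ (sign-swap j k) ⟩
      - (s j * s k) * (A zero j * A (suc zero) j′ * det (minor (minor A j) k))
        ≈⟨ solve 5 (λ s t a b d → (:- (s :* t)) :* (b :* a :* d) := :- (s :* b :* (t :* a :* d))) refl (s j) (s k) _ _ _ ⟩
      - f j k ∎
      where
      j′ : Fin (2 ℕ.+ n)
      j′ = punchIn j k
      k′ : Fin (suc n)
      k′ = punchBack j k

  infixl 8 _[_]≔_

  _[_]≔_ : ∀ {m n} → Matrix m n → Fin m → Vector Carrier n → Matrix m n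
  A [ i ]≔ v = updateAt A i (const v)

  []≔-updates : ∀ {m n} (A : Matrix m n) i v j → (A [ i ]≔ v) i j ≈ v j
  []≔-updates A i v j = reflexive (≡.cong (λ r → r j) (updateAt-updates i A))

  []≔-minimal : ∀ {m n} (A : Matrix m n) i v {k} → k ≢ i → ∀ j → (A [ i ]≔ v) k j ≈ A k j
  []≔-minimal A i v {k} k≢i j = reflexive (≡.cong (λ r → r j) (updateAt-minimal k i A k≢i))

  []≔-linear : ∀ {n} (A : Matrix n n) i x v w →
    det (A [ i ]≔ (λ j → x * v j + w j)) ≈ x * det (A [ i ]≔ v) + det (A [ i ]≔ w)
  []≔-linear A i x v w = det-linear i x
    (λ j → trans ([]≔-updates A i _ j) (sym (+-cong (*-congˡ ([]≔-updates A i v j)) ([]≔-updates A i w j))))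
    (λ k k≢i j → trans ([]≔-minimal A i _ k≢i j) (sym ([]≔-minimal A i v k≢i j)))
    (λ k k≢i j → trans ([]≔-minimal A i _ k≢i j) (sym ([]≔-minimal A i w k≢i j)))

  []≔-cong : ∀ {n} (A : Matrix n n) i {v w} → (∀ j → v j ≈ w j) → det (A [ i ]≔ v) ≈ det (A [ i ]≔ w)
  []≔-cong A i {v} {w} v≈w = det-cong λ k j → pointwise k j (k Fin.≟ i)
    where
    pointwise : ∀ k j → Dec (k ≡ i) → (A [ i ]≔ v) k j ≈ (A [ i ]≔ w) k j
    pointwise k j (yes ≡.refl) = trans ([]≔-updates A i v j) (trans (v≈w j) (sym ([]≔-updates A i w j)))
    pointwise k j (no k≢i)     = trans ([]≔-minimal A i v k≢i j) (sym ([]≔-minimal A i w k≢i j))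

  []≔-self : ∀ {n} (A : Matrix n n) i → det (A [ i ]≔ A i) ≈ det A
  []≔-self A i = det-cong λ k j → pointwise k j (k Fin.≟ i)
    where
    pointwise : ∀ k j → Dec (k ≡ i) → (A [ i ]≔ A i) k j ≈ A k j
    pointwise k j (yes ≡.refl) = []≔-updates A i (A i) j
    pointwise k j (no k≢i)     = []≔-minimal A i (A i) k≢i j

  []≔-zero : ∀ {n} (A : Matrix n n) i → det (A [ i ]≔ const 0#) ≈ 0#
  []≔-zero A i = begin
    -- Writing the zero row as - 1 · 0 + 0 makes linearity express the determinant as its own
    -- negative plus itself.
    det (A [ i ]≔ const 0#)                                               ≈⟨ []≔-cong A i (λ j → solve 0 (con (+ 0) := (:- con (+ 1)) :* con (+ 0) :+ con (+ 0)) refl) ⟩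
    det (A [ i ]≔ (λ _ → - 1# * 0# + 0#))                                 ≈⟨ []≔-linear A i (- 1#) (const 0#) (const 0#) ⟩
    - 1# * det (A [ i ]≔ const 0#) + det (A [ i ]≔ const 0#)              ≈⟨ solve 1 (λ d → (:- con (+ 1)) :* d :+ d := con (+ 0)) refl _ ⟩
    0#                                                                    ∎

  []≔-sum : ∀ {m n} (A : Matrix n n) i (x : Fin m → Carrier) (v : Fin m → Vector Carrier n) →
    det (A [ i ]≔ (λ j → sum (λ k → x k * v k j))) ≈ sum (λ k → x k * det (A [ i ]≔ v k))
  []≔-sum {zero}  A i x v = []≔-zero A i
  []≔-sum {suc m} A i x v = trans ([]≔-linear A i (x zero) (v zero) (λ j → sum (λ k → x (suc k) * v (suc k) j)))
    (+-congˡ ([]≔-sum A i (x ∘ suc) (v ∘ suc)))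

  -- Rows 1 and 2 + k are exchanged by expanding the vanishing determinant that has A 1 + A 0 in both positions.
  det-rows02+ : ∀ {n} (A : Matrix (2 ℕ.+ n) (2 ℕ.+ n)) k → (∀ j → A zero j ≈ A (suc (suc k)) j) →
    (∀ B → (∀ j → B (suc zero) j ≈ B (suc (suc k)) j) → det B ≈ 0#) → det A ≈ 0#
  det-rows02+ {n} A k A₀≈Aₖ alternating = begin
    det A                                                       ≈⟨ det-cong A≈B ⟩
    D r₁ r₀                                                     ≈⟨ solve 1 (λ d → d := con (+ 1) :* (con (+ 1) :* con (+ 0) :+ d) :+ (con (+ 1) :* con (+ 0) :+ con (+ 0))) refl _ ⟩
    1# * (1# * 0# + D r₁ r₀) + (1# * 0# + 0#)                   ≈⟨ +-cong (*-congˡ (+-congʳ (*-congˡ (Dvv≈0 r₁)))) (+-cong (*-congˡ D₀₁≈0) (Dvv≈0 r₀)) ⟨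
    1# * (1# * D r₁ r₁ + D r₁ r₀) + (1# * D r₀ r₁ + D r₀ r₀)    ≈⟨ +-cong (*-congˡ (linear₂ r₁)) (linear₂ r₀) ⟨
    1# * D r₁ s + D r₀ s                                        ≈⟨ linear₁ s ⟨
    D s s                                                       ≈⟨ Dvv≈0 s ⟩
    0#                                                          ∎
    where
    κ : Fin (2 ℕ.+ n)
    κ = suc (suc k)
    r₀ r₁ s : Vector Carrier (2 ℕ.+ n)
    r₀ = A zero
    r₁ = A (suc zero)
    s j = 1# * r₁ j + r₀ j
    B : Vector Carrier (2 ℕ.+ n) → Vector Carrier (2 ℕ.+ n) → Matrix (2 ℕ.+ n) (2 ℕ.+ n)
    B v w = A [ suc zero ]≔ v [ κ ]≔ w
    D : Vector Carrier (2 ℕ.+ n) → Vector Carrier (2 ℕ.+ n) → Carrier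
    D v w = det (B v w)
    A≈B : ∀ i j → A i j ≈ B r₁ r₀ i j
    A≈B zero          j = refl
    A≈B (suc zero)    j = refl
    A≈B (suc (suc i)) j with i Fin.≟ k
    ... | yes ≡.refl = trans (sym (A₀≈Aₖ j)) (sym ([]≔-updates (λ i → A (suc (suc i))) i r₀ j))
    ... | no  i≢k    = sym ([]≔-minimal (λ i → A (suc (suc i))) k r₀ i≢k j)
    Dvv≈0 : ∀ v → D v v ≈ 0#
    Dvv≈0 v = alternating (B v v) λ j → sym ([]≔-updates (A [ suc zero ]≔ v) κ v j)
    D₀₁≈0 : D r₀ r₁ ≈ 0#
    D₀₁≈0 = det-rows01 (B r₀ r₁) λ j → refl
    linear₂ : ∀ v → D v s ≈ 1# * D v r₁ + D v r₀
    linear₂ v = []≔-linear (A [ suc zero ]≔ v) κ 1# r₁ r₀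
    linear₁ : ∀ w → D s w ≈ 1# * D r₁ w + D r₀ w
    linear₁ w = det-linear {A = B s w} {B r₁ w} {B r₀ w} (suc zero) 1# (λ j → refl) (other r₁) (other r₀)
      where
      other : ∀ v i → i ≢ suc zero → ∀ j → B s w i j ≈ B v w i j
      other v zero          i≢1 j = refl
      other v (suc zero)    i≢1 j = contradiction ≡.refl i≢1
      other v (suc (suc i)) i≢1 j = refl

  det-minors≈0 : ∀ {n} (A : Matrix (suc n) (suc n)) → (∀ j → det (minor A j) ≈ 0#) → det A ≈ 0#
  det-minors≈0 A minors≈0 = sum-zero (λ j → (- 1#) ^ toℕ j * A zero j * det (minor A j)) λ j →
    trans (*-congˡ {(- 1#) ^ toℕ j * A zero j} (minors≈0 j)) (zeroʳ _)

  -- Two equal rows below row 0 remain equal in every minor, so induction applies. Row 0 and row 1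
  -- are settled by double expansion. Row 0 and a later row are reduced to row 1 and that row, which
  -- again survive in the minors.
  det-alternating : ∀ {n} (A : Matrix n n) {i k} → i ≢ k → (∀ j → A i j ≈ A k j) → det A ≈ 0#
  det-alternating A {zero}  {zero}  i≢k Aᵢ≈Aₖ = contradiction ≡.refl i≢k
  det-alternating A {suc i} {suc k} i≢k Aᵢ≈Aₖ = det-minors≈0 A λ j →
    det-alternating (minor A j) (i≢k ∘ ≡.cong suc) (Aᵢ≈Aₖ ∘ punchIn j)
  det-alternating {suc (suc n)} A {suc zero} {zero} i≢k Aᵢ≈Aₖ = det-rows01 A (sym ∘ Aᵢ≈Aₖ)
  det-alternating {suc (suc n)} A {zero} {suc zero} i≢k Aᵢ≈Aₖ = det-rows01 A Aᵢ≈Aₖ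
  det-alternating {suc (suc (suc n))} A {zero} {suc (suc k)} i≢k Aᵢ≈Aₖ = det-rows02+ A k Aᵢ≈Aₖ
    (λ B rows → det-minors≈0 B λ j → det-alternating (minor B j) {zero} {suc k} (λ ()) (rows ∘ punchIn j))
  det-alternating {suc (suc (suc n))} A {suc (suc i)} {zero} i≢k Aᵢ≈Aₖ = det-rows02+ A i (sym ∘ Aᵢ≈Aₖ)
    (λ B rows → det-minors≈0 B λ j → det-alternating (minor B j) {zero} {suc i} (λ ()) (rows ∘ punchIn j))

  -- The matrix determinant lemma without the adjugate. In the multilinear expansion every term with
  -- b in two rows vanishes, so only the terms of degree at most one in a remain.
  det-rankOne : ∀ {n} (A : Matrix n n) (a b : Vector Carrier n) →
    det (λ i j → A i j + a i * b j) ≈ det A + sum (λ i → a i * det (A [ i ]≔ b))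
  det-rankOne {zero}  A a b = sym (+-identityʳ 1#)
  det-rankOne {suc n} A a b = begin
    sum (λ j → s j * (A zero j + a zero * b j) * det (λ i k → minor A j i k + a (suc i) * b (punchIn j k)))
      ≈⟨ sum-cong-≋ (λ j → begin
        s j * (A zero j + a zero * b j) * det (λ i k → minor A j i k + a (suc i) * b (punchIn j k))
          ≈⟨ *-congˡ (det-rankOne (minor A j) (a ∘ suc) (b ∘ punchIn j)) ⟩
        s j * (A zero j + a zero * b j) * (det (minor A j) + T j)
          ≈⟨ solve 6 (λ s x a y d t → s :* (x :+ a :* y) :* (d :+ t) := (s :* x :* d :+ a :* (s :* y :* (d :+ t))) :+ s :* x :* t)
               refl (s j) (A zero j) (a zero) (b j) (det (minor A j)) (T j) ⟩
        (s j * A zero j * det (minor A j) + a zero * (s j * b j * (det (minor A j) + T j))) + s j * A zero j * T j ∎) ⟩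
    sum (λ j → (s j * A zero j * det (minor A j) + a zero * (s j * b j * (det (minor A j) + T j))) + s j * A zero j * T j)
      ≈⟨ trans (∑-distrib-+ (λ j → s j * A zero j * det (minor A j) + a zero * (s j * b j * (det (minor A j) + T j))) (λ j → s j * A zero j * T j))
           (+-congʳ (∑-distrib-+ (λ j → s j * A zero j * det (minor A j)) (λ j → a zero * (s j * b j * (det (minor A j) + T j))))) ⟩
    det A + sum (λ j → a zero * (s j * b j * (det (minor A j) + T j))) + sum (λ j → s j * A zero j * T j)
      ≈⟨ +-cong (+-congˡ top) (lower A) ⟩
    det A + a zero * det (A [ zero ]≔ b) + sum (λ i → a (suc i) * det (A [ suc i ]≔ b))
      ≈⟨ +-assoc _ _ _ ⟩
    det A + sum (λ i → a i * det (A [ i ]≔ b)) ∎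
    where
    s : Fin (suc n) → Carrier
    s j = (- 1#) ^ toℕ j

    T : Fin (suc n) → Carrier
    T j = sum (λ i → a (suc i) * det (minor A j [ i ]≔ (b ∘ punchIn j)))

    minor-[]≔ : ∀ (C : Matrix (suc n) (suc n)) j i →
      det (minor C j [ i ]≔ (b ∘ punchIn j)) ≈ det (minor (C [ suc i ]≔ b) j)
    minor-[]≔ C j i = det-cong λ k l → pointwise k l (k Fin.≟ i)
      where
      pointwise : ∀ k l → Dec (k ≡ i) → (minor C j [ i ]≔ (b ∘ punchIn j)) k l ≈ (C [ suc i ]≔ b) (suc k) (punchIn j l)
      pointwise k l (yes ≡.refl) = trans ([]≔-updates (minor C j) i (b ∘ punchIn j) l) (sym ([]≔-updates C (suc i) b (punchIn j l)))
      pointwise k l (no k≢i)     = trans ([]≔-minimal (minor C j) i (b ∘ punchIn j) k≢i l)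
                                         (sym ([]≔-minimal C (suc i) b (k≢i ∘ Fin.suc-injective) (punchIn j l)))

    -- Stated for every C because it serves both A and A with b in row 0; the minors along row 0 are
    -- the same for the two.
    lower : ∀ C → sum (λ j → s j * C zero j * sum (λ i → a (suc i) * det (minor C j [ i ]≔ (b ∘ punchIn j))))
                  ≈ sum (λ i → a (suc i) * det (C [ suc i ]≔ b))
    lower C = begin
      sum (λ j → s j * C zero j * sum (λ i → a (suc i) * det (minor C j [ i ]≔ (b ∘ punchIn j))))
        ≈⟨ sum-cong-≋ (λ j → trans (*-distribˡ-sum (s j * C zero j) (λ i → a (suc i) * det (minor C j [ i ]≔ (b ∘ punchIn j))))
             (sum-cong-≋ λ i → trans (*-congˡ (*-congˡ (minor-[]≔ C j i)))
               (solve 3 (λ x y z → x :* (y :* z) := y :* (x :* z)) refl (s j * C zero j) (a (suc i)) (det (minor (C [ suc i ]≔ b) j))))) ⟩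
      sum (λ j → sum (λ i → a (suc i) * (s j * C zero j * det (minor (C [ suc i ]≔ b) j))))
        ≈⟨ ∑-comm (λ j i → a (suc i) * (s j * C zero j * det (minor (C [ suc i ]≔ b) j))) ⟩
      sum (λ i → sum (λ j → a (suc i) * (s j * C zero j * det (minor (C [ suc i ]≔ b) j))))
        ≈⟨ sum-cong-≋ (λ i → *-distribˡ-sum (a (suc i)) (λ j → s j * C zero j * det (minor (C [ suc i ]≔ b) j))) ⟨
      sum (λ i → a (suc i) * det (C [ suc i ]≔ b)) ∎

    top : sum (λ j → a zero * (s j * b j * (det (minor A j) + T j))) ≈ a zero * det (A [ zero ]≔ b)
    top = begin
      sum (λ j → a zero * (s j * b j * (det (minor A j) + T j)))
        ≈⟨ *-distribˡ-sum (a zero) (λ j → s j * b j * (det (minor A j) + T j)) ⟨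
      a zero * sum (λ j → s j * b j * (det (minor A j) + T j))
        ≈⟨ *-congˡ (trans (sum-cong-≋ λ j → distribˡ (s j * b j) (det (minor A j)) (T j))
             (∑-distrib-+ (λ j → s j * b j * det (minor A j)) (λ j → s j * b j * T j))) ⟩
      a zero * (det (A [ zero ]≔ b) + sum (λ j → s j * b j * T j))
        -- Each summand is now a determinant with b both in row 0 and in row `suc i`.
        ≈⟨ *-congˡ (+-congˡ (trans (lower (A [ zero ]≔ b)) (sum-zero _ λ i →
             trans (*-congˡ (det-alternating (A [ zero ]≔ b [ suc i ]≔ b) {zero} {suc i} (λ ())
               λ j → sym ([]≔-updates (A [ zero ]≔ b) (suc i) b j))) (zeroʳ _)))) ⟩
      a zero * (det (A [ zero ]≔ b) + 0#)
        ≈⟨ *-congˡ (+-identityʳ _) ⟩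
      a zero * det (A [ zero ]≔ b) ∎

  IsLeftEigenvector : ∀ {n} → Matrix n n → Carrier → Vector Carrier n → Set ℓ
  IsLeftEigenvector A μ q = ∀ j → sum (λ i → q i * A i j) ≈ μ * q j

  -- Row i is replaced by μ q = q A, a combination of the rows of A; by alternation only the
  -- multiple of row i itself contributes. In terms of the adjugate this is μ (q adj A) = (det A) q.
  eigenvector-[]≔ : ∀ {n} (A : Matrix n n) μ q → IsLeftEigenvector A μ q →
    ∀ i → μ * det (A [ i ]≔ q) ≈ q i * det A
  eigenvector-[]≔ A μ q qA≈μq i = begin
    μ * det (A [ i ]≔ q)                              ≈⟨ +-identityʳ _ ⟨
    μ * det (A [ i ]≔ q) + 0#                         ≈⟨ +-congˡ ([]≔-zero A i) ⟨
    μ * det (A [ i ]≔ q) + det (A [ i ]≔ const 0#)    ≈⟨ []≔-linear A i μ q (const 0#) ⟨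
    det (A [ i ]≔ (λ j → μ * q j + 0#))               ≈⟨ []≔-cong A i (λ j → trans (+-identityʳ _) (sym (qA≈μq j))) ⟩
    det (A [ i ]≔ (λ j → sum (λ k → q k * A k j)))    ≈⟨ []≔-sum A i q A ⟩
    sum (λ k → q k * det (A [ i ]≔ A k))              ≈⟨ sum-only _ i (λ k k≢i → trans (*-congˡ (det-alternating (A [ i ]≔ A k) {i} {k} (k≢i ∘ ≡.sym)
                                                           λ j → trans ([]≔-updates A i (A k) j) (sym ([]≔-minimal A i (A k) k≢i j)))) (zeroʳ _)) ⟩
    q i * det (A [ i ]≔ A i)                          ≈⟨ *-congˡ ([]≔-self A i) ⟩
    q i * det A                                       ∎

  det-rankOne-eigenvector : ∀ {n} (A : Matrix n n) μ q → IsLeftEigenvector A μ q → ∀ x →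
    μ * det (λ i j → A i j + x * (q i * q j)) ≈ (μ + x * (q ⊡ q)) * det A
  det-rankOne-eigenvector A μ q qA≈μq x = begin
    μ * det (λ i j → A i j + x * (q i * q j))
      ≈⟨ *-congˡ (det-cong λ i j → +-congˡ (sym (*-assoc x (q i) (q j)))) ⟩
    μ * det (λ i j → A i j + (x * q i) * q j)
      ≈⟨ *-congˡ (det-rankOne A (λ i → x * q i) q) ⟩
    μ * (det A + sum (λ i → x * q i * det (A [ i ]≔ q)))
      ≈⟨ distribˡ μ _ _ ⟩
    μ * det A + μ * sum (λ i → x * q i * det (A [ i ]≔ q))
      ≈⟨ +-congˡ (*-distribˡ-sum μ (λ i → x * q i * det (A [ i ]≔ q))) ⟩
    μ * det A + sum (λ i → μ * (x * q i * det (A [ i ]≔ q)))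
      ≈⟨ +-congˡ (sum-cong-≋ λ i → begin
        μ * (x * q i * det (A [ i ]≔ q))      ≈⟨ solve 4 (λ m x q d → m :* (x :* q :* d) := x :* q :* (m :* d)) refl μ x (q i) (det (A [ i ]≔ q)) ⟩
        x * q i * (μ * det (A [ i ]≔ q))      ≈⟨ *-congˡ (eigenvector-[]≔ A μ q qA≈μq i) ⟩
        x * q i * (q i * det A)               ≈⟨ solve 3 (λ x q d → x :* q :* (q :* d) := x :* d :* (q :* q)) refl x (q i) (det A) ⟩
        x * det A * (q i * q i)               ∎) ⟩
    μ * det A + sum (λ i → x * det A * (q i * q i))
      ≈⟨ +-congˡ (*-distribˡ-sum (x * det A) (λ i → q i * q i)) ⟨
    μ * det A + x * det A * (q ⊡ q)
      ≈⟨ solve 4 (λ m d x s → m :* d :+ x :* d :* s := (m :+ x :* s) :* d) refl μ (det A) x (q ⊡ q) ⟩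
    (μ + x * (q ⊡ q)) * det A ∎

  basis-self : ∀ {n} (i : Fin n) → basis i i ≈ 1#
  basis-self i with i Fin.≟ i
  ... | yes _   = refl
  ... | no  i≢i = contradiction ≡.refl i≢i

  basis-other : ∀ {n} {i j : Fin n} → i ≢ j → basis i j ≈ 0#
  basis-other {i = i} {j} i≢j with i Fin.≟ j
  ... | yes i≡j = contradiction i≡j i≢j
  ... | no  _   = refl

  det-scalar : ∀ n x → det {n} (λ i j → x * basis i j) ≈ x ^ n
  det-scalar zero    x = refl
  det-scalar (suc n) x = begin
    sum term                                            ≈⟨ sum-only term zero (λ j j≢0 → trans (*-congʳ (trans (*-congˡ (off-diagonal j≢0)) (zeroʳ _))) (zeroˡ _)) ⟩
    1# * (x * 1#) * det {n} (λ i k → x * basis i k)     ≈⟨ *-cong (trans (*-identityˡ _) (*-identityʳ x)) (det-scalar n x) ⟩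
    x * x ^ n                                           ∎
    where
    term : Fin (suc n) → Carrier
    term j = (- 1#) ^ toℕ j * (x * basis {suc n} zero j) * det {n} (λ i k → x * basis {suc n} (suc i) (punchIn j k))
    off-diagonal : ∀ {j} → j ≢ zero → x * basis {suc n} zero j ≈ 0#
    off-diagonal j≢0 = trans (*-congˡ (basis-other (j≢0 ∘ ≡.sym))) (zeroʳ x)

-- Sums over edges, iterated rank-one updates and graph Laplacians

module Sums {c ℓ} (R : CompleteOrderedField c ℓ) where
  open CompleteOrderedField R
  open import Algebra.Definitions.RawSemiring (Semiring.rawSemiring semiring) using (product)
  open LinearAlgebra R
  open Determinant R
  open RingSolver commutativeRing
  open import Algebra.Properties.Semiring.Sum semiring hiding (sum)
  open import Relation.Binary.Reasoning.Setoid setoid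

  total : ∀ {a} {A : Set a} → (A → Carrier) → List A → Carrier
  total f = List.foldr (λ x s → f x + s) 0#

  sum-lookup : ∀ {a} {A : Set a} (f : A → Carrier) xs → sum (λ e → f (List.lookup xs e)) ≈ total f xs
  sum-lookup f []       = refl
  sum-lookup f (x ∷ xs) = +-congˡ (sum-lookup f xs)

  total-++ : ∀ {a} {A : Set a} (f : A → Carrier) xs ys → total f (xs ++ ys) ≈ total f xs + total f ys
  total-++ f []       ys = sym (+-identityˡ _)
  total-++ f (x ∷ xs) ys = trans (+-congˡ (total-++ f xs ys)) (sym (+-assoc _ _ _))

  total-map : ∀ {a b} {A : Set a} {B : Set b} (f : B → Carrier) (g : A → B) xs → total f (List.map g xs) ≈ total (f ∘ g) xs
  total-map f g []       = refl
  total-map f g (x ∷ xs) = +-congˡ (total-map f g xs)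

  total-filter : ∀ {a p} {A : Set a} {P : Pred A p} (P? : Decidable P) (f : A → Carrier) xs →
    total f (filter P? xs) ≈ total (λ x → if does (P? x) then f x else 0#) xs
  total-filter P? f []       = refl
  total-filter P? f (x ∷ xs) with does (P? x)
  ... | true  = +-congˡ (total-filter P? f xs)
  ... | false = trans (total-filter P? f xs) (sym (+-identityˡ _))

  total-cartesianProduct : ∀ {a b} {A : Set a} {B : Set b} (f : A × B → Carrier) xs ys →
    total f (cartesianProduct xs ys) ≈ total (λ x → total (λ y → f (x , y)) ys) xs
  total-cartesianProduct f []       ys = refl
  total-cartesianProduct f (x ∷ xs) ys = trans (total-++ f (List.map (x ,_) ys) (cartesianProduct xs ys))
    (+-cong (total-map f (x ,_) ys) (total-cartesianProduct f xs ys))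

  total-tabulate : ∀ {a} {A : Set a} {n} (f : A → Carrier) (g : Fin n → A) → total f (tabulate g) ≈ sum (f ∘ g)
  total-tabulate {n = zero}  f g = refl
  total-tabulate {n = suc n} f g = +-congˡ (total-tabulate f (g ∘ suc))

  total-cong : ∀ {a} {A : Set a} {f g : A → Carrier} → (∀ x → f x ≈ g x) → ∀ xs → total f xs ≈ total g xs
  total-cong f≈g []       = refl
  total-cong f≈g (x ∷ xs) = +-cong (f≈g x) (total-cong f≈g xs)

  below : ∀ {n} → (Fin n → Fin n → Carrier) → Fin n → Fin n → Carrier
  below f i j = if does (i Fin.<? j) then f i j else 0#

  sum-edges : ∀ n (f : Fin n × Fin n → Carrier) →
    sum (λ e → f (List.lookup (edges n) e)) ≈ sum (λ i → sum (λ j → below (λ i j → f (i , j)) i j))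
  sum-edges n f = begin
    sum (λ e → f (List.lookup (edges n) e))                     ≈⟨ sum-lookup f (edges n) ⟩
    total f (edges n)                                           ≈⟨ total-filter (λ (i , j) → i Fin.<? j) f (cartesianProduct (allFin n) (allFin n)) ⟩
    total g (cartesianProduct (allFin n) (allFin n))            ≈⟨ total-cartesianProduct g (allFin n) (allFin n) ⟩
    total (λ i → total (λ j → g (i , j)) (allFin n)) (allFin n) ≈⟨ total-cong (λ i → total-tabulate (λ j → g (i , j)) id) (allFin n) ⟩
    total (λ i → sum (λ j → g (i , j))) (allFin n)              ≈⟨ total-tabulate (λ i → sum (λ j → g (i , j))) id ⟩
    sum (λ i → sum (λ j → g (i , j)))                           ∎
    where
    g : Fin n × Fin n → Carrier
    g (i , j) = below (λ i j → f (i , j)) i j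

  if-yes : ∀ {p} {P : Set p} (P? : Dec P) {x y : Carrier} → P → (if does P? then x else y) ≈ x
  if-yes (yes _) p = refl
  if-yes (no ¬p) p = contradiction p ¬p

  if-no : ∀ {p} {P : Set p} (P? : Dec P) {x y : Carrier} → ¬ P → (if does P? then x else y) ≈ y
  if-no (yes p) ¬p = contradiction p ¬p
  if-no (no _)  ¬p = refl

  if-cong : ∀ {p} {P : Set p} (P? : Dec P) {x y z : Carrier} → (P → x ≈ y) →
    (if does P? then x else z) ≈ (if does P? then y else z)
  if-cong (yes p) x≈y = x≈y p
  if-cong (no _)  x≈y = refl

  below-cong : ∀ {n} (f g : Fin n → Fin n → Carrier) → (∀ i j → i ≢ j → f i j ≈ g i j) → ∀ i j → below f i j ≈ below g i j
  below-cong f g f≈g i j = if-cong (i Fin.<? j) (λ i<j → f≈g i j (Fin.<⇒≢ i<j))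

  below+below : ∀ {n} (g : Fin n → Fin n → Carrier) → (∀ i j → g i j ≈ g j i) → (∀ i → g i i ≈ 0#) →
    ∀ i j → below g i j + below g j i ≈ g i j
  below+below g g-sym g-diag i j with Fin.<-cmp i j
  ... | tri< i<j _ j≮i    = trans (+-cong (if-yes (i Fin.<? j) i<j) (if-no (j Fin.<? i) j≮i)) (+-identityʳ _)
  ... | tri≈ i≮i ≡.refl _ = trans (+-cong (if-no (i Fin.<? i) i≮i) (if-no (i Fin.<? i) i≮i)) (trans (+-identityˡ 0#) (sym (g-diag i)))
  ... | tri> i≮j _ j<i    = trans (+-cong (if-no (i Fin.<? j) i≮j) (if-yes (j Fin.<? i) j<i)) (trans (+-identityˡ _) (g-sym j i))

  -- Doubling turns the sum over edges i < j into a sum over all ordered pairs, which can be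
  -- rearranged without regard to the order of the indices.
  sum-below : ∀ {n} (g : Fin n → Fin n → Carrier) → (∀ i j → g i j ≈ g j i) → (∀ i → g i i ≈ 0#) →
    sum (λ i → sum (below g i)) + sum (λ i → sum (below g i)) ≈ sum (λ i → sum (g i))
  sum-below g g-sym g-diag = begin
    sum (λ i → sum (below g i)) + sum (λ i → sum (below g i))                  ≈⟨ +-congˡ (∑-comm (below g)) ⟩
    sum (λ i → sum (below g i)) + sum (λ i → sum (λ j → below g j i))          ≈⟨ ∑-distrib-+ (λ i → sum (below g i)) (λ i → sum (λ j → below g j i)) ⟨
    sum (λ i → sum (below g i) + sum (λ j → below g j i))                      ≈⟨ sum-cong-≋ (λ i → trans (sym (∑-distrib-+ (below g i) (λ j → below g j i)))
                                                                                    (sum-cong-≋ (below+below g g-sym g-diag i))) ⟩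
    sum (λ i → sum (g i))                                                      ∎

  sum-basis : ∀ {n} k (h : Fin n → Carrier) → sum (λ i → basis i k * h i) ≈ h k
  sum-basis k h = trans (sum-only (λ i → basis i k * h i) k (λ i i≢k → trans (*-congʳ (basis-other i≢k)) (zeroˡ _)))
                        (trans (*-congʳ (basis-self k)) (*-identityˡ _))

  sum-splitAt : ∀ m n (f : Fin (m ℕ.+ n) → Carrier) → sum f ≈ sum (λ i → f (i ↑ˡ n)) + sum (λ j → f (m ↑ʳ j))
  sum-splitAt zero    n f = sym (+-identityˡ _)
  sum-splitAt (suc m) n f = trans (+-congˡ (sum-splitAt m n (f ∘ suc))) (sym (+-assoc _ _ _))

  sum-remQuot : ∀ m n (f : Fin m × Fin n → Carrier) → sum (λ r → f (remQuot {m} n r)) ≈ sum (λ i → sum (λ j → f (i , j)))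
  sum-remQuot zero    n f = refl
  sum-remQuot (suc m) n f = begin
    sum (λ r → f (remQuot {suc m} n r))
      ≈⟨ sum-splitAt n (m ℕ.* n) (λ r → f (remQuot {suc m} n r)) ⟩
    sum (λ j → f (remQuot {suc m} n (j ↑ˡ (m ℕ.* n)))) + sum (λ r → f (remQuot {suc m} n (n ↑ʳ r)))
      ≈⟨ +-cong (sum-cong-≋ (λ j → reflexive (≡.cong f (remQuot-↑ˡ j)))) (sum-cong-≋ (λ r → reflexive (≡.cong f (remQuot-↑ʳ r)))) ⟩
    sum (λ j → f (zero , j)) + sum (λ r → f (suc (proj₁ (remQuot {m} n r)) , proj₂ (remQuot {m} n r)))
      ≈⟨ +-congˡ (sum-remQuot m n (λ (i , j) → f (suc i , j))) ⟩
    sum (λ i → sum (λ j → f (i , j))) ∎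
    where
    remQuot-↑ˡ : ∀ j → remQuot {suc m} n (j ↑ˡ (m ℕ.* n)) ≡ (zero , j)
    remQuot-↑ˡ j rewrite splitAt-↑ˡ n j (m ℕ.* n) = ≡.refl
    remQuot-↑ʳ : ∀ r → remQuot {suc m} n (n ↑ʳ r) ≡ (suc (proj₁ (remQuot {m} n r)) , proj₂ (remQuot {m} n r))
    remQuot-↑ʳ r rewrite splitAt-↑ʳ n (m ℕ.* n) r = ≡.refl

  left-rankOnes : ∀ {n t} (A : Matrix n n) {μ} {q} (x : Fin t → Carrier) (w : Fin t → Vector Carrier n) →
    IsLeftEigenvector A μ q → ∀ s →
    sum (λ r → q r * (A r s + sum (λ i → x i * (w i r * w i s)))) ≈ μ * q s + sum (λ i → x i * (q ⊡ w i) * w i s)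
  left-rankOnes A {μ} {q} x w qA≈μq s = begin
    sum (λ r → q r * (A r s + sum (λ i → x i * (w i r * w i s))))
      ≈⟨ sum-cong-≋ (λ r → trans (distribˡ (q r) (A r s) _) (+-congˡ (*-distribˡ-sum (q r) (λ i → x i * (w i r * w i s))))) ⟩
    sum (λ r → q r * A r s + sum (λ i → q r * (x i * (w i r * w i s))))
      ≈⟨ ∑-distrib-+ (λ r → q r * A r s) (λ r → sum (λ i → q r * (x i * (w i r * w i s)))) ⟩
    sum (λ r → q r * A r s) + sum (λ r → sum (λ i → q r * (x i * (w i r * w i s))))
      ≈⟨ +-cong (qA≈μq s) (∑-comm (λ r i → q r * (x i * (w i r * w i s)))) ⟩
    μ * q s + sum (λ i → sum (λ r → q r * (x i * (w i r * w i s))))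
      ≈⟨ +-congˡ (sum-cong-≋ λ i → begin
        sum (λ r → q r * (x i * (w i r * w i s)))   ≈⟨ sum-cong-≋ (λ r → solve 4 (λ q x w v → q :* (x :* (w :* v)) := (x :* v) :* (q :* w)) refl (q r) (x i) (w i r) (w i s)) ⟩
        sum (λ r → x i * w i s * (q r * w i r))     ≈⟨ *-distribˡ-sum (x i * w i s) (λ r → q r * w i r) ⟨
        x i * w i s * (q ⊡ w i)                     ≈⟨ solve 3 (λ x w d → x :* w :* d := x :* d :* w) refl (x i) (w i s) (q ⊡ w i) ⟩
        x i * (q ⊡ w i) * w i s                     ∎) ⟩
    μ * q s + sum (λ i → x i * (q ⊡ w i) * w i s) ∎

  -- This lets updates be composed: an eigenvector orthogonal to the directions already added keeps
  -- its eigenvalue.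
  IsLeftEigenvector-rankOnes : ∀ {n t} (A : Matrix n n) {μ} {q} (x : Fin t → Carrier) (w : Fin t → Vector Carrier n) →
    IsLeftEigenvector A μ q → (∀ i → q ⊡ w i ≈ 0#) →
    IsLeftEigenvector (λ r s → A r s + sum (λ i → x i * (w i r * w i s))) μ q
  IsLeftEigenvector-rankOnes A {μ} {q} x w qA≈μq q⊥w s = trans (left-rankOnes A {μ} {q} x w qA≈μq s)
    (trans (+-congˡ (sum-zero (λ i → x i * (q ⊡ w i) * w i s) λ i →
      trans (*-congʳ (trans (*-congˡ (q⊥w i)) (zeroʳ (x i)))) (zeroˡ _))) (+-identityʳ _))

  -- The first direction is absorbed into the matrix. By orthogonality the remaining ones are still
  -- eigenvectors for μ, and every direction contributes one application of
  -- `det-rankOne-eigenvector`.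
  det-orthogonal : ∀ {n} t (A : Matrix n n) μ σ (x : Fin t → Carrier) (q : Fin t → Vector Carrier n) →
    (∀ i → IsLeftEigenvector A μ (q i)) → (∀ i j → i ≢ j → q i ⊡ q j ≈ 0#) → (∀ i → q i ⊡ q i ≈ σ) →
    μ ^ t * det (λ r s → A r s + sum (λ i → x i * (q i r * q i s))) ≈ product (λ i → μ + x i * σ) * det A
  det-orthogonal {n} zero A μ σ x q eigen orth norm = *-congˡ (det-cong {n} {B = A} λ r s → +-identityʳ _)
  det-orthogonal {n} (suc t) A μ σ x q eigen orth norm = begin
    μ * μ ^ t * det (λ r s → A r s + (x₀ * (q zero r * q zero s) + sum (λ i → x (suc i) * (q (suc i) r * q (suc i) s))))
      ≈⟨ trans (*-assoc _ _ _) (*-congˡ (*-congˡ (det-cong {n} λ r s →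
           trans (sym (+-assoc (A r s) _ _)) (+-congʳ (+-congˡ (sym (+-identityʳ _))))))) ⟩
    μ * (μ ^ t * det (λ r s → A′ r s + sum (λ i → x (suc i) * (q (suc i) r * q (suc i) s))))
      ≈⟨ *-congˡ (det-orthogonal t A′ μ σ (x ∘ suc) (q ∘ suc)
           (λ i → IsLeftEigenvector-rankOnes A {μ} {q (suc i)} (λ (_ : Fin 1) → x₀) (λ _ → q zero) (eigen (suc i)) (λ _ → orth (suc i) zero (λ ())))
           (λ i j i≢j → orth (suc i) (suc j) (i≢j ∘ Fin.suc-injective)) (norm ∘ suc)) ⟩
    μ * (p * det A′)
      ≈⟨ solve 3 (λ m p d → m :* (p :* d) := p :* (m :* d)) refl μ p (det A′) ⟩
    p * (μ * det A′)
      ≈⟨ *-congˡ (*-congˡ (det-cong {n} λ r s → +-congˡ (+-identityʳ _))) ⟩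
    p * (μ * det (λ r s → A r s + x₀ * (q zero r * q zero s)))
      ≈⟨ *-congˡ (det-rankOne-eigenvector A μ (q zero) (eigen zero) x₀) ⟩
    p * ((μ + x₀ * (q zero ⊡ q zero)) * det A)
      ≈⟨ *-congˡ (*-congʳ (+-congˡ (*-congˡ (norm zero)))) ⟩
    p * ((μ + x₀ * σ) * det A)
      ≈⟨ solve 3 (λ p m d → p :* (m :* d) := (m :* p) :* d) refl p (μ + x₀ * σ) (det A) ⟩
    (μ + x₀ * σ) * p * det A ∎
    where
    x₀ p : Carrier
    x₀ = x zero
    p = product (λ i → μ + x (suc i) * σ)
    A′ : Matrix n n
    -- The update is written as a sum over `Fin 1` to fit `IsLeftEigenvector-rankOnes`, which
    -- accounts for the extra `+ 0#` in the chain.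
    A′ r s = A r s + sum (λ (_ : Fin 1) → x₀ * (q zero r * q zero s))

  basis-sym : ∀ {n} (i j : Fin n) → basis i j ≈ basis j i
  basis-sym i j with i Fin.≟ j
  ... | yes ≡.refl = sym (basis-self i)
  ... | no  i≢j    = sym (basis-other (i≢j ∘ ≡.sym))

  sum-basisʳ : ∀ {n} k (h : Fin n → Carrier) → sum (λ i → basis k i * h i) ≈ h k
  sum-basisʳ k h = trans (sum-cong-≋ λ i → *-congʳ (basis-sym k i)) (sum-basis k h)

  scalar-eigenvector : ∀ {n} x q → IsLeftEigenvector (λ (r s : Fin n) → x * basis r s) x q
  scalar-eigenvector x q s = trans
    (sum-cong-≋ λ r → solve 3 (λ q x b → q :* (x :* b) := b :* (x :* q)) refl (q r) x (basis r s))
    (sum-basis s (λ r → x * q r))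

  half-≈ : ∀ {x y} → x + x ≈ y + y → x ≈ y
  half-≈ {x} {y} eq = begin
    x             ≈⟨ half x ⟨
    ½ * (x + x)   ≈⟨ *-congˡ eq ⟩
    ½ * (y + y)   ≈⟨ half y ⟩
    y             ∎
    where
    open OrderedField R using (½; ½+½≈1)
    half : ∀ x → ½ * (x + x) ≈ x
    half x = trans (solve 2 (λ h x → h :* (x :+ x) := (h :+ h) :* x) refl ½ x) (trans (*-congʳ ½+½≈1) (*-identityˡ x))

  -- Both sides are twice an entry of the Laplacian of the complete graph with weights D, each edge
  -- being counted in both directions. The diagonal weights cancel on the right for k = l, so D may
  -- be nonzero there, as it is for `edgeProjection`.
  sum-graphLaplacian : ∀ {n} (D : Fin n → Fin n → Carrier) → (∀ i j → D i j ≈ D j i) → ∀ k l →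
    sum (λ i → sum (λ j → (basis i k - basis j k) * (basis i l - basis j l) * D i j)) ≈
    (basis k l * sum (D k) - D k l) + (basis k l * sum (D k) - D k l)
  sum-graphLaplacian {n} D D-sym k l = begin
    sum (λ i → sum (λ j → (basis i k - basis j k) * (basis i l - basis j l) * D i j))
      ≈⟨ sum-cong-≋ (λ i → trans (sum-cong-≋ λ j → split i j) (∑-distrib-+ (A i) (λ j → A j i))) ⟩
    sum (λ i → sum (A i) + sum (λ j → A j i))
      ≈⟨ trans (∑-distrib-+ (λ i → sum (A i)) (λ i → sum (λ j → A j i))) (+-congˡ (∑-comm (λ i j → A j i))) ⟩
    sum (λ i → sum (A i)) + sum (λ i → sum (A i))
      ≈⟨ +-cong total-A total-A ⟩
    (basis k l * sum (D k) - D k l) + (basis k l * sum (D k) - D k l) ∎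
    where
    A : Fin n → Fin n → Carrier
    -- These are the products of the expansion that carry `basis i k`; those with `basis j k` form
    -- `A j i` because D is symmetric.
    A i j = basis i k * (basis i l * D i j + - 1# * (basis j l * D i j))
    split : ∀ i j → (basis i k - basis j k) * (basis i l - basis j l) * D i j ≈ A i j + A j i
    split i j = trans
      (solve 5 (λ a b x y d → (a :- b) :* (x :- y) :* d := a :* (x :* d :+ (:- con (+ 1)) :* (y :* d)) :+ b :* (y :* d :+ (:- con (+ 1)) :* (x :* d)))
         refl (basis i k) (basis j k) (basis i l) (basis j l) (D i j))
      (+-congˡ (*-congˡ (+-cong (*-congˡ (D-sym i j)) (*-congˡ (*-congˡ (D-sym i j))))))
    sum-A : ∀ i → sum (A i) ≈ basis i k * (basis i l * sum (D i) - D i l)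
    sum-A i = begin
      sum (A i)
        ≈⟨ *-distribˡ-sum (basis i k) (λ j → basis i l * D i j + - 1# * (basis j l * D i j)) ⟨
      basis i k * sum (λ j → basis i l * D i j + - 1# * (basis j l * D i j))
        ≈⟨ *-congˡ (sum-linear (basis i l) (D i) (λ j → - 1# * (basis j l * D i j))) ⟩
      basis i k * (basis i l * sum (D i) + sum (λ j → - 1# * (basis j l * D i j)))
        ≈⟨ *-congˡ (+-congˡ (trans (sym (*-distribˡ-sum (- 1#) (λ j → basis j l * D i j))) (*-congˡ (sum-basis l (D i))))) ⟩
      basis i k * (basis i l * sum (D i) + - 1# * D i l)
        ≈⟨ solve 4 (λ b c s d → b :* (c :* s :+ (:- con (+ 1)) :* d) := b :* (c :* s :- d)) refl (basis i k) (basis i l) (sum (D i)) (D i l) ⟩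
      basis i k * (basis i l * sum (D i) - D i l) ∎
    total-A : sum (λ i → sum (A i)) ≈ basis k l * sum (D k) - D k l
    total-A = trans (sum-cong-≋ sum-A) (sum-basis k (λ i → basis i l * sum (D i) - D i l))

-- Edge directions between points of the unit circle

module UnitDifference {c ℓ} (A : CommutativeRing c ℓ) where
  open CommutativeRingKit A
  open import Relation.Binary.Reasoning.Setoid setoid

  -- In ℂ this says that the direction of a chord of the unit circle depends, up to sign, only on the product z w.
  chord² : ∀ z z̄ w w̄ → z * z̄ ≈ 1# → w * w̄ ≈ 1# → (z - w) * (z - w) ≈ - (((z - w) * (z̄ - w̄)) * (z * w))
  chord² z z̄ w w̄ zz̄≈1 ww̄≈1 = begin
    (z - w) * (z - w)                                 ≈⟨ solve 2 (λ z w → (z :- w) :* (z :- w) := :- ((z :- w) :* (con (+ 1) :* w :- con (+ 1) :* z))) refl z w ⟩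
    - ((z - w) * (1# * w - 1# * z))                   ≈⟨ -‿cong (*-congˡ (+-cong (*-congʳ zz̄≈1) (-‿cong (*-congʳ ww̄≈1)))) ⟨
    - ((z - w) * ((z * z̄) * w - (w * w̄) * z))         ≈⟨ solve 4 (λ z z̄ w w̄ → :- ((z :- w) :* ((z :* z̄) :* w :- (w :* w̄) :* z))
                                                            := :- (((z :- w) :* (z̄ :- w̄)) :* (z :* w))) refl z z̄ w w̄ ⟩
    - (((z - w) * (z̄ - w̄)) * (z * w))                 ∎

module Planar {c ℓ} (R : CompleteOrderedField c ℓ) (d : ℕ)
  (u v : Vector (CompleteOrderedField.Carrier R) d)
  (H : LinearAlgebra.Subspace R d) (onb : LinearAlgebra.IsOrthonormalBasis R H u v) where
  open CompleteOrderedField R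
  open OrderedField R
  open ComplexNumbers R
  open LinearAlgebra R
  open IsOrthonormalBasis onb
  open Determinant R
  open Sums R
  open RingSolver commutativeRing
  open RingIdentities using (x-y≈0⇒x≈y)
  open import Algebra.Properties.Semiring.Sum semiring hiding (sum)
  open import Relation.Binary.Reasoning.Setoid setoid

  planar : ℂ → Vector Carrier d
  planar z a = proj₁ z * u a + proj₂ z * v a

  ⟪_,_⟫ : ℂ → ℂ → Carrier
  ⟪ z , w ⟫ = proj₁ z * proj₁ w + proj₂ z * proj₂ w

  planar-⊡ : ∀ z w → planar z ⊡ planar w ≈ ⟪ z , w ⟫
  planar-⊡ z@(x , y) w@(x′ , y′) = begin
    sum (λ a → planar z a * planar w a)
      ≈⟨ sum-cong-≋ (λ a → solve 6 (λ x y x′ y′ u v → (x :* u :+ y :* v) :* (x′ :* u :+ y′ :* v)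
           := (x :* x′) :* (u :* u) :+ ((x :* y′ :+ y :* x′) :* (u :* v) :+ (y :* y′) :* (v :* v))) refl x y x′ y′ (u a) (v a)) ⟩
    sum (λ a → (x * x′) * (u a * u a) + ((x * y′ + y * x′) * (u a * v a) + (y * y′) * (v a * v a)))
      ≈⟨ trans (sum-linear (x * x′) (λ a → u a * u a) _) (+-congˡ (trans (sum-linear (x * y′ + y * x′) (λ a → u a * v a) _)
           (+-congˡ (sym (*-distribˡ-sum (y * y′) (λ a → v a * v a)))))) ⟩
    (x * x′) * (u ⊡ u) + ((x * y′ + y * x′) * (u ⊡ v) + (y * y′) * (v ⊡ v))
      ≈⟨ +-cong (*-congˡ u⊡u≈1) (+-cong (*-congˡ u⊡v≈0) (*-congˡ v⊡v≈1)) ⟩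
    (x * x′) * 1# + ((x * y′ + y * x′) * 0# + (y * y′) * 1#)
      ≈⟨ solve 3 (λ a b c → a :* con (+ 1) :+ (b :* con (+ 0) :+ c :* con (+ 1)) := a :+ c) refl (x * x′) (x * y′ + y * x′) (y * y′) ⟩
    x * x′ + y * y′ ∎

  projection : Fin d → Fin d → Carrier
  projection a b = u a * u b + v a * v b

  -- On H, identified with ℂ by u ↦ 1 and v ↦ 𝕚, this is w ↦ z w̄.
  reflection : ℂ → Fin d → Fin d → Carrier
  reflection z a b = proj₁ z * (u a * u b - v a * v b) + proj₂ z * (u a * v b + v a * u b)

  reflection-cong : ∀ {z w} → z ℂ.≈ w → ∀ a b → reflection z a b ≈ reflection w a b
  reflection-cong (x≈ , y≈) a b = +-cong (*-congʳ x≈) (*-congʳ y≈)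

  reflection-sum : ∀ {n} (f : Fin n → ℂ) a b → sum (λ j → reflection (f j) a b) ≈ reflection (ℂ.sum f) a b
  reflection-sum {zero}  f a b = solve 2 (λ x y → con (+ 0) := con (+ 0) :* x :+ con (+ 0) :* y) refl _ _
  reflection-sum {suc n} f a b = trans (+-congˡ (reflection-sum (f ∘ suc) a b))
    (solve 6 (λ x y x′ y′ p q → (x :* p :+ y :* q) :+ (x′ :* p :+ y′ :* q) := (x :+ x′) :* p :+ (y :+ y′) :* q) refl _ _ _ _ _ _)

  𝕚* : ℂ → ℂ
  𝕚* (x , y) = - y , x

  reflection-* : ∀ z w a b → reflection (z ℂ.* w) a b ≈ planar z a * planar w b - planar (𝕚* z) a * planar (𝕚* w) b
  reflection-* (x , y) (x′ , y′) a b = solve 8 (λ x y x′ y′ ua va ub vb →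
    (x :* x′ :- y :* y′) :* (ua :* ub :- va :* vb) :+ (x :* y′ :+ y :* x′) :* (ua :* vb :+ va :* ub)
    := (x :* ua :+ y :* va) :* (x′ :* ub :+ y′ :* vb) :- ((:- y) :* ua :+ x :* va) :* ((:- y′) :* ub :+ x′ :* vb))
    refl x y x′ y′ (u a) (v a) (u b) (v b)

  edgeProjection : ℂ → ℂ → Fin d → Fin d → Carrier
  edgeProjection z w a b = ½ * (projection a b - reflection (z ℂ.* w) a b)

  -- For every ζ in H, the outer product of ζ with itself is half of `∣ ζ ∣²` times the projection
  -- onto H plus the reflection given by ζ². For a chord, `chord²` replaces ζ² by - `∣ ζ ∣²` z w.
  chord-outer : ∀ z w → ∣ z ∣² ≈ 1# → ∣ w ∣² ≈ 1# → ∀ a b →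
    planar (z ℂ.- w) a * planar (z ℂ.- w) b ≈ ∣ z ℂ.- w ∣² * edgeProjection z w a b
  chord-outer z w ∣z∣ ∣w∣ a b = begin
    planar ζ a * planar ζ b
      ≈⟨ trans (*-congʳ ½+½≈1) (*-identityˡ _) ⟨
    (½ + ½) * (planar ζ a * planar ζ b)
      ≈⟨ solve 7 (λ h x y ua va ub vb → (h :+ h) :* ((x :* ua :+ y :* va) :* (x :* ub :+ y :* vb))
           := h :* ((x :* x :+ y :* y) :* (ua :* ub :+ va :* vb)
                    :+ ((x :* x :- y :* y) :* (ua :* ub :- va :* vb) :+ (x :* y :+ y :* x) :* (ua :* vb :+ va :* ub))))
           refl ½ (proj₁ ζ) (proj₂ ζ) (u a) (v a) (u b) (v b) ⟩
    ½ * (∣ ζ ∣² * projection a b + reflection (ζ ℂ.* ζ) a b)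
      ≈⟨ *-congˡ (+-congˡ (reflection-cong ζ² a b)) ⟩
    ½ * (∣ ζ ∣² * projection a b + reflection (- (∣ ζ ∣² * proj₁ zw) , - (∣ ζ ∣² * proj₂ zw)) a b)
      ≈⟨ solve 7 (λ h n g x y p q → h :* (n :* g :+ ((:- (n :* x)) :* p :+ (:- (n :* y)) :* q)) := n :* (h :* (g :- (x :* p :+ y :* q))))
           refl ½ ∣ ζ ∣² (projection a b) (proj₁ zw) (proj₂ zw) (u a * u b - v a * v b) (u a * v b + v a * u b) ⟩
    ∣ ζ ∣² * edgeProjection z w a b ∎
    where
    ζ zw : ℂ
    ζ = z ℂ.- w
    zw = z ℂ.* w
    inverse : ∀ z → ∣ z ∣² ≈ 1# → z ℂ.* conj z ℂ.≈ ℂ.1#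
    inverse z ∣z∣ = ℂ.trans (*-conj z) (∣z∣ , refl)
    conj-ζ : conj z ℂ.- conj w ℂ.≈ conj ζ
    conj-ζ = refl , solve 2 (λ x y → (:- x) :- (:- y) := :- (x :- y)) refl (proj₂ z) (proj₂ w)
    ζ² : ζ ℂ.* ζ ℂ.≈ (- (∣ ζ ∣² * proj₁ zw) , - (∣ ζ ∣² * proj₂ zw))
    ζ² = ℂ.trans (UnitDifference.chord² (GaussianNumbers.gaussianRing commutativeRing) z (conj z) w (conj w) (inverse z ∣z∣) (inverse w ∣w∣))
      (ℂ.-‿cong (ℂ.trans (ℂ.*-congʳ {zw} (ℂ.trans (ℂ.*-congˡ {ζ} conj-ζ) (*-conj ζ))) (scale ∣ ζ ∣² zw)))

  module _ (F : ElementaryFunctions R) where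
    open ElementaryFunctions F
    open Rigidity F

    -- The factor, the squared length, clears both denominators at once, so the square root enters
    -- only through its square.
    direction-outer : ∀ {k} (x y : Vector Carrier k) → ¬ (x -ⱽ y) ⊡ (x -ⱽ y) ≈ 0# → ∀ a b →
      (x -ⱽ y) ⊡ (x -ⱽ y) * (direction x y a * direction x y b) ≈ (x -ⱽ y) a * (x -ⱽ y) b
    direction-outer x y N≉0 a b = begin
      N * (direction x y a * direction x y b)
        ≈⟨ *-congˡ (*-cong (if-no (x ≈ⱽ? y) x≉y) (if-no (x ≈ⱽ? y) x≉y)) ⟩
      N * ((w a * ‖ w ‖ ⁻¹) * (w b * ‖ w ‖ ⁻¹))
        ≈⟨ *-congʳ ‖w‖²≈N ⟨
      ‖ w ‖ * ‖ w ‖ * ((w a * ‖ w ‖ ⁻¹) * (w b * ‖ w ‖ ⁻¹))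
        ≈⟨ solve 4 (λ s i x y → s :* s :* ((x :* i) :* (y :* i)) := ((s :* i) :* (s :* i)) :* (x :* y)) refl ‖ w ‖ (‖ w ‖ ⁻¹) (w a) (w b) ⟩
      (‖ w ‖ * ‖ w ‖ ⁻¹) * (‖ w ‖ * ‖ w ‖ ⁻¹) * (w a * w b)
        ≈⟨ *-congʳ (trans (*-cong (⁻¹-inverseʳ ‖ w ‖ ‖w‖≉0) (⁻¹-inverseʳ ‖ w ‖ ‖w‖≉0)) (*-identityˡ 1#)) ⟩
      1# * (w a * w b)
        ≈⟨ *-identityˡ _ ⟩
      w a * w b ∎
      where
      w : Vector Carrier _
      w = x -ⱽ y
      N : Carrier
      N = w ⊡ w
      0≤sum : ∀ {k} (f : Fin k → Carrier) → 0# ≤ sum (λ i → f i * f i)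
      0≤sum {zero}  f = ≤-refl
      0≤sum {suc k} f = 0≤-+ (0≤x*x (f zero)) (0≤sum (f ∘ suc))
      ‖w‖²≈N : ‖ w ‖ * ‖ w ‖ ≈ N
      ‖w‖²≈N = proj₂ (√-def N (0≤sum w))
      ‖w‖≉0 : ‖ w ‖ ≉ 0#
      ‖w‖≉0 ‖w‖≈0 = N≉0 (trans (sym ‖w‖²≈N) (trans (*-congʳ ‖w‖≈0) (zeroˡ _)))
      x≉y : ¬ (∀ i → x i ≈ y i)
      x≉y x≈y = N≉0 (sum-zero (λ i → w i * w i) λ i →
        trans (*-congʳ (trans (+-congʳ (x≈y i)) (-‿inverseʳ (y i)))) (zeroˡ _))

    direction-planar : ∀ z w → ∣ z ∣² ≈ 1# → ∣ w ∣² ≈ 1# → ¬ z ℂ.≈ w → ∀ a b →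
      direction (planar z) (planar w) a * direction (planar z) (planar w) b ≈ edgeProjection z w a b
    direction-planar z w ∣z∣ ∣w∣ z≉w a b = *-cancelˡ N≉0 (begin
      N * (direction (planar z) (planar w) a * direction (planar z) (planar w) b)
        ≈⟨ direction-outer (planar z) (planar w) N≉0 a b ⟩
      (planar z -ⱽ planar w) a * (planar z -ⱽ planar w) b
        ≈⟨ *-cong (difference a) (difference b) ⟩
      planar (z ℂ.- w) a * planar (z ℂ.- w) b
        ≈⟨ chord-outer z w ∣z∣ ∣w∣ a b ⟩
      ∣ z ℂ.- w ∣² * edgeProjection z w a b
        ≈⟨ *-congʳ N≈ ⟨
      N * edgeProjection z w a b ∎)
      where
      N : Carrier
      N = (planar z -ⱽ planar w) ⊡ (planar z -ⱽ planar w)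
      difference : ∀ a → (planar z -ⱽ planar w) a ≈ planar (z ℂ.- w) a
      difference a = solve 6 (λ x y x′ y′ u v → (x :* u :+ y :* v) :- (x′ :* u :+ y′ :* v) := (x :- x′) :* u :+ (y :- y′) :* v)
        refl (proj₁ z) (proj₂ z) (proj₁ w) (proj₂ w) (u a) (v a)
      N≈ : N ≈ ∣ z ℂ.- w ∣²
      N≈ = trans (sum-cong-≋ λ a → *-cong (difference a) (difference a)) (planar-⊡ (z ℂ.- w) (z ℂ.- w))
      N≉0 : N ≉ 0#
      N≉0 N≈0 = z≉w (x-y≈0⇒x≈y (GaussianNumbers.gaussianRing commutativeRing) (∣∣²≈0⇒≈0 (z ℂ.- w) (trans (sym N≈) N≈0)))

  module Spread (n : ℕ) where
    joint : Fin (n ℕ.* d) → Fin n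
    joint r = proj₁ (remQuot {n} d r)

    coord : Fin (n ℕ.* d) → Fin d
    coord r = proj₂ (remQuot {n} d r)

    spread : (Fin n → ℂ) → Vector Carrier (n ℕ.* d)
    spread f r = planar (f (joint r)) (coord r)

    spread-⊡ : ∀ f g → spread f ⊡ spread g ≈ sum (λ k → ⟪ f k , g k ⟫)
    spread-⊡ f g = trans (sum-remQuot n d (λ (k , a) → planar (f k) a * planar (g k) a))
                         (sum-cong-≋ λ k → planar-⊡ (f k) (g k))

    -- The orthogonal projection of the whole space onto Hⁿ: the identity on Hⁿ, extended by zero to
    -- the orthogonal complement.
    planeIdentity : Matrix (n ℕ.* d) (n ℕ.* d)
    planeIdentity r s = basis (joint r) (joint s) * projection (coord r) (coord s)

    spread-planeIdentity : ∀ f s → sum (λ r → spread f r * planeIdentity r s) ≈ spread f s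
    spread-planeIdentity f s = begin
      sum (λ r → spread f r * planeIdentity r s)
        ≈⟨ sum-remQuot n d (λ (k , a) → planar (f k) a * (basis k l * projection a b)) ⟩
      sum (λ k → sum (λ a → planar (f k) a * (basis k l * projection a b)))
        ≈⟨ sum-cong-≋ (λ k → trans (sum-cong-≋ λ a → solve 3 (λ p e g → p :* (e :* g) := e :* (p :* g)) refl (planar (f k) a) (basis k l) (projection a b))
             (sym (*-distribˡ-sum (basis k l) (λ a → planar (f k) a * projection a b)))) ⟩
      sum (λ k → basis k l * sum (λ a → planar (f k) a * projection a b))
        ≈⟨ sum-basis l (λ k → sum (λ a → planar (f k) a * projection a b)) ⟩
      sum (λ a → planar (f l) a * projection a b)
        ≈⟨ sum-cong-≋ (λ a → solve 5 (λ p ua va ub vb → p :* (ua :* ub :+ va :* vb)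
             := ub :* (p :* (con (+ 1) :* ua :+ con (+ 0) :* va)) :+ vb :* (p :* (con (+ 0) :* ua :+ con (+ 1) :* va)))
             refl (planar (f l) a) (u a) (v a) (u b) (v b)) ⟩
      sum (λ a → u b * (planar (f l) a * planar (1# , 0#) a) + v b * (planar (f l) a * planar (0# , 1#) a))
        ≈⟨ trans (sum-linear (u b) (λ a → planar (f l) a * planar (1# , 0#) a) _) (+-congˡ (sym (*-distribˡ-sum (v b) (λ a → planar (f l) a * planar (0# , 1#) a)))) ⟩
      u b * (planar (f l) ⊡ planar (1# , 0#)) + v b * (planar (f l) ⊡ planar (0# , 1#))
        ≈⟨ +-cong (*-congˡ (planar-⊡ (f l) (1# , 0#))) (*-congˡ (planar-⊡ (f l) (0# , 1#))) ⟩
      u b * (proj₁ (f l) * 1# + proj₂ (f l) * 0#) + v b * (proj₁ (f l) * 0# + proj₂ (f l) * 1#)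
        ≈⟨ solve 4 (λ u v x y → u :* (x :* con (+ 1) :+ y :* con (+ 0)) :+ v :* (x :* con (+ 0) :+ y :* con (+ 1)) := x :* u :+ y :* v)
             refl (u b) (v b) (proj₁ (f l)) (proj₂ (f l)) ⟩
      spread f s ∎
      where
      l : Fin n
      l = joint s
      b : Fin d
      b = coord s

    -- After `spread`, these are the vectors u and v placed at vertex m. Together they form an
    -- orthonormal basis of Hⁿ, which splits `planeIdentity` into 2n rank-one matrices.
    unit₁ unit₂ : Fin n → Fin n → ℂ
    unit₁ m k = basis m k , 0#
    unit₂ m k = 0# , basis m k

    planeIdentity-rankOnes : ∀ x r s →
      x * planeIdentity r s ≈ sum (λ m → x * (spread (unit₁ m) r * spread (unit₁ m) s)) + sum (λ m → x * (spread (unit₂ m) r * spread (unit₂ m) s))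
    planeIdentity-rankOnes x r s = sym (begin
      sum (λ m → x * (spread (unit₁ m) r * spread (unit₁ m) s)) + sum (λ m → x * (spread (unit₂ m) r * spread (unit₂ m) s))
        ≈⟨ +-cong
          (trans (sum-cong-≋ λ m → solve 7 (λ x e f ua va ub vb → x :* ((e :* ua :+ con (+ 0) :* va) :* (f :* ub :+ con (+ 0) :* vb)) := e :* (f :* (x :* (ua :* ub))))
             refl x (basis m k) (basis m l) (u a) (v a) (u b) (v b)) (sum-basis k (λ m → basis m l * (x * (u a * u b)))))
          (trans (sum-cong-≋ λ m → solve 7 (λ x e f ua va ub vb → x :* ((con (+ 0) :* ua :+ e :* va) :* (con (+ 0) :* ub :+ f :* vb)) := e :* (f :* (x :* (va :* vb))))
             refl x (basis m k) (basis m l) (u a) (v a) (u b) (v b)) (sum-basis k (λ m → basis m l * (x * (v a * v b))))) ⟩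
      basis k l * (x * (u a * u b)) + basis k l * (x * (v a * v b))
        ≈⟨ solve 4 (λ e x p q → e :* (x :* p) :+ e :* (x :* q) := x :* (e :* (p :+ q))) refl (basis k l) x (u a * u b) (v a * v b) ⟩
      x * planeIdentity r s ∎)
      where
      k l : Fin n
      k = joint r
      l = joint s
      a b : Fin d
      a = coord r
      b = coord s

    spread-unit₁ : ∀ m g → spread (unit₁ m) ⊡ spread g ≈ proj₁ (g m)
    spread-unit₁ m g = trans (spread-⊡ (unit₁ m) g) (trans
      (sum-cong-≋ λ k → solve 3 (λ e x y → e :* x :+ con (+ 0) :* y := e :* x) refl (basis m k) (proj₁ (g k)) (proj₂ (g k)))
      (sum-basisʳ m (proj₁ ∘ g)))

    spread-unit₂ : ∀ m g → spread (unit₂ m) ⊡ spread g ≈ proj₂ (g m)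
    spread-unit₂ m g = trans (spread-⊡ (unit₂ m) g) (trans
      (sum-cong-≋ λ k → solve 3 (λ e x y → con (+ 0) :* x :+ e :* y := e :* y) refl (basis m k) (proj₁ (g k)) (proj₂ (g k)))
      (sum-basisʳ m (proj₂ ∘ g)))

    -- Each of the 2n basis vectors of Hⁿ turns one factor x of det (x I) into x + y. They are added
    -- in two batches, and the second remains a family of eigenvectors because it is orthogonal to
    -- the first.
    det-planeIdentity : ∀ x y → x ^ n * (x ^ n * det (λ r s → x * basis r s + y * planeIdentity r s)) ≈
      (x + y) ^ n * ((x + y) ^ n * x ^ (n ℕ.* d))
    det-planeIdentity x y = begin
      x ^ n * (x ^ n * det (λ r s → x * basis r s + y * planeIdentity r s))
        ≈⟨ *-congˡ (*-congˡ (det-cong {n ℕ.* d} λ r s → trans (+-congˡ (planeIdentity-rankOnes y r s)) (sym (+-assoc (x * basis r s) _ _)))) ⟩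
      x ^ n * (x ^ n * det (λ r s → M r s + sum (λ m → y * (spread (unit₂ m) r * spread (unit₂ m) s))))
        ≈⟨ *-congˡ (det-orthogonal n M x 1# (λ _ → y) (λ m → spread (unit₂ m))
             (λ m → IsLeftEigenvector-rankOnes (λ r s → x * basis r s) {x} {spread (unit₂ m)} (λ _ → y) (λ k → spread (unit₁ k))
                      (scalar-eigenvector x (spread (unit₂ m))) (λ k → spread-unit₂ m (unit₁ k)))
             (λ i j i≢j → trans (spread-unit₂ i (unit₂ j)) (basis-other (i≢j ∘ ≡.sym)))
             (λ i → trans (spread-unit₂ i (unit₂ i)) (basis-self i))) ⟩
      x ^ n * (product {n} (λ _ → x + y * 1#) * det M)
        ≈⟨ solve 3 (λ a b c → a :* (b :* c) := b :* (a :* c)) refl (x ^ n) (product {n} (λ _ → x + y * 1#)) (det M) ⟩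
      product {n} (λ _ → x + y * 1#) * (x ^ n * det M)
        ≈⟨ *-cong product≈ (det-orthogonal n (λ r s → x * basis r s) x 1# (λ _ → y) (λ m → spread (unit₁ m))
             (λ m → scalar-eigenvector x (spread (unit₁ m)))
             (λ i j i≢j → trans (spread-unit₁ i (unit₁ j)) (basis-other (i≢j ∘ ≡.sym)))
             (λ i → trans (spread-unit₁ i (unit₁ i)) (basis-self i))) ⟩
      (x + y) ^ n * (product {n} (λ _ → x + y * 1#) * det (λ r s → x * basis {n ℕ.* d} r s))
        ≈⟨ *-congˡ (*-cong product≈ (det-scalar (n ℕ.* d) x)) ⟩
      (x + y) ^ n * ((x + y) ^ n * x ^ (n ℕ.* d)) ∎
      where
      open import Algebra.Definitions.RawSemiring (Semiring.rawSemiring semiring) using (product)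
      open import Algebra.Properties.Monoid.Sum *-monoid using () renaming (sum-replicate to product-replicate)
      open import Algebra.Properties.Semiring.Exp semiring using (^-congˡ)
      M : Matrix (n ℕ.* d) (n ℕ.* d)
      M r s = x * basis r s + sum (λ m → y * (spread (unit₁ m) r * spread (unit₁ m) s))
      product≈ : product {n} (λ _ → x + y * 1#) ≈ (x + y) ^ n
      product≈ = trans (product-replicate n) (^-congˡ n (+-congˡ (*-identityʳ y)))

-- Products of linear factors as coefficient lists

module Polynomials {c ℓ} (R : CompleteOrderedField c ℓ) where
  open CompleteOrderedField R
  open LinearAlgebra R
  open RingSolver commutativeRing

  -- The argument c carries the coefficient of q of the next lower degree; started with 0, the
  -- result is (X - a) q.
  mulLinear : Carrier → Carrier → List Carrier → List Carrier
  mulLinear c a []      = c ∷ []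
  mulLinear c a (b ∷ q) = (c - a * b) ∷ mulLinear b a q

  eval-mulLinear : ∀ c a q x → eval (mulLinear c a q) x ≈ c + (x - a) * eval q x
  eval-mulLinear c a []      x = +-congˡ (trans (zeroʳ x) (sym (zeroʳ _)))
  eval-mulLinear c a (b ∷ q) x = trans (+-congˡ (*-congˡ (eval-mulLinear b a q x)))
    (solve 5 (λ c a b x e → (c :- a :* b) :+ x :* (b :+ (x :- a) :* e) := c :+ (x :- a) :* (b :+ x :* e)) refl c a b x (eval q x))

  mulPower : ℕ → Carrier → List Carrier → List Carrier
  mulPower zero    a q = q
  mulPower (suc n) a q = mulLinear 0# a (mulPower n a q)

  eval-mulPower : ∀ n a q x → eval (mulPower n a q) x ≈ (x - a) ^ n * eval q x
  eval-mulPower zero    a q x = sym (*-identityˡ _)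
  eval-mulPower (suc n) a q x = trans (eval-mulLinear 0# a (mulPower n a q) x)
    (trans (+-identityˡ _) (trans (*-congˡ (eval-mulPower n a q x)) (sym (*-assoc _ _ _))))

  rootPower : ℕ → Carrier → ℕ → Carrier → List Carrier
  rootPower m a n b = mulPower m a (mulPower n b (1# ∷ []))

  eval-rootPower : ∀ m a n b x → eval (rootPower m a n b) x ≈ (x - a) ^ m * (x - b) ^ n
  eval-rootPower m a n b x = trans (eval-mulPower m a _ x) (*-congˡ (trans (eval-mulPower n b _ x)
    (trans (*-congˡ (trans (+-congˡ (zeroʳ x)) (+-identityʳ 1#))) (*-identityʳ _))))

-- Eigenvalues of symmetric matrices

module SymmetricMatrix {c ℓ} (R : CompleteOrderedField c ℓ) where
  open CompleteOrderedField R
  open OrderedField R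
  open LinearAlgebra R
  open Determinant R
  open Sums R
  open RingSolver commutativeRing
  open import Algebra.Properties.Semiring.Sum semiring hiding (sum)
  open import Relation.Binary.Reasoning.Setoid setoid

  Symmetric : ∀ {n} → Matrix n n → Set ℓ
  Symmetric A = ∀ i j → A i j ≈ A j i

  left⇒eigenvalue : ∀ {n} {A : Matrix n n} {μ} q → Symmetric A → IsLeftEigenvector A μ q → (∃ λ i → q i ≉ 0#) → IsEigenvalue A μ
  left⇒eigenvalue q A-sym qA≈μq q≉0 = q , q≉0 , λ i →
    trans (sum-cong-≋ λ j → trans (*-comm _ _) (*-congˡ (A-sym i j))) (qA≈μq i)

  eigenvalue⇒left : ∀ {n} {A : Matrix n n} {μ} → Symmetric A → IsEigenvalue A μ →
    Σ (Vector Carrier n) λ q → (∃ λ i → q i ≉ 0#) × IsLeftEigenvector A μ q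
  eigenvalue⇒left A-sym (q , q≉0 , Aq≈μq) = q , q≉0 , λ i →
    trans (sum-cong-≋ λ j → trans (*-comm _ _) (*-congʳ (A-sym j i))) (Aq≈μq i)

  -- By symmetry an eigenvector q is also a left eigenvector, so it annihilates μ I - A from the
  -- left. Then `eigenvector-[]≔` for the eigenvalue 0 gives q i · det = 0, and some q i is nonzero.
  charPoly-root : ∀ {n} {A : Matrix n n} {μ} → Symmetric A → IsEigenvalue A μ → charPoly A μ ≈ 0#
  charPoly-root {n} {A} {μ} A-sym eigenvalue = root (eigenvalue⇒left {A = A} {μ} A-sym eigenvalue)
    where
    root : (Σ (Vector Carrier n) λ q → (∃ λ i → q i ≉ 0#) × IsLeftEigenvector A μ q) → charPoly A μ ≈ 0#
    root (q , (i , qᵢ≉0) , qA≈μq) = x*y≈0⇒y≈0 qᵢ≉0 (trans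
      (sym (eigenvector-[]≔ (λ r s → μ * basis r s - A r s) 0# q kernel i)) (zeroˡ _))
      where
      kernel : IsLeftEigenvector (λ r s → μ * basis r s - A r s) 0# q
      kernel s = begin
        sum (λ r → q r * (μ * basis r s - A r s))
          ≈⟨ sum-cong-≋ (λ r → solve 4 (λ q m b a → q :* (m :* b :- a) := (:- con (+ 1)) :* (q :* a) :+ q :* (m :* b)) refl (q r) μ (basis r s) (A r s)) ⟩
        sum (λ r → - 1# * (q r * A r s) + q r * (μ * basis r s))
          ≈⟨ sum-linear (- 1#) (λ r → q r * A r s) (λ r → q r * (μ * basis r s)) ⟩
        - 1# * sum (λ r → q r * A r s) + sum (λ r → q r * (μ * basis r s))
          ≈⟨ +-cong (*-congˡ (qA≈μq s)) (scalar-eigenvector μ q s) ⟩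
        - 1# * (μ * q s) + μ * q s
          ≈⟨ solve 2 (λ m q → (:- con (+ 1)) :* (m :* q) :+ m :* q := con (+ 0) :* q) refl μ (q s) ⟩
        0# * q s ∎

  eigenvalue-resp : ∀ {n} {A : Matrix n n} {μ ν} → μ ≈ ν → IsEigenvalue A ν → IsEigenvalue A μ
  eigenvalue-resp μ≈ν (q , q≉0 , Aq≈νq) = q , q≉0 , λ i → trans (Aq≈νq i) (*-congʳ (sym μ≈ν))

  ⊡≉0⇒≉0 : ∀ {n} (q : Vector Carrier n) → q ⊡ q ≉ 0# → ∃ λ i → q i ≉ 0#
  ⊡≉0⇒≉0 {n} q qq≉0 = Fin.¬∀⟶∃¬ n (λ i → q i ≈ 0#) (λ i → q i ≟ 0#) λ q≈0 →
    qq≉0 (sum-zero (λ i → q i * q i) λ i → trans (*-congʳ (q≈0 i)) (zeroˡ _))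

-- Spectral decomposition of the stiffness matrix

module RegularPolygon {c ℓ} {R : CompleteOrderedField c ℓ} (F : ElementaryFunctions R) (m d : ℕ)
  (u v : Vector (CompleteOrderedField.Carrier R) d)
  (H : LinearAlgebra.Subspace R d) (onb : LinearAlgebra.IsOrthonormalBasis R H u v) where
  open CompleteOrderedField R
  open ElementaryFunctions F
  open OrderedField R
  open ComplexNumbers R
  open LinearAlgebra R
  open Rigidity F
  open Trigonometry F
  open RootsOfUnity m
  open Determinant R
  open Sums R
  open Planar R d u v H onb
  open Spread n
  open SymmetricMatrix R
  open RingSolver commutativeRing
  open import Algebra.Properties.Semiring.Sum semiring hiding (sum)
  open import Algebra.Properties.Semiring.Mult semiring using (×-assoc-*; ×-congʳ)
  open import Algebra.Properties.Semiring.Exp semiring using (^-congˡ; ^-homo-*)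
  open import Relation.Binary.Reasoning.Setoid setoid

  L : Matrix (n ℕ.* d) (n ℕ.* d)
  L = stiffnessMatrix (regularPolygon n u v)

  L-symmetric : Symmetric L
  L-symmetric r s = sum-cong-≋ λ e →
    *-comm (rigidityMatrix (regularPolygon n u v) r e) (rigidityMatrix (regularPolygon n u v) s e)

  N ν : Carrier
  N = fromℕ n
  ν = N * ½

  ν+ν≈N : ν + ν ≈ N
  ν+ν≈N = trans (sym (distribˡ N ½ ½)) (trans (*-congˡ ½+½≈1) (*-identityʳ N))

  N≉0 : N ≉ 0#
  N≉0 = <⇒≉ (0<fromℕ m)

  sum-const : ∀ x → sum {n} (λ _ → x) ≈ N * x
  sum-const x = trans (sum-replicate n) (trans (×-congʳ n (sym (*-identityˡ x))) (sym (×-assoc-* n 1# x)))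

  sum-power : ∀ j → 0 ℕ.< j → j ℕ.< n →
    (sum (λ k → proj₁ (vertex k ℂ.^ j)) , sum (λ k → proj₂ (vertex k ℂ.^ j))) ℂ.≈ ℂ.0#
  sum-power j 0<j j<n = ℂ.trans (ℂ.sym (ℂ-sum (λ k → vertex k ℂ.^ j))) (sum-vertex j 0<j j<n)

  -- The radial and the tangential motion of the vertices, and the two translations of H.
  modes : Fin 4 → Fin n → ℂ
  modes zero                   k = vertex k
  modes (suc zero)             k = 𝕚* (vertex k)
  modes (suc (suc zero))       k = 1# , 0#
  modes (suc (suc (suc zero))) k = 0# , 1#

  mode : Fin 4 → Vector Carrier (n ℕ.* d)
  mode i = spread (modes i)

  weight : Fin 4 → Carrier
  weight zero    = ½
  weight (suc _) = - ½

  module Entries (1<n : 1 ℕ.< n) where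

    sum-vertex≈0 : ℂ.sum vertex ℂ.≈ ℂ.0#
    sum-vertex≈0 = ℂ.trans (ℂ.sum-cong-≋ {n} λ k → ℂ.sym (ℂ.*-identityʳ (vertex k))) (sum-vertex 1 (ℕ.s≤s ℕ.z≤n) 1<n)

    sum-cos≈0 : sum (λ k → proj₁ (vertex k)) ≈ 0#
    sum-cos≈0 = proj₁ (ℂ.trans (ℂ.sym (ℂ-sum vertex)) sum-vertex≈0)

    sum-sin≈0 : sum (λ k → proj₂ (vertex k)) ≈ 0#
    sum-sin≈0 = proj₂ (ℂ.trans (ℂ.sym (ℂ-sum vertex)) sum-vertex≈0)

    D : Fin d → Fin d → Fin n → Fin n → Carrier
    D a b i j = edgeProjection (vertex i) (vertex j) a b

    D-sym : ∀ a b i j → D a b i j ≈ D a b j i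
    D-sym a b i j = *-congˡ (+-congˡ (-‿cong (reflection-cong (ℂ.*-comm (vertex i) (vertex j)) a b)))

    sum-D : ∀ a b k → sum (D a b k) ≈ ν * projection a b
    sum-D a b k = begin
      sum (D a b k)
        ≈⟨ sum-cong-≋ (λ j → solve 3 (λ h g r → h :* (g :- r) := (:- h) :* r :+ h :* g) refl ½ (projection a b) (ρ′ j)) ⟩
      sum (λ j → - ½ * ρ′ j + ½ * projection a b)
        ≈⟨ sum-linear (- ½) ρ′ (λ _ → ½ * projection a b) ⟩
      - ½ * sum ρ′ + sum {n} (λ _ → ½ * projection a b)
        ≈⟨ +-cong (*-congˡ sum-reflection) (sum-const (½ * projection a b)) ⟩
      - ½ * 0# + N * (½ * projection a b)
        ≈⟨ solve 3 (λ h n g → (:- h) :* con (+ 0) :+ n :* (h :* g) := (n :* h) :* g) refl ½ N (projection a b) ⟩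
      ν * projection a b ∎
      where
      ρ′ : Fin n → Carrier
      ρ′ j = reflection (vertex k ℂ.* vertex j) a b
      sum-reflection : sum ρ′ ≈ 0#
      sum-reflection = trans (reflection-sum (λ j → vertex k ℂ.* vertex j) a b) (trans
        (reflection-cong (ℂ.trans (ℂ.sym (ℂ.*-distribˡ-sum {n} (vertex k) vertex))
          (ℂ.trans (ℂ.*-congˡ {vertex k} sum-vertex≈0) (ℂ.zeroʳ (vertex k)))) a b)
        (solve 2 (λ p q → con (+ 0) :* p :+ con (+ 0) :* q := con (+ 0)) refl _ _))

    -- For fixed coordinates a and b, the entries of L form a scalar graph Laplacian with weights
    -- `D a b`. The equality is proved after doubling, where the sum over edges becomes a sum over
    -- ordered pairs.
    L-laplacian : ∀ r s → L r s ≈ basis (joint r) (joint s) * sum (D (coord r) (coord s) (joint r)) - D (coord r) (coord s) (joint r) (joint s)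
    L-laplacian r s = half-≈ (trans (+-cong L≈S L≈S) (trans (sum-below g g-sym g-diag) (sum-graphLaplacian (D a b) (D-sym a b) k l)))
      where
      k l : Fin n
      k = joint r
      l = joint s
      a b : Fin d
      a = coord r
      b = coord s
      dir : Fin n → Fin n → Vector Carrier d
      dir i j = direction (regularPolygon n u v i) (regularPolygon n u v j)
      f : Fin n × Fin n → Carrier
      f (i , j) = ((basis i -ⱽ basis j) ⊗ dir i j) r * ((basis i -ⱽ basis j) ⊗ dir i j) s
      g : Fin n → Fin n → Carrier
      g i j = (basis i k - basis j k) * (basis i l - basis j l) * D a b i j
      f≈g : ∀ i j → i ≢ j → f (i , j) ≈ g i j
      f≈g i j i≢j = trans
        (solve 4 (λ x p y q → (x :* p) :* (y :* q) := x :* y :* (p :* q)) refl (basis i k - basis j k) (dir i j a) (basis i l - basis j l) (dir i j b))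
        (*-congˡ (direction-planar F (vertex i) (vertex j) (∣cis∣²≈1 _) (∣cis∣²≈1 _) (vertex-distinct i≢j) a b))
      g-sym : ∀ i j → g i j ≈ g j i
      g-sym i j = trans (*-congˡ (D-sym a b i j))
        (solve 5 (λ x y p q d → (x :- y) :* (p :- q) :* d := (y :- x) :* (q :- p) :* d) refl (basis i k) (basis j k) (basis i l) (basis j l) (D a b j i))
      g-diag : ∀ i → g i i ≈ 0#
      g-diag i = solve 3 (λ x y d → (x :- x) :* (y :- y) :* d := con (+ 0)) refl (basis i k) (basis i l) (D a b i i)
      L≈S : L r s ≈ sum (λ i → sum (below g i))
      L≈S = trans (sum-edges n f) (sum-cong-≋ λ i → sum-cong-≋ (below-cong (λ i j → f (i , j)) g f≈g i))

    L-spectral : ∀ r s → L r s ≈ ν * planeIdentity r s + sum (λ i → weight i * (mode i r * mode i s))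
    L-spectral r s = begin
      L r s
        ≈⟨ L-laplacian r s ⟩
      e * sum (D a b k) - ½ * (projection a b - reflection (vertex k ℂ.* vertex l) a b)
        ≈⟨ +-cong (*-congˡ (sum-D a b k)) (-‿cong (*-congˡ (+-congˡ (-‿cong (reflection-* (vertex k) (vertex l) a b))))) ⟩
      e * (ν * projection a b) - ½ * (projection a b - (p * p′ - q * q′))
        -- The term - ½ `projection a b` occurs for all pairs of vertices, also distinct ones; it is
        -- the contribution of the two translations. The final `O` is the empty tail of the sum over
        -- `Fin 4`.
        ≈⟨ solve 11 (λ e n h p p′ q q′ ua va ub vb →
             let G = ua :* ub :+ va :* vb ; -h = :- h ; I = con (+ 1) ; O = con (+ 0) in
             e :* (n :* G) :- h :* (G :- (p :* p′ :- q :* q′))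
             := n :* (e :* G) :+ (h :* (p :* p′) :+ (-h :* (q :* q′) :+ (-h :* ((I :* ua :+ O :* va) :* (I :* ub :+ O :* vb))
                :+ (-h :* ((O :* ua :+ I :* va) :* (O :* ub :+ I :* vb)) :+ O)))))
             refl e ν ½ p p′ q q′ (u a) (v a) (u b) (v b) ⟩
      ν * planeIdentity r s + sum (λ i → weight i * (mode i r * mode i s)) ∎
      where
      k l : Fin n
      k = joint r
      l = joint s
      a b : Fin d
      a = coord r
      b = coord s
      e p p′ q q′ : Carrier
      e  = basis k l
      p  = planar (vertex k) a
      p′ = planar (vertex l) b
      q  = planar (𝕚* (vertex k)) a
      q′ = planar (𝕚* (vertex l)) b

    spread-⊡-sym : ∀ f g → spread f ⊡ spread g ≈ spread g ⊡ spread f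
    spread-⊡-sym f g = sum-cong-≋ λ r → *-comm (spread f r) (spread g r)

    spread-⊡-sum : ∀ f g (h : Fin n → Carrier) {x} → (∀ k → ⟪ f k , g k ⟫ ≈ h k) → sum h ≈ x → spread f ⊡ spread g ≈ x
    spread-⊡-sum f g h fg≈h h≈x = trans (spread-⊡ f g) (trans (sum-cong-≋ fg≈h) h≈x)

    sum-one : sum {n} (λ _ → 1#) ≈ N
    sum-one = trans (sum-const 1#) (*-identityʳ N)

    mode-norm : ∀ i → mode i ⊡ mode i ≈ N
    mode-norm i = spread-⊡-sum (modes i) (modes i) (λ _ → 1#) (unit i) sum-one
      where
      unit : ∀ i k → ⟪ modes i k , modes i k ⟫ ≈ 1#
      unit zero                   k = ∣cis∣²≈1 _
      unit (suc zero)             k = trans (solve 2 (λ x y → (:- y) :* (:- y) :+ x :* x := x :* x :+ y :* y) refl _ _) (∣cis∣²≈1 _)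
      unit (suc (suc zero))       k = solve 0 (con (+ 1) :* con (+ 1) :+ con (+ 0) :* con (+ 0) := con (+ 1)) refl
      unit (suc (suc (suc zero))) k = solve 0 (con (+ 0) :* con (+ 0) :+ con (+ 1) :* con (+ 1) := con (+ 1)) refl

    mode-orthogonal-< : ∀ i j → i Fin.< j → mode i ⊡ mode j ≈ 0#
    mode-orthogonal-< zero (suc zero) _ = spread-⊡-sum (modes zero) (modes (suc zero)) (λ _ → 0#)
      (λ k → solve 2 (λ x y → x :* (:- y) :+ y :* x := con (+ 0)) refl (cos (θ (toℕ k))) (sin (θ (toℕ k)))) (sum-zero {n} (λ _ → 0#) (λ _ → refl))
    mode-orthogonal-< zero (suc (suc zero)) _ = spread-⊡-sum (modes zero) (modes (suc (suc zero))) (proj₁ ∘ vertex)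
      (λ k → solve 2 (λ x y → x :* con (+ 1) :+ y :* con (+ 0) := x) refl (cos (θ (toℕ k))) (sin (θ (toℕ k)))) sum-cos≈0
    mode-orthogonal-< zero (suc (suc (suc zero))) _ = spread-⊡-sum (modes zero) (modes (suc (suc (suc zero)))) (proj₂ ∘ vertex)
      (λ k → solve 2 (λ x y → x :* con (+ 0) :+ y :* con (+ 1) := y) refl (cos (θ (toℕ k))) (sin (θ (toℕ k)))) sum-sin≈0
    mode-orthogonal-< (suc zero) (suc (suc zero)) _ = spread-⊡-sum (modes (suc zero)) (modes (suc (suc zero))) (λ k → - 1# * sin (θ (toℕ k)))
      (λ k → solve 2 (λ x y → (:- y) :* con (+ 1) :+ x :* con (+ 0) := (:- con (+ 1)) :* y) refl (cos (θ (toℕ k))) (sin (θ (toℕ k))))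
      (trans (sym (*-distribˡ-sum (- 1#) (proj₂ ∘ vertex))) (trans (*-congˡ sum-sin≈0) (zeroʳ _)))
    mode-orthogonal-< (suc zero) (suc (suc (suc zero))) _ = spread-⊡-sum (modes (suc zero)) (modes (suc (suc (suc zero)))) (proj₁ ∘ vertex)
      (λ k → solve 2 (λ x y → (:- y) :* con (+ 0) :+ x :* con (+ 1) := x) refl (cos (θ (toℕ k))) (sin (θ (toℕ k)))) sum-cos≈0
    mode-orthogonal-< (suc (suc zero)) (suc (suc (suc zero))) _ = spread-⊡-sum (modes (suc (suc zero))) (modes (suc (suc (suc zero)))) (λ _ → 0#)
      (λ k → solve 0 (con (+ 1) :* con (+ 0) :+ con (+ 0) :* con (+ 1) := con (+ 0)) refl) (sum-zero {n} (λ _ → 0#) (λ _ → refl))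
    mode-orthogonal-< (suc zero) (suc zero) (ℕ.s≤s ())
    mode-orthogonal-< (suc (suc zero)) (suc zero) (ℕ.s≤s ())
    mode-orthogonal-< (suc (suc zero)) (suc (suc zero)) (ℕ.s≤s (ℕ.s≤s ()))
    mode-orthogonal-< (suc (suc (suc zero))) (suc zero) (ℕ.s≤s ())
    mode-orthogonal-< (suc (suc (suc zero))) (suc (suc zero)) (ℕ.s≤s (ℕ.s≤s ()))
    mode-orthogonal-< (suc (suc (suc zero))) (suc (suc (suc zero))) (ℕ.s≤s (ℕ.s≤s (ℕ.s≤s ())))

    mode-orthogonal : ∀ i j → i ≢ j → mode i ⊡ mode j ≈ 0#
    mode-orthogonal i j i≢j with Fin.<-cmp i j
    ... | tri< i<j _ _ = mode-orthogonal-< i j i<j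
    ... | tri≈ _ i≡j _ = contradiction i≡j i≢j
    ... | tri> _ _ j<i = trans (spread-⊡-sym (modes i) (modes j)) (mode-orthogonal-< j i j<i)

    planeIdentity-eigenvector : ∀ x f → IsLeftEigenvector (λ r s → x * planeIdentity r s) x (spread f)
    planeIdentity-eigenvector x f s = trans
      (sum-cong-≋ λ r → solve 3 (λ q x p → q :* (x :* p) := x :* (q :* p)) refl (spread f r) x (planeIdentity r s))
      (trans (sym (*-distribˡ-sum x (λ r → spread f r * planeIdentity r s))) (*-congˡ (spread-planeIdentity f s)))

    L-left : ∀ f s → sum (λ r → spread f r * L r s) ≈ ν * spread f s + sum (λ i → weight i * (spread f ⊡ mode i) * mode i s)
    L-left f s = trans (sum-cong-≋ λ r → *-congˡ (L-spectral r s))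
      (left-rankOnes (λ r s → ν * planeIdentity r s) {ν} {spread f} weight mode (planeIdentity-eigenvector ν f) s)

    mode-eigenvector : ∀ j → IsLeftEigenvector L (ν + weight j * N) (mode j)
    mode-eigenvector j s = begin
      sum (λ r → mode j r * L r s)
        ≈⟨ L-left (modes j) s ⟩
      ν * mode j s + sum (λ i → weight i * (mode j ⊡ mode i) * mode i s)
        ≈⟨ +-congˡ (sum-only (λ i → weight i * (mode j ⊡ mode i) * mode i s) j λ i i≢j →
             trans (*-congʳ (trans (*-congˡ (mode-orthogonal j i (i≢j ∘ ≡.sym))) (zeroʳ _))) (zeroˡ _)) ⟩
      ν * mode j s + weight j * (mode j ⊡ mode j) * mode j s
        ≈⟨ +-congˡ (*-congʳ (*-congˡ (mode-norm j))) ⟩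
      ν * mode j s + weight j * N * mode j s
        ≈⟨ distribʳ (mode j s) ν (weight j * N) ⟨
      (ν + weight j * N) * mode j s ∎

    mode-eigenvalue : ∀ j → IsEigenvalue L (ν + weight j * N)
    mode-eigenvalue j = left⇒eigenvalue {A = L} {ν + weight j * N} (mode j) L-symmetric (mode-eigenvector j)
      (⊡≉0⇒≉0 (mode j) λ eq → N≉0 (trans (sym (mode-norm j)) eq))

    N-eigenvalue : IsEigenvalue L N
    N-eigenvalue = eigenvalue-resp {A = L} (trans (sym ν+ν≈N) (+-congˡ (*-comm N ½))) (mode-eigenvalue zero)

    0-eigenvalue : IsEigenvalue L 0#
    0-eigenvalue = eigenvalue-resp {A = L} (solve 2 (λ n h → con (+ 0) := n :* h :+ (:- h) :* n) refl N ½) (mode-eigenvalue (suc zero))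

    -- The squares of the vertices are orthogonal to the four modes because Σ z = Σ z² = 0; the latter needs n ≥ 3.
    ν-eigenvalue : 2 ℕ.< n → IsEigenvalue L ν
    ν-eigenvalue 2<n = left⇒eigenvalue {A = L} {ν} (spread squares) L-symmetric eigenvector
      (⊡≉0⇒≉0 (spread squares) λ eq → N≉0 (trans (sym norm) eq))
      where
      squares : Fin n → ℂ
      squares k = vertex k ℂ.* vertex k
      sum-squares : ∀ (p : ℂ → Carrier) → (∀ {z w} → z ℂ.≈ w → p z ≈ p w) → sum (λ k → p (vertex k ℂ.^ 2)) ≈ 0# → sum (λ k → p (squares k)) ≈ 0#
      sum-squares p p-cong eq = trans (sum-cong-≋ λ k → p-cong (ℂ.*-congˡ {vertex k} (ℂ.sym (ℂ.*-identityʳ (vertex k))))) eq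
      norm : spread squares ⊡ spread squares ≈ N
      norm = spread-⊡-sum squares squares (λ _ → 1#) (λ k → trans
        (solve 2 (λ x y → (x :* x :- y :* y) :* (x :* x :- y :* y) :+ (x :* y :+ y :* x) :* (x :* y :+ y :* x)
          := (x :* x :+ y :* y) :* (x :* x :+ y :* y)) refl (cos (θ (toℕ k))) (sin (θ (toℕ k))))
        (trans (*-cong (∣cis∣²≈1 _) (∣cis∣²≈1 _)) (*-identityˡ 1#))) sum-one
      orthogonal : ∀ i → spread squares ⊡ mode i ≈ 0#
      orthogonal zero = spread-⊡-sum squares (modes zero) (proj₁ ∘ vertex) (λ k → trans
        (solve 2 (λ x y → (x :* x :- y :* y) :* x :+ (x :* y :+ y :* x) :* y := (x :* x :+ y :* y) :* x) refl (cos (θ (toℕ k))) (sin (θ (toℕ k))))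
        (trans (*-congʳ (∣cis∣²≈1 _)) (*-identityˡ _))) sum-cos≈0
      orthogonal (suc zero) = spread-⊡-sum squares (modes (suc zero)) (proj₂ ∘ vertex) (λ k → trans
        (solve 2 (λ x y → (x :* x :- y :* y) :* (:- y) :+ (x :* y :+ y :* x) :* x := (x :* x :+ y :* y) :* y) refl (cos (θ (toℕ k))) (sin (θ (toℕ k))))
        (trans (*-congʳ (∣cis∣²≈1 _)) (*-identityˡ _))) sum-sin≈0
      orthogonal (suc (suc zero)) = spread-⊡-sum squares (modes (suc (suc zero))) (proj₁ ∘ squares)
        (λ k → solve 2 (λ x y → x :* con (+ 1) :+ y :* con (+ 0) := x) refl (proj₁ (squares k)) (proj₂ (squares k)))
        (sum-squares proj₁ proj₁ (proj₁ (sum-power 2 (ℕ.s≤s ℕ.z≤n) 2<n)))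
      orthogonal (suc (suc (suc zero))) = spread-⊡-sum squares (modes (suc (suc (suc zero)))) (proj₂ ∘ squares)
        (λ k → solve 2 (λ x y → x :* con (+ 0) :+ y :* con (+ 1) := y) refl (proj₁ (squares k)) (proj₂ (squares k)))
        (sum-squares proj₂ proj₂ (proj₂ (sum-power 2 (ℕ.s≤s ℕ.z≤n) 2<n)))
      eigenvector : IsLeftEigenvector L ν (spread squares)
      eigenvector s = trans (L-left squares s) (trans (+-congˡ (sum-zero (λ i → weight i * (spread squares ⊡ mode i) * mode i s) λ i →
        trans (*-congʳ (trans (*-congˡ (orthogonal i)) (zeroʳ _))) (zeroˡ _))) (+-identityʳ _))

    -- The characteristic polynomial

    module CharPoly (x : Carrier) where
      C μ : Carrier
      C = charPoly L x
      μ = x - ν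

      M : Matrix (n ℕ.* d) (n ℕ.* d)
      M r s = x * basis r s + - ν * planeIdentity r s

      C≈det : C ≈ det (λ r s → M r s + sum (λ i → - weight i * (mode i r * mode i s)))
      C≈det = det-cong {n ℕ.* d} λ r s → trans (+-congˡ (-‿cong (L-spectral r s)))
        (solve 8 (λ xb n p h a b c e → let -h = :- h ; O = con (+ 0) in
           xb :- (n :* p :+ (h :* a :+ (-h :* b :+ (-h :* c :+ (-h :* e :+ O)))))
           := (xb :+ (:- n) :* p) :+ (-h :* a :+ ((:- -h) :* b :+ ((:- -h) :* c :+ ((:- -h) :* e :+ O)))))
           refl (x * basis r s) ν (planeIdentity r s) ½ (mode zero r * mode zero s) (mode (suc zero) r * mode (suc zero) s)
           (mode (suc (suc zero)) r * mode (suc (suc zero)) s) (mode (suc (suc (suc zero))) r * mode (suc (suc (suc zero))) s))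

      M-eigenvector : ∀ f → IsLeftEigenvector M μ (spread f)
      M-eigenvector f s = begin
        sum (λ r → spread f r * (x * basis r s + - ν * planeIdentity r s))
          ≈⟨ trans (sum-cong-≋ λ r → distribˡ (spread f r) (x * basis r s) (- ν * planeIdentity r s))
               (∑-distrib-+ (λ r → spread f r * (x * basis r s)) (λ r → spread f r * (- ν * planeIdentity r s))) ⟩
        sum (λ r → spread f r * (x * basis r s)) + sum (λ r → spread f r * (- ν * planeIdentity r s))
          ≈⟨ +-cong (scalar-eigenvector x (spread f) s) (planeIdentity-eigenvector (- ν) f s) ⟩
        x * spread f s + - ν * spread f s
          ≈⟨ distribʳ (spread f s) x (- ν) ⟨
        μ * spread f s ∎

      -- The radial mode turns a factor μ = x - n/2 into x - n; each of the other three, having the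
      -- opposite weight, turns it into x.
      μ^4*C : μ ^ 4 * C ≈ (x - N) * x ^ 3 * det M
      μ^4*C = begin
        μ ^ 4 * C
          ≈⟨ *-congˡ C≈det ⟩
        μ ^ 4 * det (λ r s → M r s + sum (λ i → - weight i * (mode i r * mode i s)))
          ≈⟨ det-orthogonal 4 M μ N (λ i → - weight i) mode (λ i → M-eigenvector (modes i)) mode-orthogonal mode-norm ⟩
        (μ + - ½ * N) * ((μ + - (- ½) * N) * ((μ + - (- ½) * N) * ((μ + - (- ½) * N) * 1#))) * det M
          ≈⟨ *-congʳ (*-cong μ-N/2 (*-cong μ+N/2 (*-cong μ+N/2 (*-cong μ+N/2 refl)))) ⟩
        (x - N) * x ^ 3 * det M ∎
        where
        μ-N/2 : μ + - ½ * N ≈ x - N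
        μ-N/2 = trans (solve 3 (λ x n h → (x :- n :* h) :+ (:- h) :* n := x :- (n :* h :+ n :* h)) refl x N ½) (+-congˡ (-‿cong ν+ν≈N))
        μ+N/2 : μ + - (- ½) * N ≈ x
        μ+N/2 = solve 3 (λ x n h → (x :- n :* h) :+ (:- (:- h)) :* n := x) refl x N ½

      charPoly-identity : x ^ n * (x ^ n * (μ ^ 4 * C)) ≈ (x - N) * x ^ 3 * (μ ^ n * (μ ^ n * x ^ (n ℕ.* d)))
      charPoly-identity = begin
        x ^ n * (x ^ n * (μ ^ 4 * C))
          ≈⟨ *-congˡ (*-congˡ μ^4*C) ⟩
        x ^ n * (x ^ n * ((x - N) * x ^ 3 * det M))
          ≈⟨ solve 3 (λ a b c → a :* (a :* (b :* c)) := b :* (a :* (a :* c))) refl (x ^ n) ((x - N) * x ^ 3) (det M) ⟩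
        (x - N) * x ^ 3 * (x ^ n * (x ^ n * det M))
          ≈⟨ *-congˡ (det-planeIdentity x (- ν)) ⟩
        (x - N) * x ^ 3 * (μ ^ n * (μ ^ n * x ^ (n ℕ.* d))) ∎

      -- The identity above determines C only where x and μ are invertible; at the two remaining points both sides vanish.
      charPoly-formula : 2 ℕ.< n → ∀ e f → n ℕ.+ n ≡ 4 ℕ.+ suc e → 3 ℕ.+ n ℕ.* d ≡ n ℕ.+ (n ℕ.+ suc f) →
        C ≈ (x - N) * (μ ^ suc e * x ^ suc f)
      charPoly-formula 2<n e f n+n≡ n*d≡ with x ≟ 0# | μ ≟ 0#
      ... | yes x≈0 | _ = trans (charPoly-root {A = L} {x} L-symmetric (eigenvalue-resp {A = L} x≈0 0-eigenvalue))
        (sym (trans (*-congˡ (*-congˡ (*-congʳ x≈0))) (solve 3 (λ a b c → a :* (b :* (con (+ 0) :* c)) := con (+ 0)) refl (x - N) (μ ^ suc e) (x ^ f))))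
      ... | no  _   | yes μ≈0 = trans (charPoly-root {A = L} {x} L-symmetric (eigenvalue-resp {A = L} x≈ν (ν-eigenvalue 2<n)))
        (sym (trans (*-congˡ (*-congʳ (*-congʳ μ≈0))) (solve 3 (λ a b c → a :* ((con (+ 0) :* b) :* c) := con (+ 0)) refl (x - N) (μ ^ e) (x ^ suc f))))
        where
        x≈ν : x ≈ ν
        x≈ν = RingIdentities.x-y≈0⇒x≈y commutativeRing μ≈0
      ... | no x≉0 | no μ≉0 = *-cancelˡ (^-≉0 4 μ≉0) (*-cancelˡ (^-≉0 n x≉0) (*-cancelˡ (^-≉0 n x≉0) (begin
        x ^ n * (x ^ n * (μ ^ 4 * C))
          ≈⟨ charPoly-identity ⟩
        (x - N) * x ^ 3 * (μ ^ n * (μ ^ n * x ^ (n ℕ.* d)))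
          ≈⟨ solve 4 (λ a b m k → a :* b :* (m :* (m :* k)) := a :* ((m :* m) :* (b :* k))) refl (x - N) (x ^ 3) (μ ^ n) (x ^ (n ℕ.* d)) ⟩
        (x - N) * ((μ ^ n * μ ^ n) * (x ^ 3 * x ^ (n ℕ.* d)))
          ≈⟨ *-congˡ (*-cong (trans (sym (^-homo-* μ n n)) (trans (reflexive (≡.cong (μ ^_) n+n≡)) (^-homo-* μ 4 (suc e))))
               (trans (sym (^-homo-* x 3 (n ℕ.* d))) (trans (reflexive (≡.cong (x ^_) n*d≡))
                 (trans (^-homo-* x n (n ℕ.+ suc f)) (*-congˡ (^-homo-* x n (suc f))))))) ⟩
        (x - N) * ((μ ^ 4 * μ ^ suc e) * (x ^ n * (x ^ n * x ^ suc f)))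
          ≈⟨ solve 5 (λ a m p y q → a :* ((m :* p) :* (y :* (y :* q))) := y :* (y :* (m :* (a :* (p :* q))))) refl (x - N) (μ ^ 4) (μ ^ suc e) (x ^ n) (x ^ suc f) ⟩
        x ^ n * (x ^ n * (μ ^ 4 * ((x - N) * (μ ^ suc e * x ^ suc f)))) ∎)))

  -- Eigenvalues and their multiplicities

  module Spectrum (2<n : 2 ℕ.< n) (e f : ℕ)
    -- These equations say `suc e` = 2n - 4 and `suc f` = n(d - 2) + 3 without truncated
    -- subtraction. The successors make the powers vanish at their roots.
    (n+n≡ : n ℕ.+ n ≡ 4 ℕ.+ suc e) (n*d≡ : 3 ℕ.+ n ℕ.* d ≡ n ℕ.+ (n ℕ.+ suc f)) where
    open Entries (ℕ.<-trans (ℕ.s≤s (ℕ.s≤s ℕ.z≤n)) 2<n)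
    open Polynomials R

    formula : ∀ x → charPoly L x ≈ (x - N) * ((x - ν) ^ suc e * x ^ suc f)
    formula x = CharPoly.charPoly-formula x 2<n e f n+n≡ n*d≡

    x-0≈x : ∀ x → x - 0# ≈ x
    x-0≈x x = solve 1 (λ x → x :- con (+ 0) := x) refl x

    ν≉0 : ν ≉ 0#
    ν≉0 = *-≉0 N≉0 (<⇒≉ 0<½)

    N≉ν : N ≉ ν
    N≉ν N≈ν = ν≉0 (trans (solve 1 (λ v → v := (v :+ v) :- v) refl ν) (trans (+-congʳ (trans ν+ν≈N N≈ν)) (-‿inverseʳ ν)))

    ≉⇒-≉0 : ∀ {x y} → x ≉ y → x - y ≉ 0#
    ≉⇒-≉0 x≉y eq = x≉y (RingIdentities.x-y≈0⇒x≈y commutativeRing eq)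

    ≉⇒≉0 : ∀ k l {x y z} → x ≉ y → x ≉ z → (x - y) ^ k * (x - z) ^ l ≉ 0#
    ≉⇒≉0 k l x≉y x≉z = *-≉0 (^-≉0 k (≉⇒-≉0 x≉y)) (^-≉0 l (≉⇒-≉0 x≉z))

    -- The cofactor is the product of the other two root powers, nonzero at μ because the three
    -- roots are distinct.
    multiplicity : ∀ k a b {μ} y z → (∀ x → charPoly L x ≈ (x - μ) ^ k * ((x - y) ^ a * (x - z) ^ b)) → μ ≉ y → μ ≉ z →
      HasAlgebraicMultiplicity L μ k
    multiplicity k a b {μ} y z factors μ≉y μ≉z = rootPower a y b z ,
      (λ x → trans (factors x) (*-congˡ (sym (eval-rootPower a y b z x)))) ,
      λ eq → ≉⇒≉0 a b μ≉y μ≉z (trans (sym (eval-rootPower a y b z μ)) eq)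

    factors : ∀ x → charPoly L x ≈ (x - N) ^ 1 * ((x - ν) ^ suc e * (x - 0#) ^ suc f)
    factors x = trans (formula x) (*-cong (sym (*-identityʳ _)) (*-congˡ (^-congˡ (suc f) (sym (x-0≈x x)))))

    root⇒≈ : ∀ x → charPoly L x ≈ 0# → Any (λ (y , _) → x ≈ y) ((N , 1) ∷ (ν , suc e) ∷ (0# , suc f) ∷ [])
    root⇒≈ x Cx≈0 with x ≟ N | x ≟ ν | x ≟ 0#
    ... | yes x≈N | _       | _       = here x≈N
    ... | no  _   | yes x≈ν | _       = there (here x≈ν)
    ... | no  _   | no  _   | yes x≈0 = there (there (here x≈0))
    ... | no  x≉N | no  x≉ν | no  x≉0 =
      contradiction (trans (sym (factors x)) Cx≈0) (*-≉0 (^-≉0 1 (≉⇒-≉0 x≉N)) (≉⇒≉0 (suc e) (suc f) x≉ν x≉0))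

    eigenvalues : ∀ x → IsEigenvalue L x ⇔ Any (λ (y , _) → x ≈ y) ((N , 1) ∷ (ν , suc e) ∷ (0# , suc f) ∷ [])
    eigenvalues x = mk⇔ (λ eigenvalue → root⇒≈ x (charPoly-root {A = L} {x} L-symmetric eigenvalue)) λ
      { (here x≈N)                 → eigenvalue-resp {A = L} x≈N N-eigenvalue
      ; (there (here x≈ν))         → eigenvalue-resp {A = L} x≈ν (ν-eigenvalue 2<n)
      ; (there (there (here x≈0))) → eigenvalue-resp {A = L} x≈0 0-eigenvalue
      }

    spectrum : HasSpectrum L ((N , 1) ∷ (ν , suc e) ∷ (0# , suc f) ∷ [])
    spectrum = record
      { distinct       = (N≉ν ∷ N≉0 ∷ []) ∷ (ν≉0 ∷ []) ∷ [] ∷ []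
      ; eigenvalues    = eigenvalues
      ; multiplicities =
          multiplicity 1 (suc e) (suc f) ν 0# factors N≉ν N≉0 ∷
          multiplicity (suc e) 1 (suc f) N 0# (λ x → trans (factors x) (x∙yz≈y∙xz _ _ _)) (N≉ν ∘ sym) ν≉0 ∷
          multiplicity (suc f) 1 (suc e) N ν (λ x → trans (factors x) (x∙yz≈z∙xy _ _ _)) (N≉0 ∘ sym) (ν≉0 ∘ sym) ∷ []
      -- Since `n*d≡` concerns 3 + n d, the multiplicities are added up after adding 3 to both
      -- sides.
      ; exhaustive     = ℕ.+-cancelˡ-≡ 3 _ _ dimension
      }
      where
      open import Algebra.Properties.CommutativeSemigroup *-commutativeSemigroup using (x∙yz≈y∙xz; x∙yz≈z∙xy)
      dimension : 3 ℕ.+ (1 ℕ.+ (suc e ℕ.+ (suc f ℕ.+ 0))) ≡ 3 ℕ.+ n ℕ.* d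
      dimension = ≡.trans (≡.cong (λ k → 4 ℕ.+ (suc e ℕ.+ k)) (ℕ.+-identityʳ (suc f)))
        (≡.trans (≡.cong (ℕ._+ suc f) (≡.sym n+n≡)) (≡.trans (ℕ.+-assoc n n (suc f)) (≡.sym n*d≡)))

-- Arithmetic of the multiplicities

open import Data.Nat.Base using (_≤_; _+_; _*_; _∸_)

theorem2 : {c ℓ : Level} (R : CompleteOrderedField c ℓ) (F : ElementaryFunctions R) →
    let module R = CompleteOrderedField R
        open LinearAlgebra R
        open Rigidity F
    in (d n : ℕ) → 2 ≤ d → 3 ≤ n →
       (H : Subspace d) (u v : Vector R.Carrier d) → IsOrthonormalBasis H u v →
       HasSpectrum (stiffnessMatrix (regularPolygon n u v))
         ( (R.fromℕ n                       , 1)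
         ∷ (R.fromℕ n R.* R.fromℕ 2 R.⁻¹    , 2 * n ∸ 4)
         ∷ (R.0#                            , n * (d ∸ 2) + 3)
         ∷ [] )
-- Matching n as 3 + m and the dimension as 2 + d makes the truncated subtractions harmless: the
-- multiplicities are 2m + 2 and n d + 3, where d now stands for the codimension of H.
theorem2 R F (suc (suc d)) (suc (suc (suc m))) (ℕ.s≤s (ℕ.s≤s _)) 3≤n@(ℕ.s≤s (ℕ.s≤s (ℕ.s≤s _))) H u v onb =
  ≡.subst₂ (λ e f → HasSpectrum (stiffnessMatrix (regularPolygon n u v))
              ((R.fromℕ n , 1) ∷ (R.fromℕ n R.* R.fromℕ 2 R.⁻¹ , e) ∷ (R.0# , f) ∷ []))
    e≡ f≡ (RegularPolygon.Spectrum.spectrum F (2 + m) (2 + d) u v H onb 3≤n (suc (m + m)) (n * d + 2) n+n≡ n*d≡)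
  where
  module R = CompleteOrderedField R
  open LinearAlgebra R
  open Rigidity F
  open +-*-Solver
  n : ℕ
  n = 3 + m
  e≡ : suc (suc (m + m)) ≡ 2 * n ∸ 4
  e≡ = ≡.cong (_∸ 4) (solve 1 (λ m → con 6 :+ (m :+ m) := con 2 :* (con 3 :+ m)) ≡.refl m)
  f≡ : suc (n * d + 2) ≡ n * d + 3
  f≡ = ≡.sym (ℕ.+-suc (n * d) 2)
  n+n≡ : n + n ≡ 4 + suc (suc (m + m))
  n+n≡ = solve 1 (λ m → (con 3 :+ m) :+ (con 3 :+ m) := con 6 :+ (m :+ m)) ≡.refl m
  n*d≡ : 3 + n * (2 + d) ≡ n + (n + suc (n * d + 2))
  n*d≡ = solve 2 (λ m d → con 3 :+ (con 3 :+ m) :* (con 2 :+ d)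
    := (con 3 :+ m) :+ ((con 3 :+ m) :+ (con 1 :+ ((con 3 :+ m) :* d :+ con 2)))) ≡.refl m d
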